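{- Let $m,n$ be positive integers with $m<n$ and $m$ even, and let $G$ be a finite simple graph with maximum degree $\Delta(G)=3$. Then $\chi(G^{\frac{m}{n}})=\omega(G^{\frac{m}{n}})$.
   Context: For a graph $G$ and positive integer $n$, the $n$-subdivision $G^{\frac{1}{n}}$ is obtained from $G$ by replacing each edge with a path of length $n$. For a graph $H$ and positive integer $m$, the $m$-th power $H^m$ is the graph on $V(H)$ in which two distinct vertices are adjacent iff their distance in $H$ is at most $m$. The fractional power is $G^{\frac{m}{n}}=(G^{\frac{1}{n}})^m$. $\chi$ denotes the chromatic number and $\omega$ the clique number. -}

module Defs where

open import Data.Nat using (ℕ; zero; suc; _+_; _∸_; _≤_; _<_; _⊔_; _<?_)
open import Data.Nat.Divisibility using (_∣_)
open import Data.Fin using (Fin; fromℕ<)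
import Data.Fin as F
open import Data.Bool using (Bool; true; false; T; if_then_else_)
open import Data.List using (List; map; foldr)
open import Data.Nat.ListAction using (sum)
open import Data.List using () renaming (allFin to allFinL)
open import Data.Product using (Σ; ∃; _×_; _,_; proj₁; proj₂; Σ-syntax; ∃-syntax)
open import Data.Sum using (_⊎_; inj₁; inj₂)
open import Relation.Binary.PropositionalEquality using (_≡_; _≢_)
open import Relation.Nullary using (yes; no)

record FinGraph : Set where
  field
    N     : ℕ
    adj   : Fin N → Fin N → Bool
    sym   : ∀ u v → adj u v ≡ adj v u
    irref : ∀ u → adj u u ≡ false

open FinGraph public

degree : (G : FinGraph) → Fin (N G) → ℕ
degree G v = sum (map (λ u → if adj G v u then 1 else 0) (allFinL (N G)))

maxDegree : FinGraph → ℕ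
maxDegree G = foldr _⊔_ 0 (map (degree G) (allFinL (N G)))

record Graph : Set₁ where
  field
    V   : Set
    Adj : V → V → Set

open Graph public

data Walk (H : Graph) : V H → V H → ℕ → Set where
  here : ∀ x → Walk H x x 0
  step : ∀ {x y z ℓ} → Adj H x y → Walk H y z ℓ → Walk H x z (suc ℓ)

DistLe : (H : Graph) → V H → V H → ℕ → Set
DistLe H x y m = ∃[ ℓ ] (ℓ ≤ m × Walk H x y ℓ)

power : Graph → ℕ → Graph
power H m = record { V = V H ; Adj = λ x y → x ≢ y × DistLe H x y m }

-- n-subdivision G^{1/n}.  Each edge {u,v} (stored once, with u < v) is
-- replaced by the path u = p_0, p_1, ..., p_n = v, whose internal
-- vertices p_1..p_{n-1} are new vertices (e , i) with i : Fin (n ∸ 1).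

Edge : FinGraph → Set
Edge G = Σ[ u ∈ Fin (N G) ] Σ[ v ∈ Fin (N G) ] (u F.< v × T (adj G u v))

SubV : FinGraph → ℕ → Set
SubV G n = Fin (N G) ⊎ (Edge G × Fin (n ∸ 1))

-- position k (0 ≤ k ≤ n) along the path replacing edge e
pathPos : (G : FinGraph) (n : ℕ) → Edge G → ℕ → SubV G n
pathPos G n (u , v , _) zero = inj₁ u
pathPos G n e (suc k) with k <? n ∸ 1
... | yes p = inj₂ (e , fromℕ< p)
... | no _  = inj₁ (proj₁ (proj₂ e))

SubAdj : (G : FinGraph) (n : ℕ) → SubV G n → SubV G n → Set
SubAdj G n x y = Σ[ e ∈ Edge G ] Σ[ k ∈ ℕ ] (k < n ×
  ((pathPos G n e k ≡ x × pathPos G n e (suc k) ≡ y)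
   ⊎ (pathPos G n e k ≡ y × pathPos G n e (suc k) ≡ x)))

subdivision : FinGraph → ℕ → Graph
subdivision G n = record { V = SubV G n ; Adj = SubAdj G n }

fracPower : FinGraph → ℕ → ℕ → Graph
fracPower G m n = power (subdivision G n) m

Colourable : Graph → ℕ → Set
Colourable H k = Σ[ c ∈ (V H → Fin k) ] (∀ x y → Adj H x y → c x ≢ c y)

HasClique : Graph → ℕ → Set
HasClique H k = Σ[ f ∈ (Fin k → V H) ]
  (∀ i j → i ≢ j → (f i ≢ f j) × Adj H (f i) (f j))

IsChromaticNumber : Graph → ℕ → Set
IsChromaticNumber H k = Colourable H k × (∀ j → Colourable H j → k ≤ j)

IsCliqueNumber : Graph → ℕ → Set
IsCliqueNumber H k = HasClique H k × (∀ j → HasClique H j → j ≤ k)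

{-# OPTIONS --safe #-}
module Submission where

-- Let m = 2r.  The ball of radius r around a vertex of degree 3 is a clique of size 3r + 1, so it remains to colour
-- with 3r + 1 colours.  As 2r + 1 consecutive vertices of a subdivided edge receive different colours, repeating a
-- stretch of 2r + 1 of them reduces the length of the subdivided edges to n = 2r + 1 + t with 0 ≤ t ≤ 2r.
-- All branch vertices share one colour and the others form three classes of r colours; each of the three half-edges at
-- a vertex shows one class, in one of two orders that mostly reverse each other.
--  * If t ≤ r, the classes at the two ends of an edge differ, and the t middle vertices show the third class, for which
--    the orders at the two ends must be opposite.
--  * If t = r + 2z with z > 0, an edge may also have the same class at both ends, in opposite orders; if the classes
--    differ, all three classes must be in opposite orders, and the middle also shows z colours of each of these two.
--  * If t = r + 2z + 1, the classes have r - 1 colours, and the other four colours properly colour the branch vertices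
--    and the ends of the half-edges.
-- All these labellings come from a proper 4-edge-colouring, which exists by Vizing's Kempe chain argument, together
-- with 2-colourings of unions of two of its matchings.

open import Defs hiding (sym)
open import Data.Bool using (Bool; true; false; not; if_then_else_; T; _∧_; _xor_)
import Data.Bool.Properties as B
open import Data.Empty using (⊥; ⊥-elim)
open import Data.Fin using (Fin; zero; suc; toℕ; fromℕ<)
import Data.Fin as F
import Data.Fin.Properties as F
open import Data.List using (List; []; _∷_; map; foldr; tabulate; allFin; cartesianProduct)
open import Data.List.Membership.Propositional using (_∈_)
open import Data.List.Membership.Propositional.Properties using (∈-allFin; ∈-cartesianProduct⁺)
open import Data.List.Properties using (map-tabulate)
open import Data.List.Relation.Unary.Any using (here; there)
open import Data.Maybe using (Maybe; just; nothing)
import Data.Maybe.Properties as Maybeₚ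
open import Data.Nat using (ℕ; zero; suc; _+_; _*_; _∸_; _⊔_; _≤_; _<_; z≤n; s≤s; s≤s⁻¹; z<s; _≤?_; _<?_; _/_; _%_)
open import Data.Nat.DivMod using (m≡m%n+[m/n]*n; m%n<n)
open import Data.Nat.Divisibility using (_∣_; divides)
import Data.Nat.ListAction as ListAction
open import Data.Nat.Properties
open import Data.Nat.Tactic.RingSolver using (solve)
open import Data.Product using (∃; ∃₂; ∃-syntax; _×_; _,_; proj₁; proj₂)
open import Data.Sum using (_⊎_; inj₁; inj₂)
import Data.Sum.Properties as Sumₚ
open import Data.Unit using (⊤; tt)
open import Function using (_∘_; id)
open import Function.Bundles using (Equivalence)
open import Function.Definitions using (Injective)
open import Relation.Binary.Definitions using (tri<; tri≈; tri>)
open import Relation.Binary.PropositionalEquality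
  using (_≡_; _≢_; refl; sym; trans; cong; cong₂; subst; subst₂; ≢-sym; module ≡-Reasoning)
open import Relation.Nullary using (¬_; Dec; yes; no; does; contradiction; ¬?; from-yes)
open import Relation.Nullary.Decidable using (dec-true; dec-false; decidable-stable; _×-dec_; _⊎-dec_; _→-dec_)
open import Relation.Unary using (Decidable)

-- A linear consequence c ≤ d of the summed hypotheses A ≤ B, with slack s; the side equation is a semiring identity.
lin : ∀ {A B c d} s → A ≤ B → d + A ≡ c + B + s → c ≤ d
lin {A} {B} {c} {d} s h eq = +-cancelʳ-≤ A c d (begin
  c + A      ≤⟨ +-monoʳ-≤ c h ⟩
  c + B      ≤⟨ m≤m+n _ s ⟩
  c + B + s  ≡⟨ eq ⟨
  d + A      ∎)
  where open ≤-Reasoning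

lin-⊥ : ∀ {A B} s → A ≤ B → A ≡ 1 + B + s → ⊥
lin-⊥ s h eq = 1+n≰n {0} (lin s h eq)

infixr 4 _⊕_
_⊕_ : ∀ {a b c d} → a ≤ b → c ≤ d → a + c ≤ b + d
_⊕_ = +-mono-≤

least : ∀ {P : ℕ → Set} → Decidable P → ∀ k → P k → ∃ λ l → P l × (∀ i → i < l → ¬ P i)
least P? zero pk = zero , pk , λ _ ()
least {P} P? (suc k) pk with P? zero
... | yes p0 = zero , p0 , λ _ ()
... | no ¬p0 with least (λ i → P? (suc i)) k pk
... | l , pl , min = suc l , pl , λ { zero _ → ¬p0 ; (suc i) (s≤s i<l) → min i i<l }

-- Paths in the union of two matchings.

Involutive : ∀ {A : Set} → (A → A) → Set
Involutive f = ∀ w → f (f w) ≡ w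

-- The component of v in the union of two matchings, given as involutions a and b whose fixed points
-- are the unmatched vertices: if b misses v, it is a path starting in v.
module Component {N} (a b : Fin N → Fin N) (a² : Involutive a) (b² : Involutive b)
                 (v : Fin N) (bv : b v ≡ v) where

  turn : Bool → Fin N → Fin N
  turn false = a
  turn true  = b

  turn² : ∀ s → Involutive (turn s)
  turn² false = a²
  turn² true  = b²

  par : ℕ → Bool
  par zero    = false
  par (suc k) = not (par k)

  path : ℕ → Fin N
  path zero    = v
  path (suc k) = turn (par k) (path k)

  double : ℕ → ℕ
  double zero    = zero
  double (suc k) = suc (suc (double k))

  even : ℕ → Fin N
  even zero    = v
  even (suc k) = b (a (even k))

  par-double : ∀ k → par (double k) ≡ false
  par-double zero    = refl
  par-double (suc k) = trans (B.not-involutive _) (par-double k)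

  path-double : ∀ k → path (double k) ≡ even k
  path-double zero = refl
  path-double (suc k) rewrite par-double k = cong (λ w → b (a w)) (path-double k)

  -- Being involutions, `a` and `b` are injective, so the first `i` rounds cancel.
  even-return : ∀ i d → even i ≡ even (i + d) → even d ≡ v
  even-return zero    d eq = sym eq
  even-return (suc i) d eq = even-return i d (trans (sym (a² _)) (trans (cong a (trans (sym (b² _)) (trans (cong b eq) (b² _)))) (a² _)))

  Stall : ℕ → Set
  Stall k = path (suc k) ≡ path k

  -- By pigeonhole the rounds return to `v`. Since `b` fixes `v`, the vertex before the last
  -- `b`-step of the returning round is `v` as well, so that step stalls.
  stall : ∃ Stall
  stall with F.pigeonhole (n<1+n N) (λ i → even (toℕ i))
  ... | i , j , i<j , eq with m≤n⇒∃[o]m+o≡n i<j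
  ... | d , refl-d = suc (double d) , at-end
    where
    back : even (suc d) ≡ v
    back = even-return (toℕ i) (suc d) (trans eq (cong even (trans (sym refl-d) (sym (+-suc (toℕ i) d)))))
    odd : a (even d) ≡ v
    odd = trans (sym (b² _)) (trans (cong b back) bv)
    at-end : Stall (suc (double d))
    at-end rewrite par-double d | path-double d = trans back (sym odd)

  abstract
    first-stall : ∃ λ l → Stall l × (∀ i → i < l → ¬ Stall i)
    first-stall = least (λ k → path (suc k) F.≟ path k) (proj₁ stall) (proj₂ stall)

  end : ℕ
  end = proj₁ first-stall

  no-stall : ∀ {i} → i < end → ¬ Stall i
  no-stall = proj₂ (proj₂ first-stall) _

  In : Fin N → Set
  In w = ∃ λ i → i < suc end × path i ≡ w

  abstract
    In? : Decidable In
    In? w = anyUpTo? (λ i → path i F.≟ w) (suc end)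

  In-start : In v
  In-start = zero , z<s , refl

  -- The involution by which the path does not leave `path i` is the one by which it entered; at the
  -- start it is `b`, which fixes `v`.
  step-back : ∀ s i → par i ≢ s → (i ≡ zero × turn s (path i) ≡ v) ⊎ ∃ λ j → i ≡ suc j × turn s (path i) ≡ path j
  step-back false zero p≢s = contradiction refl p≢s
  step-back true  zero _   = inj₁ (refl , bv)
  step-back s (suc j) p≢s = inj₂ (j , refl , eq)
    where
    par-j : par j ≡ s
    par-j = trans (sym (B.not-involutive _)) (trans (cong not (B.¬-not p≢s)) (B.not-involutive s))
    eq : turn s (path (suc j)) ≡ path j
    eq rewrite par-j = turn² s _

  In-turn : ∀ s {w} → In w → In (turn s w)
  In-turn s (i , i≤l , refl) with par i B.≟ s
  ... | no p≢s with step-back s i p≢s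
  ...   | inj₁ (refl , eq)     = zero , z<s , sym eq
  ...   | inj₂ (j , refl , eq) = j , <-trans (n<1+n j) i≤l , sym eq
  In-turn s (i , i≤l , refl) | yes refl with m<1+n⇒m<n∨m≡n i≤l
  ...   | inj₁ i<l  = suc i , s≤s i<l , refl
  ...   | inj₂ refl = i , i≤l , sym (proj₁ (proj₂ first-stall))

  In-turn⁻ : ∀ s {w} → In (turn s w) → In w
  In-turn⁻ s p = subst In (turn² s _) (In-turn s p)

  -- A vertex of the path other than `v` and the end is moved by both involutions, since no step
  -- before `end` stalls. Hence two vertices of the path, both different from `v` and each missed by
  -- one of the matchings, coincide; the Kempe chain argument rests on this.
  In-end : ∀ s {w} → In w → turn s w ≡ w → w ≢ v → w ≡ path end
  In-end s (i , i≤l , refl) fix w≢v with par i B.≟ s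
  ... | no p≢s with step-back s i p≢s
  ...   | inj₁ (refl , _)      = contradiction refl w≢v
  ...   | inj₂ (j , refl , eq) = contradiction (trans (sym fix) eq) (no-stall (s≤s⁻¹ i≤l))
  In-end s (i , i≤l , refl) fix w≢v | yes refl with m<1+n⇒m<n∨m≡n i≤l
  ...   | inj₁ i<l  = contradiction fix (no-stall i<l)
  ...   | inj₂ refl = refl

  -- A 2-colouring alternates along the path, and the path ends with an a-edge if b misses its end.
  In-b-free : ∀ (x : Fin N → Bool) → (∀ s w → turn s w ≢ w → x (turn s w) ≡ not (x w)) →
              ∀ {w} → In w → b w ≡ w → w ≢ v → x w ≡ not (x v)
  In-b-free x alt {w} w∈ fix w≢v = trans (cong x w≡end) (trans (alternates end ≤-refl) (odd-end end refl))
    where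
    w≡end : w ≡ path end
    w≡end = In-end true w∈ fix w≢v
    flip : Bool → Bool → Bool
    flip p c = if p then not c else c
    flip-not : ∀ p c → not (flip p c) ≡ flip (not p) c
    flip-not true  c = B.not-involutive c
    flip-not false c = refl
    alternates : ∀ i → i ≤ end → x (path i) ≡ flip (par i) (x v)
    alternates zero    _   = refl
    alternates (suc i) i<l = trans (alt (par i) (path i) (no-stall i<l))
      (trans (cong not (alternates i (<⇒≤ i<l))) (flip-not (par i) (x v)))
    odd-end : ∀ l → l ≡ end → flip (par l) (x v) ≡ not (x v)
    odd-end zero    refl-l = contradiction (trans w≡end (cong path (sym refl-l))) w≢v
    odd-end (suc l) refl-l with par l in par-l
    ... | false = refl
    ... | true  = contradiction stalls (no-stall (≤-reflexive refl-l))
      where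
      stalls : Stall l
      stalls = trans (sym (trans (cong b (cong path refl-l)) (trans (cong b (sym w≡end)) (trans fix (trans w≡end (cong path (sym refl-l)))))))
                     (trans (cong (λ s → b (turn s (path l))) par-l) (b² _))

-- 2-colourings of the union of two matchings.

Alternating : ∀ {N} → (Fin N → Bool) → (Fin N → Fin N) → Set
Alternating x f = ∀ w → f w ≢ w → x (f w) ≡ not (x w)

module _ {N} (a b : Fin N → Fin N) (a² : Involutive a) (b² : Involutive b) where

  abstract
    -- The part of `b` on the vertices numbered below `k`. Passing from `k` to `suc k` adds at most
    -- one edge, the one at the vertex numbered `k`.
    below : ℕ → Fin N → Fin N
    below k w = if does ((toℕ w <? k) ×-dec (toℕ (b w) <? k)) then b w else w

    below-yes : ∀ {k w} → toℕ w < k → toℕ (b w) < k → below k w ≡ b w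
    below-yes {k} {w} p q rewrite dec-true ((toℕ w <? k) ×-dec (toℕ (b w) <? k)) (p , q) = refl

    below-no : ∀ {k w} → ¬ (toℕ w < k × toℕ (b w) < k) → below k w ≡ w
    below-no {k} {w} p rewrite dec-false ((toℕ w <? k) ×-dec (toℕ (b w) <? k)) p = refl

    below² : ∀ k → Involutive (below k)
    below² k w with (toℕ w <? k) ×-dec (toℕ (b w) <? k)
    ... | no p        = trans (cong (below k) (below-no p)) (below-no p)
    ... | yes (p , q) = trans (cong (below k) (below-yes p q)) (trans (below-yes q (subst (λ z → toℕ z < k) (sym (b² w)) p)) (b² w))

  -- Let the edge from `u` to `t` be added. Both ends are missed by `below k`, so if they lie in one
  -- component of the old union, `In-b-free` shows that their colours already differ. If the colours
  -- agree, `t` is outside the component of `u`, which can be flipped.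
  partial-2-colouring : ∀ k → ∃ λ x → Alternating x a × Alternating x (below k)
  partial-2-colouring zero = x , alt , λ w moved → contradiction (below-no (λ ())) moved
    where
    x : Fin N → Bool
    x w = does (toℕ w <? toℕ (a w))
    alt : Alternating x a
    alt w moved rewrite a² w with <-cmp (toℕ w) (toℕ (a w))
    ... | tri< p _ q = trans (dec-false (_ <? _) q) (cong not (sym (dec-true (_ <? _) p)))
    ... | tri≈ _ p _ = contradiction (sym (F.toℕ-injective p)) moved
    ... | tri> p _ q = trans (dec-true (_ <? _) q) (cong not (sym (dec-false (_ <? _) p)))
  partial-2-colouring (suc k) with partial-2-colouring k | k <? N
  ... | x , xa , xb | no k≮N = x , xa , λ w moved → subst (λ z → x z ≡ not (x w)) (sym (same w)) (xb w (λ eq → moved (trans (same w) eq)))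
    where
    small : ∀ w → toℕ w < k
    small w = <-≤-trans (F.toℕ<n w) (≮⇒≥ k≮N)
    same : ∀ w → below (suc k) w ≡ below k w
    same w = trans (below-yes (m<n⇒m<1+n (small w)) (m<n⇒m<1+n (small (b w)))) (sym (below-yes (small w) (small (b w))))
  ... | x , xa , xb | yes k<N = result
    where
    u t : Fin N
    u = F.fromℕ< k<N
    t = b u
    u≡k : toℕ u ≡ k
    u≡k = F.toℕ-fromℕ< k<N
    at-k : ∀ {w} → ¬ (toℕ w < k) → toℕ w < suc k → w ≡ u
    at-k p q = F.toℕ-injective (trans (≤-antisym (s≤s⁻¹ q) (≮⇒≥ p)) (sym u≡k))
    u-free : below k u ≡ u
    u-free = below-no (λ p → <-irrefl u≡k (proj₁ p))
    open Component a (below k) a² (below² k) u u-free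
    t-free : below k t ≡ t
    t-free = below-no (λ p → <-irrefl u≡k (subst (λ z → toℕ z < k) (b² u) (proj₂ p)))
    alt : ∀ s w → turn s w ≢ w → x (turn s w) ≡ not (x w)
    alt false = xa
    alt true  = xb
    combine : (x′ : Fin N → Bool) → Alternating x′ (below k) → (t ≢ u → x′ t ≡ not (x′ u)) → Alternating x′ (below (suc k))
    combine x′ xb′ new w moved with (toℕ w <? suc k) ×-dec (toℕ (b w) <? suc k)
    ... | no ¬pq = contradiction (below-no ¬pq) moved
    ... | yes (p , q) = trans (cong x′ (below-yes p q)) (split (λ eq → moved (trans (below-yes p q) eq)) (toℕ w <? k) (toℕ (b w) <? k))
      where
      split : b w ≢ w → Dec (toℕ w < k) → Dec (toℕ (b w) < k) → x′ (b w) ≡ not (x′ w)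
      split moved (yes p′) (yes q′) = subst (λ z → x′ z ≡ not (x′ w)) (below-yes p′ q′) (xb′ w (λ eq → moved (trans (sym (below-yes p′ q′)) eq)))
      split moved (no p′)  _ = subst (λ z → x′ (b z) ≡ not (x′ z)) (sym w≡u) (new (λ eq → moved (trans (cong b w≡u) (trans eq (sym w≡u)))))
        where
        w≡u : w ≡ u
        w≡u = at-k p′ p
      split moved (yes p′) (no q′) = trans (cong x′ bw≡u) (trans (sym (B.not-involutive _)) (cong not (sym (trans (cong x′ w≡t) (new t≢u)))))
        where
        bw≡u : b w ≡ u
        bw≡u = at-k q′ q
        w≡t : w ≡ t
        w≡t = trans (sym (b² w)) (cong b bw≡u)
        t≢u : t ≢ u
        t≢u eq = moved (trans bw≡u (sym (trans w≡t eq)))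
    result : ∃ λ x → Alternating x a × Alternating x (below (suc k))
    result with x t B.≟ not (x u)
    ... | yes differ = x , xa , combine x xb (λ _ → differ)
    ... | no agree = x′ , (λ w → flipped false w) , combine x′ (flipped true) new
      where
      x′ : Fin N → Bool
      x′ w = if does (In? w) then not (x w) else x w
      flipped : ∀ s → Alternating x′ (turn s)
      flipped s w moved with In? w | In? (turn s w)
      ... | yes p | yes q = cong not (alt s w moved)
      ... | no p  | no q  = alt s w moved
      ... | yes p | no q  = contradiction (In-turn s p) q
      ... | no p  | yes q = contradiction (In-turn⁻ s q) p
      new : t ≢ u → x′ t ≡ not (x′ u)
      new t≢u with In? t | In? u
      ... | yes p | _     = contradiction (In-b-free x alt p t-free t≢u) agree
      ... | no _  | yes _ = trans (B.¬-not agree) refl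
      ... | no _  | no q  = contradiction In-start q

  2-colouring : ∃ λ x → Alternating x a × Alternating x b
  2-colouring with partial-2-colouring N
  ... | x , xa , xb = x , xa , λ w moved → subst (λ z → x z ≡ not (x w)) (full w) (xb w (λ eq → moved (trans (sym (full w)) eq)))
    where
    full : ∀ w → below N w ≡ b w
    full w = below-yes (F.toℕ<n w) (F.toℕ<n (b w))

-- Functions that are constant along orbits.

-- Follow step until it stops; after N steps it has stopped or never will.
module Follow {N} (step : Fin N → Fin N) where

  after : ℕ → Fin N → Fin N
  after zero    w = w
  after (suc k) w = after k (step w)

  after-step : ∀ k w → after k (step w) ≡ step (after k w)
  after-step zero    w = refl
  after-step (suc k) w = after-step k (step w)

  after-+ : ∀ i j w → after (i + j) w ≡ after j (after i w)
  after-+ zero    j w = refl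
  after-+ (suc i) j w = after-+ i j (step w)

  after-fixed : ∀ k {w} → step w ≡ w → after k w ≡ w
  after-fixed zero    fix = refl
  after-fixed (suc k) fix = trans (cong (after k) fix) (after-fixed k fix)

  -- Two of the first `N + 1` points of the orbit are equal, so `after N w` recurs at a later time,
  -- when the orbit already rests at `step (after N w)`.
  settled : ∀ w → step (step (after N w)) ≡ step (after N w) → step (after N w) ≡ after N w
  settled w stop with F.pigeonhole (n<1+n N) (λ i → after (toℕ i) w)
  ... | i , j , i<j , eq with m≤n⇒∃[o]m+o≡n i<j | m≤n⇒∃[o]m+o≡n (F.toℕ≤pred[n] i)
  ...   | d , i+1+d≡j | e , i+e≡N = sym (begin
    after N w                       ≡⟨ cong (λ k → after k w) i+e≡N ⟨
    after (toℕ i + e) w             ≡⟨ after-+ (toℕ i) e w ⟩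
    after e (after (toℕ i) w)       ≡⟨ cong (after e) eq ⟩
    after e (after (toℕ j) w)       ≡⟨ after-+ (toℕ j) e w ⟨
    after (toℕ j + e) w             ≡⟨ cong (λ k → after k w) late ⟩
    after (N + suc d) w             ≡⟨ after-+ N (suc d) w ⟩
    after d (step (after N w))      ≡⟨ after-fixed d stop ⟩
    step (after N w)                ∎)
    where
    open ≡-Reasoning
    shift : ∀ x y n → suc x + d ≡ y → x + e ≡ n → y + e ≡ n + suc d
    shift x y n p q = ≤-antisym (lin 0 (≤-reflexive (sym p) ⊕ ≤-reflexive q) (solve (y ∷ e ∷ n ∷ d ∷ x ∷ []))) (lin 0 (≤-reflexive p ⊕ ≤-reflexive (sym q)) (solve (y ∷ e ∷ n ∷ d ∷ x ∷ [])))
    late : toℕ j + e ≡ N + suc d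
    late = shift (toℕ i) (toℕ j) N i+1+d≡j i+e≡N

  constant-along : ∀ (off : Fin N → Bool) → ∃ λ (R : Fin N → Bool) → (∀ w → R (step w) ≡ R w) × (∀ w → step w ≡ w → R w ≡ off w)
  constant-along off = R , along , fixed
    where
    -- Orbits that never stop contain no fixed point, so the constant `false` satisfies both
    -- requirements on them.
    stopped : Fin N → Bool
    stopped z = if does (step z F.≟ z) then off z else false
    R : Fin N → Bool
    R w = stopped (after N w)
    fixed : ∀ w → step w ≡ w → R w ≡ off w
    fixed w fix rewrite after-fixed N fix | dec-true (step w F.≟ w) fix = refl
    along : ∀ w → R (step w) ≡ R w
    along w rewrite after-step N w with step (after N w) F.≟ after N w
    ... | yes fix rewrite fix | dec-true (step (after N w) F.≟ after N w) fix = refl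
    ... | no ¬fix rewrite dec-false (step (step (after N w)) F.≟ step (after N w)) (λ eq → ¬fix (settled w eq)) = refl

-- Counting neighbours, and the maximum degree.

indicator : Bool → ℕ
indicator b = if b then 1 else 0

count : ∀ n → (Fin n → Bool) → ℕ
count zero    P = 0
count (suc n) P = indicator (P zero) + count n (P ∘ suc)

sum-tabulate : ∀ n (P : Fin n → Bool) → ListAction.sum (tabulate (indicator ∘ P)) ≡ count n P
sum-tabulate zero    P = refl
sum-tabulate (suc n) P = cong (indicator (P zero) +_) (sum-tabulate n (P ∘ suc))

degree-count : ∀ G v → degree G v ≡ count (N G) (adj G v)
degree-count G v = trans (cong ListAction.sum (map-tabulate id (indicator ∘ adj G v))) (sum-tabulate (N G) (adj G v))

enumerate : ∀ n (P : Fin n → Bool) → ∃ λ (f : Fin (count n P) → Fin n) → Injective _≡_ _≡_ f × (∀ i → P (f i) ≡ true)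
enumerate zero P = (λ ()) , (λ { {()} }) , λ ()
enumerate (suc n) P with P zero in P0 | enumerate n (P ∘ suc)
... | false | f , inj , Pf = suc ∘ f , inj ∘ F.suc-injective , Pf
... | true  | f , inj , Pf = g , g-inj , Pg
  where
  g : Fin (suc (count n (P ∘ suc))) → Fin (suc n)
  g zero    = zero
  g (suc i) = suc (f i)
  g-inj : Injective _≡_ _≡_ g
  g-inj {zero}  {zero}  _  = refl
  g-inj {suc i} {suc j} eq = cong suc (inj (F.suc-injective eq))
  Pg : ∀ i → P (g i) ≡ true
  Pg zero    = P0
  Pg (suc i) = Pf i

-- A variable `b` in place of `P zero` lets the type `Fin (indicator b + k)` reduce by matching on
-- `b`.
here-index : ∀ {k} b → b ≡ true → Fin (indicator b + k)
here-index true _ = zero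

later-index : ∀ {k} b → Fin k → Fin (indicator b + k)
later-index true  x = suc x
later-index false x = x

here≢later : ∀ {k} b (p : b ≡ true) (x : Fin k) → here-index b p ≢ later-index b x
here≢later true p x ()

later-injective : ∀ {k} b {x y : Fin k} → later-index b x ≡ later-index b y → x ≡ y
later-injective true  eq = F.suc-injective eq
later-injective false eq = eq

rank : ∀ n (P : Fin n → Bool) → ∀ x → P x ≡ true → Fin (count n P)
rank (suc n) P zero    p = here-index (P zero) p
rank (suc n) P (suc x) p = later-index (P zero) (rank n (P ∘ suc) x p)

rank-injective : ∀ n (P : Fin n → Bool) {x y} (p : P x ≡ true) (q : P y ≡ true) → rank n P x p ≡ rank n P y q → x ≡ y
rank-injective (suc n) P {zero}  {zero}  p q eq = refl
rank-injective (suc n) P {zero}  {suc y} p q eq = contradiction eq (here≢later (P zero) p _)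
rank-injective (suc n) P {suc x} {zero}  p q eq = contradiction (sym eq) (here≢later (P zero) q _)
rank-injective (suc n) P {suc x} {suc y} p q eq = cong suc (rank-injective n (P ∘ suc) p q (later-injective (P zero) eq))

count-≥ : ∀ {k} n (P : Fin n → Bool) (f : Fin k → Fin n) → Injective _≡_ _≡_ f → (∀ i → P (f i) ≡ true) → k ≤ count n P
count-≥ n P f inj Pf = F.injective⇒≤ {f = λ i → rank n P (f i) (Pf i)} (λ eq → inj (rank-injective n P _ _ eq))

max-≥ : ∀ {A : Set} (f : A → ℕ) {x} xs → x ∈ xs → f x ≤ foldr _⊔_ 0 (map f xs)
max-≥ f (x ∷ xs) (here refl) = m≤m⊔n _ _
max-≥ f (x ∷ xs) (there p)   = ≤-trans (max-≥ f xs p) (m≤n⊔m (f x) _)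

max-attained : ∀ {A : Set} (f : A → ℕ) {k} xs → foldr _⊔_ 0 (map f xs) ≡ suc k → ∃ λ x → f x ≡ suc k
max-attained f (x ∷ xs) eq with ⊔-sel (f x) (foldr _⊔_ 0 (map f xs))
... | inj₁ left  = x , trans (sym left) eq
... | inj₂ right = max-attained f xs (trans (sym right) eq)

-- A proper 4-edge-colouring of a subcubic graph.

module EdgeColouring {n : ℕ} (adjacent : Fin n → Fin n → Bool)
  (symmetric : ∀ u v → adjacent u v ≡ adjacent v u) (irreflexive : ∀ u → adjacent u u ≡ false)
  (subcubic : ∀ u (f : Fin 4 → Fin n) → Injective _≡_ _≡_ f → ¬ (∀ i → adjacent u (f i) ≡ true)) where

  -- A partial proper edge-colouring: `mate i w` is the other end of the edge of colour `i` at `w`,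
  -- or `w` itself if there is none. Having a function for each colour makes properness automatic;
  -- `disjoint` keeps an edge from having two colours.
  record Matchings : Set where
    field
      mate       : Fin 4 → Fin n → Fin n
      involutive : ∀ i → Involutive (mate i)
      edge       : ∀ i w → mate i w ≢ w → adjacent w (mate i w) ≡ true
      disjoint   : ∀ i j w → mate i w ≡ mate j w → mate i w ≢ w → i ≡ j

    Covered : Fin n → Fin n → Set
    Covered x y = ∃ λ i → mate i x ≡ y

    Free : Fin n → Fin 4 → Set
    Free x i = mate i x ≡ x

    free? : ∀ x i → Dec (Free x i)
    free? x i = mate i x F.≟ x

    Covered-sym : ∀ {x y} → Covered x y → Covered y x
    Covered-sym (i , refl) = i , involutive i _

  open Matchings

  adjacent⇒≢ : ∀ {u v} → adjacent u v ≡ true → u ≢ v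
  adjacent⇒≢ {u} uv refl with () ← trans (sym uv) (irreflexive u)

  four-neighbours : ∀ {u a b c d} → adjacent u a ≡ true → adjacent u b ≡ true → adjacent u c ≡ true → adjacent u d ≡ true →
    a ≢ b → a ≢ c → a ≢ d → b ≢ c → b ≢ d → c ≢ d → ⊥
  four-neighbours {u} {a} {b} {c} {d} ua ub uc ud ab ac ad bc bd cd = subcubic u f inj adj-f
    where
    f : Fin 4 → Fin n
    f zero                   = a
    f (suc zero)             = b
    f (suc (suc zero))       = c
    f (suc (suc (suc zero))) = d
    adj-f : ∀ i → adjacent u (f i) ≡ true
    adj-f zero                   = ua
    adj-f (suc zero)             = ub
    adj-f (suc (suc zero))       = uc
    adj-f (suc (suc (suc zero))) = ud
    inj : Injective _≡_ _≡_ f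
    inj {zero}                   {zero}                   _ = refl
    inj {zero}                   {suc zero}               e = contradiction e ab
    inj {zero}                   {suc (suc zero)}         e = contradiction e ac
    inj {zero}                   {suc (suc (suc zero))}   e = contradiction e ad
    inj {suc zero}               {zero}                   e = contradiction (sym e) ab
    inj {suc zero}               {suc zero}               _ = refl
    inj {suc zero}               {suc (suc zero)}         e = contradiction e bc
    inj {suc zero}               {suc (suc (suc zero))}   e = contradiction e bd
    inj {suc (suc zero)}         {zero}                   e = contradiction (sym e) ac
    inj {suc (suc zero)}         {suc zero}               e = contradiction (sym e) bc
    inj {suc (suc zero)}         {suc (suc zero)}         _ = refl
    inj {suc (suc zero)}         {suc (suc (suc zero))}   e = contradiction e cd
    inj {suc (suc (suc zero))}   {zero}                   e = contradiction (sym e) ad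
    inj {suc (suc (suc zero))}   {suc zero}               e = contradiction (sym e) bd
    inj {suc (suc (suc zero))}   {suc (suc zero)}         e = contradiction (sym e) cd
    inj {suc (suc (suc zero))}   {suc (suc (suc zero))}   _ = refl

  module _ (M : Matchings) where

    mates-differ : ∀ {w i j} → i ≢ j → ¬ Free M w i → mate M i w ≢ mate M j w
    mates-differ i≢j used eq = i≢j (disjoint M _ _ _ eq used)

    four-used : ∀ {w i j k l} → i ≢ j → i ≢ k → i ≢ l → j ≢ k → j ≢ l → k ≢ l →
      ¬ Free M w i → ¬ Free M w j → ¬ Free M w k → Free M w l
    four-used {w} {i} {j} {k} {l} ij ik il jk jl kl fi fj fk with free? M w l
    ... | yes free = free
    ... | no fl = ⊥-elim (four-neighbours (edge M i w fi) (edge M j w fj) (edge M k w fk) (edge M l w fl)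
      (mates-differ ij fi) (mates-differ ik fi) (mates-differ il fi) (mates-differ jk fj) (mates-differ jl fj) (mates-differ kl fk))

    -- The uncoloured edge `uv` occupies one of the at most three places at `u`.
    three-used : ∀ {u v i j k} → adjacent u v ≡ true → ¬ Covered M u v → i ≢ j → i ≢ k → j ≢ k →
      ¬ Free M u i → ¬ Free M u j → Free M u k
    three-used {u} {v} {i} {j} {k} uv new ij ik jk fi fj with free? M u k
    ... | yes free = free
    ... | no fk = ⊥-elim (four-neighbours uv (edge M i u fi) (edge M j u fj) (edge M k u fk)
      (λ e → new (i , sym e)) (λ e → new (j , sym e)) (λ e → new (k , sym e))
      (mates-differ ij fi) (mates-differ ik fi) (mates-differ jk fj))

    record TwoFree (u : Fin n) : Set where
      constructor twoFree
      field
        {α γ β δ} : Fin 4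
        α≢γ : α ≢ γ
        α≢β : α ≢ β
        α≢δ : α ≢ δ
        γ≢β : γ ≢ β
        γ≢δ : γ ≢ δ
        β≢δ : β ≢ δ
        αu  : Free M u α
        γu  : Free M u γ

    one-of-three : ∀ {u v} i j k → adjacent u v ≡ true → ¬ Covered M u v → i ≢ j → i ≢ k → j ≢ k →
      Free M u i ⊎ Free M u j ⊎ Free M u k
    one-of-three {u} i j k uv new ij ik jk with free? M u i | free? M u j
    ... | yes p | _     = inj₁ p
    ... | no _  | yes q = inj₂ (inj₁ q)
    ... | no p  | no q  = inj₂ (inj₂ (three-used uv new ij ik jk p q))

    two-free : ∀ {u v} → adjacent u v ≡ true → ¬ Covered M u v → TwoFree u
    two-free uv new with one-of-three zero (suc zero) (suc (suc zero)) uv new (λ ()) (λ ()) (λ ())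
    two-free uv new | inj₁ p with one-of-three (suc zero) (suc (suc zero)) (suc (suc (suc zero))) uv new (λ ()) (λ ()) (λ ())
    ... | inj₁ q        = twoFree {β = suc (suc zero)} {suc (suc (suc zero))} (λ ()) (λ ()) (λ ()) (λ ()) (λ ()) (λ ()) p q
    ... | inj₂ (inj₁ q) = twoFree {β = suc zero} {suc (suc (suc zero))} (λ ()) (λ ()) (λ ()) (λ ()) (λ ()) (λ ()) p q
    ... | inj₂ (inj₂ q) = twoFree {β = suc zero} {suc (suc zero)} (λ ()) (λ ()) (λ ()) (λ ()) (λ ()) (λ ()) p q
    two-free uv new | inj₂ (inj₁ p) with one-of-three zero (suc (suc zero)) (suc (suc (suc zero))) uv new (λ ()) (λ ()) (λ ())
    ... | inj₁ q        = twoFree {β = suc (suc zero)} {suc (suc (suc zero))} (λ ()) (λ ()) (λ ()) (λ ()) (λ ()) (λ ()) p q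
    ... | inj₂ (inj₁ q) = twoFree {β = zero} {suc (suc (suc zero))} (λ ()) (λ ()) (λ ()) (λ ()) (λ ()) (λ ()) p q
    ... | inj₂ (inj₂ q) = twoFree {β = zero} {suc (suc zero)} (λ ()) (λ ()) (λ ()) (λ ()) (λ ()) (λ ()) p q
    two-free uv new | inj₂ (inj₂ p) with one-of-three zero (suc zero) (suc (suc (suc zero))) uv new (λ ()) (λ ()) (λ ())
    ... | inj₁ q        = twoFree {β = suc zero} {suc (suc (suc zero))} (λ ()) (λ ()) (λ ()) (λ ()) (λ ()) (λ ()) p q
    ... | inj₂ (inj₁ q) = twoFree {β = zero} {suc (suc (suc zero))} (λ ()) (λ ()) (λ ()) (λ ()) (λ ()) (λ ()) p q
    ... | inj₂ (inj₂ q) = twoFree {β = zero} {suc zero} (λ ()) (λ ()) (λ ()) (λ ()) (λ ()) (λ ()) p q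

  Extends : Matchings → Matchings → Set
  Extends M M′ = ∀ {x y} → x ≢ y → Covered M x y → Covered M′ x y

  module Add (M : Matchings) {u v} (uv : adjacent u v ≡ true) (new : ¬ Covered M u v)
             (c : Fin 4) (cu : Free M u c) (cv : Free M v c) where

    u≢v : u ≢ v
    u≢v = adjacent⇒≢ uv

    new-mate : Fin 4 → Fin n → Fin n
    new-mate i w with i F.≟ c | w F.≟ u | w F.≟ v
    ... | no _  | _     | _     = mate M i w
    ... | yes _ | yes _ | _     = v
    ... | yes _ | no _  | yes _ = u
    ... | yes _ | no _  | no _  = mate M i w

    at-u : new-mate c u ≡ v
    at-u with c F.≟ c | u F.≟ u
    ... | yes _ | yes _ = refl
    ... | no ¬p | _     = contradiction refl ¬p
    ... | yes _ | no ¬p = contradiction refl ¬p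

    at-v : new-mate c v ≡ u
    at-v with c F.≟ c | v F.≟ u | v F.≟ v
    ... | yes _ | yes p | _     = contradiction (sym p) u≢v
    ... | yes _ | no _  | yes _ = refl
    ... | no ¬p | _     | _     = contradiction refl ¬p
    ... | yes _ | no _  | no ¬p = contradiction refl ¬p

    old-colour : ∀ {i} w → i ≢ c → new-mate i w ≡ mate M i w
    old-colour {i} w i≢c with i F.≟ c
    ... | yes p = contradiction p i≢c
    ... | no _  = refl

    old-vertex : ∀ i {w} → w ≢ u → w ≢ v → new-mate i w ≡ mate M i w
    old-vertex i {w} w≢u w≢v with i F.≟ c | w F.≟ u | w F.≟ v
    ... | no _  | _     | _     = refl
    ... | yes _ | yes p | _     = contradiction p w≢u
    ... | yes _ | no _  | yes p = contradiction p w≢v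
    ... | yes _ | no _  | no _  = refl

    data View : Fin 4 → Fin n → Set where
      first  : View c u
      second : View c v
      old    : ∀ {i w} → new-mate i w ≡ mate M i w → new-mate i (mate M i w) ≡ mate M i (mate M i w) → View i w

    view : ∀ i w → View i w
    view i w with i F.≟ c
    ... | no i≢c = old (old-colour w i≢c) (old-colour (mate M i w) i≢c)
    ... | yes refl with w F.≟ u | w F.≟ v
    ...   | yes refl | _        = first
    ...   | no _     | yes refl = second
    ...   | no w≢u   | no w≢v   = old (old-vertex c w≢u w≢v)
      (old-vertex c (λ e → w≢u (trans (sym (involutive M c w)) (trans (cong (mate M c) e) cu)))
                    (λ e → w≢v (trans (sym (involutive M c w)) (trans (cong (mate M c) e) cv))))

    -- If the new edge agreed at `w` with an edge of an old colour, `uv` would have been covered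
    -- before.
    not-both : ∀ {i j w} → i ≢ c → new-mate j w ≡ mate M i w → View j w → new-mate j w ≡ mate M j w
    not-both {i} i≢c e first  = contradiction (i , trans (sym e) at-u) new
    not-both {i} i≢c e second = contradiction (Covered-sym M (i , trans (sym e) at-v)) new
    not-both     i≢c e (old p _) = p

    add : Matchings
    add .mate = new-mate
    add .involutive i w with view i w
    ... | first   = trans (cong (new-mate c) at-u) at-v
    ... | second  = trans (cong (new-mate c) at-v) at-u
    ... | old p q = trans (cong (new-mate i) p) (trans q (involutive M i w))
    add .edge i w moved with view i w
    ... | first   = trans (cong (adjacent u) at-u) uv
    ... | second  = trans (cong (adjacent v) at-v) (trans (symmetric v u) uv)
    ... | old p _ = trans (cong (adjacent w) p) (edge M i w (λ e → moved (trans p e)))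
    add .disjoint i j w e moved = compare (i F.≟ c) (j F.≟ c)
      where
      compare : Dec (i ≡ c) → Dec (j ≡ c) → i ≡ j
      compare (yes p)  (yes q)  = trans p (sym q)
      compare (no i≢c) (no j≢c) = disjoint M i j w (trans (sym (old-colour w i≢c)) (trans e (old-colour w j≢c)))
        (λ f → moved (trans (old-colour w i≢c) f))
      compare (no i≢c) (yes _)  = disjoint M i j w (trans (sym (old-colour w i≢c)) (trans e p)) (λ f → moved (trans (old-colour w i≢c) f))
        where
        p : new-mate j w ≡ mate M j w
        p = not-both i≢c (trans (sym e) (old-colour w i≢c)) (view j w)
      compare (yes _)  (no j≢c) = disjoint M i j w (trans (sym p) (trans e (old-colour w j≢c))) (λ f → moved (trans p f))
        where
        p : new-mate i w ≡ mate M i w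
        p = not-both j≢c (trans e (old-colour w j≢c)) (view i w)

    extends : Extends M add
    extends {x} x≢y (i , refl) with view i x
    ... | first   = contradiction (sym cu) x≢y
    ... | second  = contradiction (sym cv) x≢y
    ... | old p _ = i , p

    Result : Set
    Result = ∃ λ M′ → Extends M M′ × Covered M′ u v

    result : Result
    result = add , extends , c , at-u

  -- A Kempe exchange on any set closed under both mates, not only on one component: it is applied
  -- to a chain, to the complement of a chain, and to the two ends of a single edge.
  module Swap (M : Matchings) (α β : Fin 4) (α≢β : α ≢ β) {P : Fin n → Set} (P? : Decidable P)
              (Pα : ∀ {w} → P w → P (mate M α w)) (Pβ : ∀ {w} → P w → P (mate M β w)) where

    τ : Fin 4 → Fin 4
    τ i with i F.≟ α | i F.≟ β
    ... | yes _ | _     = β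
    ... | no _  | yes _ = α
    ... | no _  | no _  = i

    τα : τ α ≡ β
    τα with α F.≟ α
    ... | yes _ = refl
    ... | no ¬p = contradiction refl ¬p

    τβ : τ β ≡ α
    τβ with β F.≟ α | β F.≟ β
    ... | yes p | _     = contradiction (sym p) α≢β
    ... | no _  | yes _ = refl
    ... | no _  | no ¬p = contradiction refl ¬p

    data View : Fin 4 → Set where
      is-α : View α
      is-β : View β
      else : ∀ {i} → τ i ≡ i → View i

    view : ∀ i → View i
    view i = case (i F.≟ α) (i F.≟ β)
      where
      other : i ≢ α → i ≢ β → τ i ≡ i
      other i≢α i≢β with i F.≟ α | i F.≟ β
      ... | yes p | _     = contradiction p i≢α
      ... | no _  | yes p = contradiction p i≢β
      ... | no _  | no _  = refl
      case : Dec (i ≡ α) → Dec (i ≡ β) → View i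
      case (yes refl) _          = is-α
      case (no _)     (yes refl) = is-β
      case (no i≢α)   (no i≢β)   = else (other i≢α i≢β)

    τ² : ∀ i → τ (τ i) ≡ i
    τ² i with view i
    ... | is-α   = trans (cong τ τα) τβ
    ... | is-β   = trans (cong τ τβ) τα
    ... | else p = trans (cong τ p) p

    colour : Fin 4 → Fin n → Fin 4
    colour i w = if does (P? w) then τ i else i

    inside : ∀ i {w} → P w → colour i w ≡ τ i
    inside i {w} p rewrite dec-true (P? w) p = refl

    outside : ∀ i {w} → ¬ P w → colour i w ≡ i
    outside i {w} ¬p rewrite dec-false (P? w) ¬p = refl

    colour-injective : ∀ {i j} w → colour i w ≡ colour j w → i ≡ j
    colour-injective {i} {j} w e with does (P? w)
    ... | true  = trans (sym (τ² i)) (trans (cong τ e) (τ² j))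
    ... | false = e

    colour-fixed : ∀ {i} w → τ i ≡ i → colour i w ≡ i
    colour-fixed w e with does (P? w)
    ... | true  = e
    ... | false = refl

    swapped-mate : Fin 4 → Fin n → Fin n
    swapped-mate i w = mate M (colour i w) w

    Pα⁻ : ∀ {w} → P (mate M α w) → P w
    Pα⁻ p = subst P (involutive M α _) (Pα p)

    Pβ⁻ : ∀ {w} → P (mate M β w) → P w
    Pβ⁻ p = subst P (involutive M β _) (Pβ p)

    colour-mate : ∀ i w → colour i (swapped-mate i w) ≡ colour i w
    colour-mate i w = by-cases (view i) (P? w)
      where
      by-cases : ∀ {i} → View i → Dec (P w) → colour i (swapped-mate i w) ≡ colour i w
      by-cases {i} (else e) _ = trans (colour-fixed (swapped-mate i w) e) (sym (colour-fixed w e))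
      by-cases is-α (yes p) = trans (cong (λ k → colour α (mate M k w)) (trans (inside α p) τα)) (trans (inside α (Pβ p)) (sym (inside α p)))
      by-cases is-α (no ¬p) = trans (cong (λ k → colour α (mate M k w)) (outside α ¬p)) (trans (outside α (λ q → ¬p (Pα⁻ q))) (sym (outside α ¬p)))
      by-cases is-β (yes p) = trans (cong (λ k → colour β (mate M k w)) (trans (inside β p) τβ)) (trans (inside β (Pα p)) (sym (inside β p)))
      by-cases is-β (no ¬p) = trans (cong (λ k → colour β (mate M k w)) (outside β ¬p)) (trans (outside β (λ q → ¬p (Pβ⁻ q))) (sym (outside β ¬p)))

    swap : Matchings
    swap .mate = swapped-mate
    swap .involutive i w = trans (cong (λ k → mate M k (swapped-mate i w)) (colour-mate i w)) (involutive M (colour i w) w)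
    swap .edge i w = edge M (colour i w) w
    swap .disjoint i j w e moved = colour-injective w (disjoint M _ _ w e moved)

    covered : ∀ {x y} → Covered M x y → Covered swap x y
    covered {x} {y} (i , e) = by-cases (P? x)
      where
      by-cases : Dec (P x) → Covered swap x y
      by-cases (yes p) = τ i , trans (cong (λ k → mate M k x) (trans (inside (τ i) p) (τ² i))) e
      by-cases (no ¬p) = i , trans (cong (λ k → mate M k x) (outside i ¬p)) e

    covered⁻ : ∀ {x y} → Covered swap x y → Covered M x y
    covered⁻ {x} (i , e) = colour i x , e

    mate-inside : ∀ i {w} → P w → swapped-mate i w ≡ mate M (τ i) w
    mate-inside i {w} p = cong (λ k → mate M k w) (inside i p)

    mate-outside : ∀ i {w} → ¬ P w → swapped-mate i w ≡ mate M i w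
    mate-outside i {w} p = cong (λ k → mate M k w) (outside i p)

  Insertion : Matchings → Fin n → Fin n → Set
  Insertion M u v = ∃ λ M′ → Extends M M′ × Covered M′ u v

  -- The edge from u to its δ-neighbour gets colour ε, so that δ becomes available for uv.
  recolour : ∀ M {u v} → adjacent u v ≡ true → ¬ Covered M u v → ∀ δ ε → δ ≢ ε → ¬ Free M u δ →
    Free M u ε → Free M (mate M δ u) ε → Free M v δ → Insertion M u v
  recolour M {u} {v} uv new δ ε δ≢ε used εu εw δv =
    add , (λ x≢y c → extends x≢y (S.covered c)) , δ , at-u
    where
    w : Fin n
    w = mate M δ u
    P : Fin n → Set
    P x = x ≡ u ⊎ x ≡ w
    Pδ : ∀ {x} → P x → P (mate M δ x)
    Pδ (inj₁ refl) = inj₂ refl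
    Pδ (inj₂ refl) = inj₁ (involutive M δ u)
    Pε : ∀ {x} → P x → P (mate M ε x)
    Pε (inj₁ refl) = inj₁ εu
    Pε (inj₂ refl) = inj₂ εw
    module S = Swap M δ ε δ≢ε {P} (λ x → (x F.≟ u) ⊎-dec (x F.≟ w)) Pδ Pε
    ¬Pv : ¬ P v
    ¬Pv (inj₁ v≡u) = adjacent⇒≢ uv (sym v≡u)
    ¬Pv (inj₂ v≡w) = new (δ , sym v≡w)
    open Add S.swap uv (λ c → new (S.covered⁻ c)) δ
      (trans (S.mate-inside δ (inj₁ refl)) (trans (cong (λ k → mate M k u) S.τα) εu))
      (trans (S.mate-outside δ ¬Pv) δv)

  -- The colours `α` and `γ` are free at `u`. If either is free at `v`, or if `β` or `δ` is free at
  -- `u`, the ends have a common free colour. Otherwise `β` and `δ` are free at `v`. If the path of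
  -- colours `α` and `β` from `v` avoids `u`, exchanging its colours makes `α` common. If it
  -- contains `u`, the aim is to recolour the edge from `u` to its `δ`-neighbour `w`, which makes
  -- `δ` common.
  insert : ∀ M {u v} → adjacent u v ≡ true → Insertion M u v
  insert M {u} {v} uv with F.any? (λ i → mate M i u F.≟ v)
  ... | yes c  = M , (λ _ d → d) , c
  ... | no new with two-free M uv new
  ... | twoFree {α} {γ} {β} {δ} α≢γ α≢β α≢δ γ≢β γ≢δ β≢δ αu γu
    with free? M v α | free? M v γ | free? M u β | free? M u δ
  ... | yes αv | _      | _      | _      = Add.result M uv new α αu αv
  ... | no _   | yes γv | _      | _      = Add.result M uv new γ γu γv
  ... | no αv  | no γv  | yes βu | _      = Add.result M uv new β βu (three-used M (trans (symmetric v u) uv) (λ c → new (Covered-sym M c)) α≢γ α≢β γ≢β αv γv)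
  ... | no αv  | no γv  | no _   | yes δu = Add.result M uv new δ δu (three-used M (trans (symmetric v u) uv) (λ c → new (Covered-sym M c)) α≢γ α≢δ γ≢δ αv γv)
  ... | no αv  | no γv  | no βu  | no δu  = chain
    where
    v-free : ∀ {k} → α ≢ k → γ ≢ k → Free M v k
    v-free α≢k γ≢k = three-used M (trans (symmetric v u) uv) (λ c → new (Covered-sym M c)) α≢γ α≢k γ≢k αv γv
    βv : Free M v β
    βv = v-free α≢β γ≢β
    δv : Free M v δ
    δv = v-free α≢δ γ≢δ
    w : Fin n
    w = mate M δ u
    module C = Component (mate M α) (mate M β) (involutive M α) (involutive M β) v βv
    chain : Insertion M u v
    chain with C.In? u
    chain | no u∉ = proj₁ r , (λ x≢y c → proj₁ (proj₂ r) x≢y (S.covered c)) , proj₂ (proj₂ r)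
      where
      module S = Swap M α β α≢β {C.In} C.In? (C.In-turn false) (C.In-turn true)
      r : Insertion S.swap u v
      r = Add.result S.swap uv (λ c → new (S.covered⁻ c)) α (trans (S.mate-outside α u∉) αu)
        (trans (S.mate-inside α C.In-start) (trans (cong (λ k → mate M k v) S.τα) βv))
    chain | yes u∈ with free? M w α | free? M w γ
    ... | yes αw | _ = recolour M uv new δ α (≢-sym α≢δ) δu αu αw δv
    ... | no _ | yes γw = recolour M uv new δ γ (≢-sym γ≢δ) δu γu γw δv
    ... | no αw | no γw = proj₁ r , (λ x≢y c → proj₁ (proj₂ r) x≢y (S.covered c)) , proj₂ (proj₂ r)
      where
      βw : Free M w β
      βw = four-used M α≢γ α≢δ α≢β γ≢δ γ≢β (≢-sym β≢δ) αw γw (λ e → δu (trans (sym e) (involutive M δ u)))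
      -- The path ends in `u`, which `α` misses; `w`, which `β` misses, would have to be that same
      -- end. So an exchange off the path frees `α` at `w` and changes nothing at `u` and `v`.
      w∉ : ¬ C.In w
      w∉ w∈ = δu (trans (C.In-end true w∈ βw (λ e → new (δ , e))) (sym (C.In-end false u∈ αu (adjacent⇒≢ uv))))
      module S = Swap M α β α≢β {λ x → ¬ C.In x} (λ x → ¬? (C.In? x)) (λ ¬p q → ¬p (C.In-turn⁻ false q)) (λ ¬p q → ¬p (C.In-turn⁻ true q))
      unchanged : ∀ i {x} → C.In x → S.swapped-mate i x ≡ mate M i x
      unchanged i p = S.mate-outside i (λ ¬p → ¬p p)
      w≡ : S.swapped-mate δ u ≡ w
      w≡ = unchanged δ u∈
      αw′ : S.swapped-mate α w ≡ w
      αw′ = trans (S.mate-inside α w∉) (trans (cong (λ k → mate M k w) S.τα) βw)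
      r : Insertion S.swap u v
      r = recolour S.swap uv (λ c → new (S.covered⁻ c)) δ α (≢-sym α≢δ) (λ e → δu (trans (sym w≡) e))
        (trans (unchanged α u∈) αu) (subst (λ x → S.swapped-mate α x ≡ x) (sym w≡) αw′) (trans (unchanged δ C.In-start) δv)

  empty : Matchings
  empty .mate i w = w
  empty .involutive i w = refl
  empty .edge i w moved = contradiction refl moved
  empty .disjoint i j w _ moved = contradiction refl moved

  cover : ∀ (xs : List (Fin n × Fin n)) → ∃ λ M → ∀ {u v} → (u , v) ∈ xs → adjacent u v ≡ true → Covered M u v
  cover [] = empty , λ ()
  cover ((u , v) ∷ xs) with cover xs | adjacent u v in uv
  ... | M , done | false = M , λ { (here refl) e → contradiction (trans (sym e) uv) (λ ()) ; (there p) e → done p e }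
  ... | M , done | true with insert M uv
  ...   | M′ , ext , c = M′ , λ { (here refl) _ → c ; (there p) e → ext (adjacent⇒≢ e) (done p e) }

  edge-colouring : ∃ λ M → ∀ u v → adjacent u v ≡ true → Covered M u v
  edge-colouring with cover (cartesianProduct (allFin n) (allFin n))
  ... | M , done = M , λ u v e → done (∈-cartesianProduct⁺ (∈-allFin u) (∈-allFin v)) e

-- Colour words along a subdivided edge.

-- The j-th of t middle vertices of a path is the j′-th one from the other end.
record Slot (t j j′ : ℕ) : Set where
  constructor slot
  field
    1≤j  : 1 ≤ j
    1≤j′ : 1 ≤ j′
    sum  : j + j′ ≡ suc t

On : ∀ {C : Set} → ℕ → (ℕ → C) → C → Set
On r A x = ∃ λ i → i ≤ r × A i ≡ x

-- A half-edge shows its end and the r vertices next to it, A 0, …, A r and B 0, …, B r.  The t vertices in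
-- between are to be coloured by X, where p x and q x are the distances of the colour x from the two ends.
module _ {C : Set} (Valid : C → Set) (r : ℕ) where

  record Link (t : ℕ) (A B : ℕ → C) (p q : C → ℕ) : Set where
    field
      X       : ℕ → C
      valid-A : ∀ {i} → i ≤ r → Valid (A i)
      valid-B : ∀ {i} → i ≤ r → Valid (B i)
      valid-X : ∀ {j j′} → Slot t j j′ → Valid (X j)
      pos-A   : ∀ {i} → i ≤ r → p (A i) ≡ i
      pos-B   : ∀ {i} → i ≤ r → q (B i) ≡ i
      -- On a path of length 2r + 1 + t, with `X j` at distance r + j from the start, this field and
      -- the next two put equal colours more than 2r apart. The last four fields say that a colour
      -- not shown by the half-edge itself has position plus distance greater than 2r.
      A-B     : ∀ {i j} → i ≤ r → j ≤ r → A i ≡ B j → i + j ≤ t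
      A-X     : ∀ {i j j′} → i ≤ r → Slot t j j′ → A i ≡ X j → i + r < j
      B-X     : ∀ {i j j′} → i ≤ r → Slot t j j′ → B i ≡ X j → i + r < j′
      X-X     : ∀ {i i′ j j′} → Slot t i i′ → Slot t j j′ → X i ≡ X j → i ≡ j
      near-X  : ∀ {j j′} → Slot t j j′ → On r A (X j) ⊎ r < p (X j) + j
      far-X   : ∀ {j j′} → Slot t j j′ → On r B (X j) ⊎ r < q (X j) + j′
      near-B  : ∀ {i} → i ≤ r → On r A (B i) ⊎ i ≤ t + p (B i)
      far-A   : ∀ {i} → i ≤ r → On r B (A i) ⊎ i ≤ t + q (A i)

  -- `near` and `far` protect against the other half-edges at an end. Such a half-edge can show a
  -- colour only at the position given by `p` or `q`, so either the colour belongs to the own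
  -- half-edge, or position plus distance exceeds 2r.
  record Word (n : ℕ) (A B : ℕ → C) (p q : C → ℕ) : Set where
    field
      W      : ℕ → C
      start  : ∀ {i} → i ≤ r → W i ≡ A i
      end    : ∀ {i i′} → i + i′ ≡ n → i′ ≤ r → W i ≡ B i′
      valid  : ∀ {i} → i ≤ n → Valid (W i)
      window : ∀ {i j} → i < j → j ≤ n → j ≤ i + (r + r) → W i ≢ W j
      near   : ∀ {i} → i ≤ r + r → On r A (W i) ⊎ r + r < p (W i) + i
      far    : ∀ {i i′} → i + i′ ≡ n → i′ ≤ r + r → On r B (W i) ⊎ r + r < q (W i) + i′

  module FromLink {t A B p q} (L : Link t A B p q) where
    open Link L

    letters : ℕ → C
    letters i with i ≤? r | i ≤? r + t
    ... | yes _ | _     = A i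
    ... | no _  | yes _ = X (i ∸ r)
    ... | no _  | no _  = B (suc (r + r + t) ∸ i)

    data Zone (i i′ : ℕ) : Set where
      head   : i ≤ r → letters i ≡ A i → Zone i i′
      middle : ∀ {j j′} → i ≡ r + j → i′ ≡ r + j′ → Slot t j j′ → letters i ≡ X j → Zone i i′
      tail   : i′ ≤ r → letters i ≡ B i′ → Zone i i′

    zone : ∀ i i′ → i + i′ ≡ suc (r + r + t) → Zone i i′
    zone i i′ eq with i ≤? r | i ≤? r + t in near-end
    ... | yes i≤r | _ = head i≤r at
      where
      at : letters i ≡ A i
      at with i ≤? r
      ... | yes _  = refl
      ... | no i≰r = contradiction i≤r i≰r
    ... | no i≰r | yes i≤r+t = middle (sym (m+[n∸m]≡n (<⇒≤ r<i))) i′≡ (slot 1≤j 1≤j′ (m+[n∸m]≡n j≤1+t)) at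
      where
      r<i : r < i
      r<i = ≰⇒> i≰r
      j : ℕ
      j = i ∸ r
      shift : ∀ j → r + j ≡ i → r < i → i ≤ r + t → 1 ≤ j × j ≤ t
      shift j e h h′ = (lin 0 (≤-reflexive (sym e) ⊕ h) (solve (j ∷ r ∷ i ∷ []))) , (lin 0 (≤-reflexive e ⊕ h′) (solve (j ∷ t ∷ r ∷ i ∷ [])))
      bounds : 1 ≤ j × j ≤ t
      bounds = shift j (m+[n∸m]≡n (<⇒≤ r<i)) r<i i≤r+t
      1≤j : 1 ≤ j
      1≤j = proj₁ bounds
      j≤1+t : j ≤ suc t
      j≤1+t = m≤n⇒m≤1+n (proj₂ bounds)
      1≤j′ : 1 ≤ suc t ∸ j
      1≤j′ = m<n⇒0<n∸m (s≤s (proj₂ bounds))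
      opposite : ∀ j j′ → r + j ≡ i → j + j′ ≡ suc t → i′ ≡ r + j′
      opposite j j′ e h = ≤-antisym (lin 0 (≤-reflexive e ⊕ ≤-reflexive (sym h) ⊕ ≤-reflexive eq) (solve (i′ ∷ r ∷ j′ ∷ j ∷ i ∷ t ∷ []))) (lin 0 (≤-reflexive (sym e) ⊕ ≤-reflexive h ⊕ ≤-reflexive (sym eq)) (solve (i′ ∷ r ∷ j′ ∷ j ∷ i ∷ t ∷ [])))
      i′≡ : i′ ≡ r + (suc t ∸ j)
      i′≡ = opposite j (suc t ∸ j) (m+[n∸m]≡n (<⇒≤ r<i)) (m+[n∸m]≡n j≤1+t)
      at : letters i ≡ X (i ∸ r)
      at with i ≤? r | i ≤? r + t
      ... | yes i≤r | _      = contradiction i≤r i≰r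
      ... | no _    | yes _  = refl
      ... | no _    | no h   = contradiction i≤r+t h
    ... | no i≰r | no i≰r+t = tail i′≤r at
      where
      r+t<i : r + t < i
      r+t<i = ≰⇒> i≰r+t
      i′≤r : i′ ≤ r
      i′≤r = lin 0 (≤-reflexive eq ⊕ r+t<i) (solve (i′ ∷ r ∷ i ∷ t ∷ []))
      at : letters i ≡ B i′
      at with i ≤? r | i ≤? r + t
      ... | yes i≤r | _     = contradiction i≤r i≰r
      ... | no _    | yes h = contradiction h i≰r+t
      ... | no _    | no _  = cong B (trans (cong (_∸ i) (sym eq)) (m+n∸m≡n i i′))

    distinct : ∀ {i i′ j j′} → i + i′ ≡ suc (r + r + t) → j + j′ ≡ suc (r + r + t) → i < j → j ≤ i + (r + r) → Zone i i′ → Zone j j′ → letters i ≢ letters j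
    distinct ei ej i<j close (head i≤r ai) (head j≤r aj) eq =
      <-irrefl (trans (sym (pos-A i≤r)) (trans (cong p (trans (sym ai) (trans eq aj))) (pos-A j≤r))) i<j
    distinct {i} ei ej i<j close (head i≤r ai) (middle {k} refl _ s xj) eq = far-apart (A-X i≤r s (trans (sym ai) (trans eq xj)))
      where
      far-apart : i + r < k → ⊥
      far-apart h = lin-⊥ 0 (h ⊕ close) (solve (i ∷ r ∷ k ∷ []))
    distinct {i} {j = j} {j′} ei ej i<j close (head i≤r ai) (tail j′≤r bj) eq = far-apart (A-B i≤r j′≤r (trans (sym ai) (trans eq bj)))
      where
      far-apart : i + j′ ≤ t → ⊥
      far-apart h = lin-⊥ 0 (h ⊕ close ⊕ ≤-reflexive (sym ej)) (solve (i ∷ j′ ∷ j ∷ r ∷ t ∷ []))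
    distinct ei ej i<j close (middle refl _ s xi) (middle refl _ s′ xj) eq =
      <-irrefl (cong (r +_) (X-X s s′ (trans (sym xi) (trans eq xj)))) i<j
    distinct {i} {i′} {j} {j′} ei ej i<j close (middle {k} {k′} _ refl s xi) (tail j′≤r bj) eq =
      far-apart (B-X j′≤r s (trans (sym bj) (trans (sym eq) xi)))
      where
      far-apart : j′ + r < k′ → ⊥
      far-apart h = lin-⊥ 0 (h ⊕ close ⊕ ≤-reflexive ei ⊕ ≤-reflexive (sym ej)) (solve (j′ ∷ r ∷ j ∷ i ∷ k′ ∷ t ∷ []))
    distinct {i} {i′} {j} {j′} ei ej i<j close (tail i′≤r bi) (tail j′≤r bj) eq = far-apart (trans (sym (pos-B i′≤r)) (trans (cong q (trans (sym bi) (trans eq bj))) (pos-B j′≤r)))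
      where
      far-apart : i′ ≡ j′ → ⊥
      far-apart h = lin-⊥ 0 (≤-reflexive h ⊕ i<j ⊕ ≤-reflexive (sym ei) ⊕ ≤-reflexive ej) (solve (i′ ∷ j′ ∷ i ∷ r ∷ t ∷ j ∷ []))
    -- In the remaining cases the zones of `i` and `j` come in the wrong order for `i < j`.
    distinct {j = j} ei ej i<j close (middle {k} refl _ s xi) (head j≤r aj) eq = lin-⊥ k (i<j ⊕ j≤r) (solve (r ∷ k ∷ j ∷ []))
    distinct {i} {i′} {j} ei ej i<j close (tail i′≤r bi) (head j≤r aj) eq = lin-⊥ (1 + t) (≤-reflexive (sym ei) ⊕ i′≤r ⊕ i<j ⊕ j≤r) (solve (i ∷ i′ ∷ r ∷ t ∷ j ∷ []))
    distinct {i} {i′} {j} ei ej i<j close (tail i′≤r bi) (middle {k} {k′} _ refl s xj) eq =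
      (lin-⊥ k′ (≤-reflexive (sym ei) ⊕ ≤-reflexive ej ⊕ i′≤r ⊕ i<j) (solve (i ∷ i′ ∷ r ∷ t ∷ j ∷ k′ ∷ [])))

    word : Word (suc (r + r + t)) A B p q
    word .Word.W = letters
    word .Word.start {i} i≤r with i ≤? r
    ... | yes _  = refl
    ... | no i≰r = contradiction i≤r i≰r
    word .Word.end {i} {i′} eq i′≤r with zone i i′ eq
    ... | head i≤r _ = ⊥-elim (lin-⊥ t (≤-reflexive (sym eq) ⊕ i≤r ⊕ i′≤r) (solve (i ∷ i′ ∷ r ∷ t ∷ [])))
    ... | middle {k} {k′} _ refl s _ = ⊥-elim (impossible (Slot.1≤j′ s))
      where
      impossible : 1 ≤ k′ → ⊥
      impossible h = lin-⊥ 0 (h ⊕ i′≤r) (solve (r ∷ k′ ∷ []))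
    ... | tail _ b = b
    word .Word.valid {i} i≤n with zone i (suc (r + r + t) ∸ i) (m+[n∸m]≡n i≤n)
    ... | head i≤r a     = subst Valid (sym a) (valid-A i≤r)
    ... | middle _ _ s x = subst Valid (sym x) (valid-X s)
    ... | tail i′≤r b    = subst Valid (sym b) (valid-B i′≤r)
    word .Word.window {i} {j} i<j j≤n close = distinct ei ej i<j close (zone i (suc (r + r + t) ∸ i) ei) (zone j (suc (r + r + t) ∸ j) ej)
      where
      ei : i + (suc (r + r + t) ∸ i) ≡ suc (r + r + t)
      ei = m+[n∸m]≡n (≤-trans (<⇒≤ i<j) j≤n)
      ej : j + (suc (r + r + t) ∸ j) ≡ suc (r + r + t)
      ej = m+[n∸m]≡n j≤n
    word .Word.near {i} i≤2r = by-zone (suc (r + r + t) ∸ i) ei (zone i (suc (r + r + t) ∸ i) ei)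
      where
      ei : i + (suc (r + r + t) ∸ i) ≡ suc (r + r + t)
      ei = m+[n∸m]≡n (≤-trans i≤2r (m≤n⇒m≤1+n (m≤m+n (r + r) t)))
      by-zone : ∀ i′ → i + i′ ≡ suc (r + r + t) → Zone i i′ → On r A (letters i) ⊎ r + r < p (letters i) + i
      by-zone i′ e (head i≤r a) = inj₁ (i , i≤r , sym a)
      by-zone i′ e (middle {k} refl _ s x) rewrite x with near-X s
      ... | inj₁ on = inj₁ on
      ... | inj₂ h  = inj₂ (later (p (X k)) h)
        where
        later : ∀ z → r < z + k → r + r < z + (r + k)
        later z h = lin 0 h (solve (r ∷ z ∷ k ∷ []))
      by-zone i′ e (tail i′≤r b) rewrite b with near-B i′≤r
      ... | inj₁ on = inj₁ on
      ... | inj₂ h  = inj₂ (later (p (B i′)) h)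
        where
        later : ∀ z → i′ ≤ t + z → r + r < z + i
        later z h = lin 0 (h ⊕ ≤-reflexive (sym e)) (solve (r ∷ z ∷ i ∷ i′ ∷ t ∷ []))
    word .Word.far {i} {i′} e i′≤2r with zone i i′ e
    ... | tail i′≤r b = inj₁ (i′ , i′≤r , sym b)
    ... | middle {k} {k′} _ refl s x rewrite x with far-X s
    ...   | inj₁ on = inj₁ on
    ...   | inj₂ h  = inj₂ (later (q (X k)) h)
      where
      later : ∀ z → r < z + k′ → r + r < z + (r + k′)
      later z h = lin 0 h (solve (r ∷ z ∷ k′ ∷ []))
    word .Word.far {i} {i′} e i′≤2r | head i≤r a rewrite a with far-A i≤r
    ...   | inj₁ on = inj₁ on
    ...   | inj₂ h  = inj₂ (later (q (A i)) h)
      where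
      later : ∀ z → i ≤ t + z → r + r < z + i′
      later z h = lin 0 (h ⊕ ≤-reflexive (sym e)) (solve (r ∷ z ∷ i′ ∷ i ∷ t ∷ []))

  -- Repeating the first 2r + 1 letters keeps all windows of 2r + 1 letters rainbow.
  module Repeat {n A B p q} (w : Word n A B p q) (2r<n : r + r < n) where
    open Word w

    repeated : ℕ → C
    repeated i with i ≤? r + r
    ... | yes _ = W i
    ... | no _  = W (i ∸ suc (r + r))

    repeated-early : ∀ {i} → i ≤ r + r → repeated i ≡ W i
    repeated-early {i} h with i ≤? r + r
    ... | yes _ = refl
    ... | no ¬h = contradiction h ¬h

    repeated-late : ∀ i → repeated (suc (r + r) + i) ≡ W i
    repeated-late i with suc (r + r) + i ≤? r + r
    ... | yes h = contradiction h (<⇒≱ (m≤m+n (suc (r + r)) i))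
    ... | no _  = cong W (m+n∸m≡n (r + r) i)

    data Part (i : ℕ) : Set where
      early : i ≤ r + r → Part i
      late  : ∀ k → i ≡ suc (r + r) + k → Part i

    part : ∀ i → Part i
    part i with i ≤? r + r
    ... | yes h = early h
    ... | no ¬h = late (i ∸ suc (r + r)) (sym (m+[n∸m]≡n (≰⇒> ¬h)))

    extend : Word (suc (r + r) + n) A B p q
    extend .Word.W = repeated
    extend .Word.start i≤r = trans (repeated-early (≤-trans i≤r (m≤m+n r r))) (start i≤r)
    extend .Word.end {i} {i′} e i′≤r with part i
    ... | early h = ⊥-elim (lin-⊥ (1 + r) (≤-reflexive (sym e) ⊕ 2r<n ⊕ h ⊕ i′≤r) (solve (i ∷ i′ ∷ r ∷ n ∷ [])))
    ... | late k refl = trans (repeated-late k) (end {k} {i′} (≤-antisym (lin 0 (≤-reflexive e) (solve (k ∷ i′ ∷ n ∷ r ∷ []))) (lin 0 (≤-reflexive (sym e)) (solve (k ∷ i′ ∷ n ∷ r ∷ [])))) i′≤r)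
    extend .Word.valid {i} i≤ with part i
    ... | early h = subst Valid (sym (repeated-early h)) (valid (≤-trans h (<⇒≤ 2r<n)))
    ... | late k refl = subst Valid (sym (repeated-late k)) (valid {k} (lin 0 i≤ (solve (k ∷ n ∷ r ∷ []))))
    extend .Word.window {i} {j} i<j j≤ close eq with part i | part j
    ... | early hi | early hj = window i<j (≤-trans hj (<⇒≤ 2r<n)) close (trans (sym (repeated-early hi)) (trans eq (repeated-early hj)))
    -- With `j = 2r + 1 + k`, being close means `k < i`: the two letters are `W i` and `W k`, both
    -- among the first 2r + 1, in exchanged order.
    ... | early hi | late k refl = window {k} {i} (lin 0 close (solve (k ∷ i ∷ r ∷ []))) (≤-trans hi (<⇒≤ 2r<n))
          (lin k hi (solve (i ∷ k ∷ r ∷ []))) (trans (sym (repeated-late k)) (trans (sym eq) (repeated-early hi)))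
    ... | late k refl | early hj = lin-⊥ (1 + k) (i<j ⊕ hj) (solve (r ∷ k ∷ j ∷ []))
    ... | late k refl | late l refl = window {k} {l} (lin 0 i<j (solve (k ∷ l ∷ r ∷ [])))
          (lin 0 j≤ (solve (l ∷ n ∷ r ∷ []))) (lin 0 close (solve (l ∷ k ∷ r ∷ [])))
          (trans (sym (repeated-late k)) (trans eq (repeated-late l)))
    extend .Word.near h rewrite repeated-early h = near h
    extend .Word.far {i} {i′} e i′≤2r with part i
    ... | early h = ⊥-elim (lin-⊥ 1 (≤-reflexive (sym e) ⊕ 2r<n ⊕ h ⊕ i′≤2r) (solve (i ∷ i′ ∷ r ∷ n ∷ [])))
    ... | late k refl rewrite repeated-late k = far {k} {i′} (≤-antisym (lin 0 (≤-reflexive e) (solve (k ∷ i′ ∷ n ∷ r ∷ []))) (lin 0 (≤-reflexive (sym e)) (solve (k ∷ i′ ∷ n ∷ r ∷ [])))) i′≤2r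

  word-of-length : ∀ {t A B p q} → Link t A B p q → ∀ k → Word (k * suc (r + r) + suc (r + r + t)) A B p q
  word-of-length L zero = FromLink.word L
  word-of-length {t} {A} {B} {p} {q} L (suc k) =
    subst (λ n → Word n A B p q) (sym (+-assoc (suc (r + r)) (k * suc (r + r)) _))
      (Repeat.extend (word-of-length L k) (≤-trans (s≤s (m≤m+n (r + r) t)) (m≤n+m _ (k * suc (r + r)))))

  word-of-total : ∀ {t A B p q n} → Link t A B p q → ∀ k → k * suc (r + r) + suc (r + r + t) ≡ n → Word n A B p q
  word-of-total L k refl = word-of-length L k

-- The two orders of a class.

-- The two orders of a class: the position of its k-th colour is k, or the top w of the e + w positions are reversed.
flip : ℕ → ℕ → Bool → ℕ → ℕ
flip e w false k = k
flip e w true  k with k ≤? e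
... | yes _ = k
... | no _  = suc (e + e + w) ∸ k

-- The relation between the positions of one colour in the two orders. It is symmetric, so it need
-- not be known at which end the order is reversed. The sum is that of the extreme reversed
-- positions e + 1 and e + w.
Opposite : ℕ → ℕ → ℕ → ℕ → Set
Opposite e w p q = (p ≤ e × p ≡ q) ⊎ (e < p × e < q × p + q ≡ suc (e + e + w))

InRange : ℕ → ℕ → Set
InRange r k = 1 ≤ k × k ≤ r

module _ {e w : ℕ} where

  Opposite-sym : ∀ {p q} → Opposite e w p q → Opposite e w q p
  Opposite-sym (inj₁ (h , refl))     = inj₁ (h , refl)
  Opposite-sym {p} {q} (inj₂ (h , h′ , eq)) = inj₂ (h′ , h , trans (+-comm q p) eq)

  Opposite-unique : ∀ {p q q′} → Opposite e w p q → Opposite e w p q′ → q ≡ q′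
  Opposite-unique (inj₁ (_ , refl)) (inj₁ (_ , eq)) = eq
  Opposite-unique (inj₁ (h , _)) (inj₂ (h′ , _)) = contradiction h (<⇒≱ h′)
  Opposite-unique (inj₂ (h , _)) (inj₁ (h′ , _)) = contradiction h′ (<⇒≱ h)
  Opposite-unique {p} (inj₂ (_ , _ , eq)) (inj₂ (_ , _ , eq′)) = +-cancelˡ-≡ p _ _ (trans eq (sym eq′))

  flip-true : ∀ {k} → InRange (e + w) k → Opposite e w k (flip e w true k)
  flip-true {k} (_ , k≤r) with k ≤? e
  ... | yes h = inj₁ (h , refl)
  ... | no ¬h = inj₂ (≰⇒> ¬h , bound (suc (e + e + w) ∸ k) sum , sum)
    where
    sum : k + (suc (e + e + w) ∸ k) ≡ suc (e + e + w)
    sum = m+[n∸m]≡n {k} {suc (e + e + w)} (lin (e + 1) k≤r (solve (k ∷ e ∷ w ∷ [])))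
    bound : ∀ q → k + q ≡ suc (e + e + w) → e < q
    bound q h = lin 0 (≤-reflexive (sym h) ⊕ k≤r) (solve (e ∷ q ∷ k ∷ w ∷ []))

  Opposite-range : ∀ {p q} → InRange (e + w) p → Opposite e w p q → InRange (e + w) q
  Opposite-range h (inj₁ (_ , refl)) = h
  Opposite-range {p} {q} h (inj₂ (e<p , e<q , eq)) =
    ≤-trans (s≤s z≤n) e<q , (lin 0 (≤-reflexive eq ⊕ e<p) (solve (q ∷ e ∷ w ∷ p ∷ [])))

  flip-range : ∀ b {k} → InRange (e + w) k → InRange (e + w) (flip e w b k)
  flip-range false h = h
  flip-range true  h = Opposite-range h (flip-true h)

  flip-flip : ∀ b {k} → InRange (e + w) k → flip e w b (flip e w b k) ≡ k
  flip-flip false h = refl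
  flip-flip true  h = Opposite-unique (flip-true (flip-range true h)) (Opposite-sym (flip-true h))

  at-position : ∀ b {p} → InRange (e + w) p → InRange (e + w) (flip e w b p) × flip e w b (flip e w b p) ≡ p
  at-position b h = flip-range b h , flip-flip b h

  flip-opposite : ∀ {b c} → b ≢ c → ∀ {k} → InRange (e + w) k → Opposite e w (flip e w b k) (flip e w c k)
  flip-opposite {false} {true}  _ h = flip-true h
  flip-opposite {true}  {false} _ h = Opposite-sym (flip-true h)
  flip-opposite {false} {false} n h = contradiction refl n
  flip-opposite {true}  {true}  n h = contradiction refl n

-- Filling the middle of an edge with class colours.

Class : Set
Class = Fin 3

-- On the diagonal the value is some class other than `a`, so that `third-≢ˡ` holds for all pairs.
third : Class → Class → Class
third zero             (suc zero)       = suc (suc zero)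
third zero             _                = suc zero
third (suc zero)       zero             = suc (suc zero)
third (suc zero)       _                = zero
third (suc (suc zero)) zero             = suc zero
third (suc (suc zero)) _                = zero

third-≢ˡ : ∀ a b → third a b ≢ a
third-≢ˡ zero             zero             ()
third-≢ˡ zero             (suc zero)       ()
third-≢ˡ zero             (suc (suc zero)) ()
third-≢ˡ (suc zero)       zero             ()
third-≢ˡ (suc zero)       (suc zero)       ()
third-≢ˡ (suc zero)       (suc (suc zero)) ()
third-≢ˡ (suc (suc zero)) zero             ()
third-≢ˡ (suc (suc zero)) (suc zero)       ()
third-≢ˡ (suc (suc zero)) (suc (suc zero)) ()

third-≢ʳ : ∀ a b → a ≢ b → third a b ≢ b
third-≢ʳ zero             zero             n _ = n refl
third-≢ʳ zero             (suc zero)       _ ()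
third-≢ʳ zero             (suc (suc zero)) _ ()
third-≢ʳ (suc zero)       zero             _ ()
third-≢ʳ (suc zero)       (suc zero)       n _ = n refl
third-≢ʳ (suc zero)       (suc (suc zero)) _ ()
third-≢ʳ (suc (suc zero)) zero             _ ()
third-≢ʳ (suc (suc zero)) (suc zero)       _ ()
third-≢ʳ (suc (suc zero)) (suc (suc zero)) n _ = n refl

-- A path between a half-edge of class a at v and one of class b at u; x and y are the orders of the classes at v and u.
module _ (e w t : ℕ) (a b : Class) (x y : Class → Bool) where

  near-pos far-pos : Class × ℕ → ℕ
  near-pos (c , k) = flip e w (x c) k
  far-pos  (c , k) = flip e w (y c) k

  -- A colour of the end's own class already occurs on this path at its position, and the repetition
  -- must be more than 2r away. A colour of another class may be on a different half-edge of that
  -- end, where position plus distance must exceed 2r. Both are written after cancelling the r in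
  -- the distance r + j.
  record SlotOK (z : Class × ℕ) (j j′ : ℕ) : Set where
    field
      range : InRange (e + w) (proj₂ z)
      near  : (proj₁ z ≡ a × near-pos z + (e + w) < j) ⊎ (proj₁ z ≢ a × e + w < near-pos z + j)
      far   : (proj₁ z ≡ b × far-pos z + (e + w) < j′) ⊎ (proj₁ z ≢ b × e + w < far-pos z + j′)

  record ClassLink : Set where
    field
      X    : ℕ → Class × ℕ
      slots : ∀ {j j′} → Slot t j j′ → SlotOK (X j) j j′
      X-X  : ∀ {i i′ j j′} → Slot t i i′ → Slot t j j′ → X i ≡ X j → i ≡ j
      both : ∀ {c k} → InRange (e + w) k → c ≡ a → c ≡ b → near-pos (c , k) + far-pos (c , k) ≤ t
      only-near : ∀ {c k} → InRange (e + w) k → c ≡ a → c ≢ b → near-pos (c , k) ≤ t + far-pos (c , k)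
      only-far  : ∀ {c k} → InRange (e + w) k → c ≢ a → c ≡ b → far-pos (c , k) ≤ t + near-pos (c , k)

slot-complement : ∀ {t j j′} → Slot t j j′ → suc t ∸ j ≡ j′
slot-complement {j = j} {j′} (slot _ _ eq) = trans (cong (_∸ j) (sym eq)) (m+n∸m≡n j j′)

-- Different classes at the two ends: the slots show b-colours, then third-class colours, then a-colours.
module Mixed {e w z : ℕ} {a b : Class} {x y : Class → Bool} (a≢b : a ≢ b)
  (third-differs : x (third a b) ≢ y (third a b))
  (extra : z ≡ 0 ⊎ (e ≡ 0 × z + z ≤ w × x a ≢ y a × x b ≢ y b)) where

  private
    g : Class
    g = third a b
    P Q : Class × ℕ → ℕ
    P = near-pos e w (w + z + z) a b x y
    Q = far-pos e w (w + z + z) a b x y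

  mixed-letter : ℕ → Class × ℕ
  mixed-letter j with j ≤? z | suc (w + z + z) ∸ j ≤? z
  ... | yes _ | _     = b , flip e w (y b) j
  ... | no _  | yes _ = a , flip e w (x a) (suc (w + z + z) ∸ j)
  ... | no _  | no _  = g , flip e w (x g) (suc (e + w + z) ∸ j)

  -- The outer slots read the position off the end of the same class, nearest colour outermost. In a
  -- `mid` slot, position plus `j` is the constant r + z + 1 with r = e + w: as `j` runs from z + 1
  -- to z + w, the positions run down from r to e + 1, exactly the reversible ones.
  data Spec (j j′ : ℕ) (c : Class) (k : ℕ) : Set where
    low  : 1 ≤ z → j ≤ z → c ≡ b → Q (c , k) ≡ j → Spec j j′ c k
    high : 1 ≤ z → j′ ≤ z → c ≡ a → P (c , k) ≡ j′ → Spec j j′ c k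
    mid  : z < j → z < j′ → c ≡ g → P (c , k) + j ≡ suc (e + w + z) → Spec j j′ c k

  z≤r : z ≤ e + w
  z≤r = bound extra
    where
    bound : z ≡ 0 ⊎ (e ≡ 0 × z + z ≤ w × x a ≢ y a × x b ≢ y b) → z ≤ e + w
    bound (inj₁ refl) = z≤n
    bound (inj₂ (_ , h , _)) = lin (e + z) h (solve (z ∷ e ∷ w ∷ []))

  spec : ∀ {j j′} → Slot (w + z + z) j j′ → InRange (e + w) (proj₂ (mixed-letter j)) × Spec j j′ (proj₁ (mixed-letter j)) (proj₂ (mixed-letter j))
  spec {j} {j′} s@(slot 1≤j 1≤j′ eq) with j ≤? z | suc (w + z + z) ∸ j ≤? z
  ... | yes h | _ = proj₁ rp , low (≤-trans 1≤j h) h refl (proj₂ rp)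
    where
    rp = at-position {e} {w} (y b) {j} (1≤j , ≤-trans h z≤r)
  ... | no _ | yes h = proj₁ rp , high (≤-trans 1≤j′ j′≤z) j′≤z refl (trans (proj₂ rp) (slot-complement s))
    where
    j′≤z : j′ ≤ z
    j′≤z = subst (_≤ z) (slot-complement s) h
    rp = at-position {e} {w} (x a) {suc (w + z + z) ∸ j}
      (subst (InRange (e + w)) (sym (slot-complement s)) (1≤j′ , ≤-trans j′≤z z≤r))
  ... | no h | no h′ = proj₁ rp , mid z<j z<j′ refl (trans (cong (_+ j) (proj₂ rp)) (trans (+-comm _ j) sum))
    where
    z<j : z < j
    z<j = ≰⇒> h
    z<j′ : z < j′
    z<j′ = ≰⇒> (λ i → h′ (subst (_≤ z) (sym (slot-complement s)) i))
    sum : j + (suc (e + w + z) ∸ j) ≡ suc (e + w + z)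
    sum = m+[n∸m]≡n {j} {suc (e + w + z)} (lin (e + 1) (z<j′ ⊕ ≤-reflexive eq) (solve (j ∷ e ∷ w ∷ z ∷ j′ ∷ [])))
    bounds : ∀ p → j + p ≡ suc (e + w + z) → InRange (e + w) p
    bounds p i = (lin e (≤-reflexive (sym i) ⊕ z<j′ ⊕ ≤-reflexive eq) (solve (p ∷ j ∷ e ∷ w ∷ z ∷ j′ ∷ []))) , (lin 0 (≤-reflexive i ⊕ z<j) (solve (p ∷ e ∷ w ∷ j ∷ z ∷ [])))
    rp = at-position {e} {w} (x g) (bounds (suc (e + w + z) ∸ j) sum)

  spec-injective : ∀ {i i′ j j′ c k} → Slot (w + z + z) i i′ → Slot (w + z + z) j j′ → Spec i i′ c k → Spec j j′ c k → i ≡ j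
  spec-injective _ _ (low _ _ _ p) (low _ _ _ q) = trans (sym p) q
  spec-injective {i} {i′} {j} {j′} (slot _ _ s) (slot _ _ s′) (high _ _ _ p) (high _ _ _ q) = +-cancelʳ-≡ i′ i j (trans s (trans (sym s′) (cong (j +_) (trans (sym q) p))))
  spec-injective _ _ (mid _ _ _ p) (mid _ _ _ q) = +-cancelˡ-≡ _ _ _ (trans p (sym q))
  spec-injective _ _ (low _ _ cb _) (high _ _ ca _) = contradiction (trans (sym ca) cb) a≢b
  spec-injective _ _ (high _ _ ca _) (low _ _ cb _) = contradiction (trans (sym ca) cb) a≢b
  spec-injective _ _ (low _ _ cb _) (mid _ _ cg _) = contradiction (trans (sym cg) cb) (third-≢ʳ a b a≢b)
  spec-injective _ _ (mid _ _ cg _) (low _ _ cb _) = contradiction (trans (sym cg) cb) (third-≢ʳ a b a≢b)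
  spec-injective _ _ (high _ _ ca _) (mid _ _ cg _) = contradiction (trans (sym cg) ca) (third-≢ˡ a b)
  spec-injective _ _ (mid _ _ cg _) (high _ _ ca _) = contradiction (trans (sym cg) ca) (third-≢ˡ a b)

  extra-slots : 1 ≤ z → e ≡ 0 × x a ≢ y a × x b ≢ y b
  extra-slots 1≤z = by-cases extra
    where
    by-cases : z ≡ 0 ⊎ (e ≡ 0 × z + z ≤ w × x a ≢ y a × x b ≢ y b) → e ≡ 0 × x a ≢ y a × x b ≢ y b
    by-cases (inj₁ z≡0) = contradiction (subst (1 ≤_) z≡0 1≤z) (λ ())
    by-cases (inj₂ (e≡0 , _ , rest)) = e≡0 , rest

  reversed : ∀ {p q} → e ≡ 0 → 1 ≤ p → Opposite e w p q → p + q ≡ suc w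
  reversed e≡0 1≤p (inj₁ (p≤e , _)) = contradiction (≤-trans 1≤p (subst (_ ≤_) e≡0 p≤e)) (λ ())
  reversed {p} {q} e≡0 _ (inj₂ (_ , _ , eq)) = ≤-antisym (lin 0 (≤-reflexive eq ⊕ ≤-reflexive e≡0 ⊕ ≤-reflexive e≡0) (solve (p ∷ q ∷ w ∷ e ∷ []))) (lin (2 * e) (≤-reflexive (sym eq)) (solve (p ∷ q ∷ w ∷ e ∷ [])))

  -- In a `low` slot the reversed orders give P + j = w + 1, just above the bound, while the
  -- distance to the equal colour at the far end follows from 2j ≤ 2z; `high` slots are the mirror
  -- image. In a `mid` slot P + j and Q + j′ are both r + z + 1.
  slot-ok : ∀ {j j′ c k} → Slot (w + z + z) j j′ → InRange (e + w) k → Spec j j′ c k → SlotOK e w (w + z + z) a b x y (c , k) j j′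
  slot-ok {j} {j′} {c} {k} (slot _ _ s) rk (low 1≤z j≤z refl q) =
    record { range = rk ; near = inj₂ (≢-sym a≢b , near (P (b , k)) (Q (b , k)) q pq) ; far = inj₁ (refl , far (Q (b , k)) q) }
    where
    e≡0 : e ≡ 0
    e≡0 = proj₁ (extra-slots 1≤z)
    pq : P (b , k) + Q (b , k) ≡ suc w
    pq = reversed e≡0 (proj₁ (flip-range (x b) rk)) (flip-opposite (proj₂ (proj₂ (extra-slots 1≤z))) rk)
    near : ∀ p q → q ≡ j → p + q ≡ suc w → e + w < p + j
    near p q i h = lin 0 (≤-reflexive i ⊕ ≤-reflexive (sym h) ⊕ ≤-reflexive e≡0) (solve (e ∷ w ∷ p ∷ j ∷ q ∷ []))
    far : ∀ q → q ≡ j → q + (e + w) < j′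
    far q i = lin 0 (≤-reflexive i ⊕ j≤z ⊕ j≤z ⊕ ≤-reflexive (sym s) ⊕ ≤-reflexive e≡0) (solve (q ∷ e ∷ w ∷ j′ ∷ j ∷ z ∷ []))
  slot-ok {j} {j′} {c} {k} (slot _ _ s) rk (high 1≤z j′≤z refl p) =
    record { range = rk ; near = inj₁ (refl , near (P (a , k)) p) ; far = inj₂ (a≢b , far (P (a , k)) (Q (a , k)) p pq) }
    where
    e≡0 : e ≡ 0
    e≡0 = proj₁ (extra-slots 1≤z)
    pq : P (a , k) + Q (a , k) ≡ suc w
    pq = reversed e≡0 (proj₁ (flip-range (x a) rk)) (flip-opposite (proj₁ (proj₂ (extra-slots 1≤z))) rk)
    near : ∀ p → p ≡ j′ → p + (e + w) < j
    near p i = lin 0 (≤-reflexive i ⊕ j′≤z ⊕ j′≤z ⊕ ≤-reflexive (sym s) ⊕ ≤-reflexive e≡0) (solve (p ∷ e ∷ w ∷ j ∷ j′ ∷ z ∷ []))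
    far : ∀ p q → p ≡ j′ → p + q ≡ suc w → e + w < q + j′
    far p q i h = lin 0 (≤-reflexive i ⊕ ≤-reflexive (sym h) ⊕ ≤-reflexive e≡0) (solve (e ∷ w ∷ q ∷ j′ ∷ p ∷ []))
  slot-ok {j} {j′} {c} {k} (slot _ _ s) rk (mid z<j z<j′ refl p) =
    record { range = rk ; near = inj₂ (third-≢ˡ a b , near (P (g , k)) p) ; far = inj₂ (third-≢ʳ a b a≢b , far (P (g , k)) (Q (g , k)) p (flip-opposite third-differs rk)) }
    where
    near : ∀ p → p + j ≡ suc (e + w + z) → e + w < p + j
    near p i = lin z (≤-reflexive (sym i)) (solve (e ∷ w ∷ p ∷ j ∷ z ∷ []))
    far : ∀ p q → p + j ≡ suc (e + w + z) → Opposite e w p q → e + w < q + j′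
    far p q i (inj₁ (p≤e , _)) = ⊥-elim (lin-⊥ 0 (≤-reflexive (sym i) ⊕ p≤e ⊕ z<j′ ⊕ ≤-reflexive s) (solve (p ∷ j ∷ e ∷ w ∷ z ∷ j′ ∷ [])))
    far p q i (inj₂ (_ , _ , o)) = lin z (≤-reflexive i ⊕ ≤-reflexive (sym s) ⊕ ≤-reflexive (sym o)) (solve (e ∷ w ∷ q ∷ j′ ∷ p ∷ j ∷ z ∷ []))

  within : ∀ {p q} → InRange (e + w) p → Opposite e w p q → p ≤ w + z + z + q
  within _ (inj₁ (_ , refl)) = m≤n+m _ (w + z + z)
  within {p} {q} (_ , p≤r) (inj₂ (_ , e<q , _)) = lin (2 * z + 1) (p≤r ⊕ e<q) (solve (p ∷ w ∷ z ∷ q ∷ e ∷ []))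

  within-any : ∀ (s s′ : Bool) {k} → InRange (e + w) k → flip e w s k ≤ w + z + z + flip e w s′ k
  within-any s s′ rk with s B.≟ s′
  ... | yes refl = m≤n+m _ (w + z + z)
  ... | no s≢s′  = within (flip-range s rk) (flip-opposite s≢s′ rk)

  mixed-link : ClassLink e w (w + z + z) a b x y
  mixed-link .ClassLink.X = mixed-letter
  mixed-link .ClassLink.slots s = slot-ok s (proj₁ (spec s)) (proj₂ (spec s))
  mixed-link .ClassLink.X-X s s′ eq = spec-injective s s′ (proj₂ (spec s))
    (subst₂ (Spec _ _) (sym (cong proj₁ eq)) (sym (cong proj₂ eq)) (proj₂ (spec s′)))
  mixed-link .ClassLink.both rk ca cb = contradiction (trans (sym ca) cb) a≢b
  mixed-link .ClassLink.only-near {c} rk _ _ = within-any (x c) (y c) rk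
  mixed-link .ClassLink.only-far  {c} rk _ _ = within-any (y c) (x c) rk

next : Class → Class
next zero             = suc zero
next (suc zero)       = suc (suc zero)
next (suc (suc zero)) = zero

next-≢ : ∀ a → next a ≢ a
next-≢ zero             ()
next-≢ (suc zero)       ()
next-≢ (suc (suc zero)) ()

next-next-≢ : ∀ a → next (next a) ≢ a
next-next-≢ zero             ()
next-next-≢ (suc zero)       ()
next-next-≢ (suc (suc zero)) ()

-- The same class at both ends, in opposite orders: each half of the slots shows one of the other two classes.
module Same {w t : ℕ} {a : Class} {x y : Class → Bool} (differs : x a ≢ y a) (w<t : w < t) (t≤2w : t ≤ w + w) where

  private
    g h : Class
    g = next a
    h = next (next a)
    P Q : Class × ℕ → ℕ
    P = near-pos 0 w t a a x y
    Q = far-pos 0 w t a a x y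

  same-letter : ℕ → Class × ℕ
  same-letter j with j ≤? suc t ∸ j
  ... | yes _ = g , flip 0 w (x g) (suc w ∸ j)
  ... | no _  = h , flip 0 w (y h) (suc w ∸ (suc t ∸ j))

  data SameSpec (j j′ : ℕ) (c : Class) (k : ℕ) : Set where
    first  : j ≤ j′ → c ≡ g → P (c , k) + j ≡ suc w → SameSpec j j′ c k
    second : j′ < j → c ≡ h → Q (c , k) + j′ ≡ suc w → SameSpec j j′ c k

  -- The smaller of two distances with sum `suc t` is at most `w` because `t ≤ w + w`; its
  -- complement to `suc w` is therefore a position.
  complement : ∀ {i i′} → 1 ≤ i → i ≤ i′ → i + i′ ≡ suc t → InRange w (suc w ∸ i) × i + (suc w ∸ i) ≡ suc w
  complement {i} {i′} 1≤i i≤i′ s = bounds (suc w ∸ i) sum , sum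
    where
    i≤w : i ≤ w
    i≤w = ≮⇒≥ too-long
      where
      too-long : ¬ w < i
      too-long w<i = lin-⊥ 0 (w<i ⊕ w<i ⊕ i≤i′ ⊕ ≤-reflexive s ⊕ t≤2w) (solve (w ∷ i ∷ i′ ∷ t ∷ []))
    sum : i + (suc w ∸ i) ≡ suc w
    sum = m+[n∸m]≡n (m≤n⇒m≤1+n i≤w)
    bounds : ∀ p → i + p ≡ suc w → InRange w p
    bounds p o = (lin 0 (≤-reflexive (sym o) ⊕ i≤w) (solve (p ∷ i ∷ w ∷ []))) , (lin 0 (≤-reflexive o ⊕ 1≤i) (solve (p ∷ w ∷ i ∷ [])))

  same-spec : ∀ {j j′} → Slot t j j′ → InRange w (proj₂ (same-letter j)) × SameSpec j j′ (proj₁ (same-letter j)) (proj₂ (same-letter j))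
  same-spec {j} {j′} s@(slot 1≤j 1≤j′ eq) with j ≤? suc t ∸ j
  ... | yes i = proj₁ rp , first j≤j′ refl (trans (cong (_+ j) (proj₂ rp)) (trans (+-comm _ j) (proj₂ c)))
    where
    j≤j′ : j ≤ j′
    j≤j′ = subst (j ≤_) (slot-complement s) i
    c = complement 1≤j j≤j′ eq
    rp = at-position {0} {w} (x g) (proj₁ c)
  ... | no i = proj₁ rp , second j′<j refl (trans (cong (_+ j′) (trans (proj₂ rp) (cong (suc w ∸_) (slot-complement s)))) (trans (+-comm _ j′) (proj₂ c)))
    where
    j′<j : j′ < j
    j′<j = ≰⇒> (λ o → i (subst (j ≤_) (sym (slot-complement s)) o))
    c = complement 1≤j′ (<⇒≤ j′<j) (trans (+-comm j′ j) eq)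
    rp = at-position {0} {w} (y h) (subst (λ o → InRange w (suc w ∸ o)) (sym (slot-complement s)) (proj₁ c))

  same-injective : ∀ {i i′ j j′ c k} → Slot t i i′ → Slot t j j′ → SameSpec i i′ c k → SameSpec j j′ c k → i ≡ j
  same-injective _ _ (first _ _ p) (first _ _ q) = +-cancelˡ-≡ _ _ _ (trans p (sym q))
  same-injective {i} {i′} {j} {j′} (slot _ _ s) (slot _ _ s′) (second _ _ p) (second _ _ q) =
    +-cancelʳ-≡ i′ i j (trans s (trans (sym s′) (cong (j +_) (+-cancelˡ-≡ _ j′ i′ (trans q (sym p))))))
  same-injective _ _ (first _ cg _) (second _ ch _) = contradiction (trans (sym ch) cg) (next-≢ g)
  same-injective _ _ (second _ ch _) (first _ cg _) = contradiction (trans (sym ch) cg) (next-≢ g)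

  -- Seen from the other end, the first half stays in range whether or not the orders agree.
  across : ∀ (s s′ : Bool) {k i i′} → InRange w k → i ≤ i′ → i + i′ ≡ suc t → flip 0 w s k + i ≡ suc w → w < flip 0 w s′ k + i′
  across s s′ {k} {i} {i′} rk i≤i′ o p with s B.≟ s′
  ... | yes refl = agree (flip 0 w s k) p
    where
    agree : ∀ z → z + i ≡ suc w → w < z + i′
    agree z h = lin 0 (≤-reflexive (sym h) ⊕ i≤i′) (solve (w ∷ z ∷ i′ ∷ i ∷ []))
  ... | no s≢s′ = opposite (flip 0 w s k) (flip 0 w s′ k) p (proj₁ (flip-range s rk)) (flip-opposite s≢s′ rk)
    where
    opposite : ∀ z z′ → z + i ≡ suc w → 1 ≤ z → Opposite 0 w z z′ → w < z′ + i′
    opposite z z′ h 1≤z (inj₁ (z≤0 , _)) = contradiction (≤-trans 1≤z z≤0) (λ ())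
    opposite z z′ h _ (inj₂ (_ , _ , q)) = lin 1 (≤-reflexive h ⊕ ≤-reflexive (sym q) ⊕ ≤-reflexive (sym o) ⊕ w<t) (solve (w ∷ z′ ∷ i′ ∷ z ∷ i ∷ t ∷ []))

  same-ok : ∀ {j j′ c k} → Slot t j j′ → InRange w k → SameSpec j j′ c k → SlotOK 0 w t a a x y (c , k) j j′
  same-ok (slot _ _ s) rk (first j≤j′ refl p) = record
    { range = rk ; near = inj₂ (next-≢ a , ≤-reflexive (sym p)) ; far = inj₂ (next-≢ a , across (x g) (y g) rk j≤j′ s p) }
  same-ok {j} {j′} (slot _ _ s) rk (second j′<j refl q) = record
    { range = rk ; near = inj₂ (next-next-≢ a , across (y h) (x h) rk (<⇒≤ j′<j) (trans (+-comm j′ j) s) q) ; far = inj₂ (next-next-≢ a , ≤-reflexive (sym q)) }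

  same-link : ClassLink 0 w t a a x y
  same-link .ClassLink.X = same-letter
  same-link .ClassLink.slots s = same-ok s (proj₁ (same-spec s)) (proj₂ (same-spec s))
  same-link .ClassLink.X-X s s′ eq = same-injective s s′ (proj₂ (same-spec s))
    (subst₂ (SameSpec _ _) (sym (cong proj₁ eq)) (sym (cong proj₂ eq)) (proj₂ (same-spec s′)))
  -- Reversed orders give p + q = w + 1, so a class can be repeated at the other end only if `t`
  -- exceeds `w`.
  same-link .ClassLink.both {k = k} rk refl _ = bound (flip 0 w (x a) k) (flip 0 w (y a) k) (proj₁ (flip-range (x a) rk)) (flip-opposite differs rk)
    where
    bound : ∀ p q → 1 ≤ p → Opposite 0 w p q → p + q ≤ t
    bound p q 1≤p (inj₁ (p≤0 , _)) = contradiction (≤-trans 1≤p p≤0) (λ ())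
    bound p q _ (inj₂ (_ , _ , eq)) = ≤-trans (≤-reflexive eq) w<t
  same-link .ClassLink.only-near rk ca c≢a = contradiction ca c≢a
  same-link .ClassLink.only-far  rk c≢a ca = contradiction ca c≢a

-- Links in which all branch vertices share one colour.

letter : ℕ → ℕ → Class → (Class → Bool) → ℕ → Class × ℕ
letter e w a x i = a , flip e w (x a) i

position : ℕ → ℕ → (Class → Bool) → Class × ℕ → ℕ
position e w x (c , k) = flip e w (x c) k

module ClassLetters {e w t a b x y} (L : ClassLink e w t a b x y) where
  open ClassLink L public

  A B : ℕ → Class × ℕ
  A = letter e w a x
  B = letter e w b y

  p q : Class × ℕ → ℕ
  p = position e w x
  q = position e w y

  p-A : ∀ {i} → InRange (e + w) i → p (A i) ≡ i
  p-A = flip-flip (x a)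

  q-B : ∀ {i} → InRange (e + w) i → q (B i) ≡ i
  q-B = flip-flip (y b)

  A-p : ∀ {z} → InRange (e + w) (proj₂ z) → proj₁ z ≡ a → A (p z) ≡ z
  A-p r refl = cong (a ,_) (flip-flip (x a) r)

  B-q : ∀ {z} → InRange (e + w) (proj₂ z) → proj₁ z ≡ b → B (q z) ≡ z
  B-q r refl = cong (b ,_) (flip-flip (y b) r)

  A-range : ∀ {i} → InRange (e + w) i → InRange (e + w) (proj₂ (A i))
  A-range = flip-range (x a)

  B-range : ∀ {i} → InRange (e + w) i → InRange (e + w) (proj₂ (B i))
  B-range = flip-range (y b)

  A-B : ∀ {i j} → InRange (e + w) i → InRange (e + w) j → A i ≡ B j → i + j ≤ t
  A-B {i} {j} ri rj eq = subst₂ (λ i j → i + j ≤ t) (p-A ri) (trans (cong q eq) (q-B rj))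
    (both (A-range ri) refl (cong proj₁ eq))

  A-X : ∀ {i j j′} → InRange (e + w) i → Slot t j j′ → A i ≡ X j → i + (e + w) < j
  A-X {i} ri s eq with SlotOK.near (slots s)
  ... | inj₁ (_ , h) = subst (λ i → i + (e + w) < _) (trans (cong p (sym eq)) (p-A ri)) h
  ... | inj₂ (n , _) = contradiction (sym (cong proj₁ eq)) n

  B-X : ∀ {i j j′} → InRange (e + w) i → Slot t j j′ → B i ≡ X j → i + (e + w) < j′
  B-X {i} ri s eq with SlotOK.far (slots s)
  ... | inj₁ (_ , h) = subst (λ i → i + (e + w) < _) (trans (cong q (sym eq)) (q-B ri)) h
  ... | inj₂ (n , _) = contradiction (sym (cong proj₁ eq)) n

  Among : (ℕ → Class × ℕ) → Class × ℕ → Set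
  Among A z = ∃ λ i → InRange (e + w) i × A i ≡ z

  near-X : ∀ {j j′} → Slot t j j′ → Among A (X j) ⊎ e + w < p (X j) + j
  near-X s with SlotOK.near (slots s)
  ... | inj₁ (c , _) = inj₁ (_ , flip-range (x _) (SlotOK.range (slots s)) , A-p (SlotOK.range (slots s)) c)
  ... | inj₂ (_ , h) = inj₂ h

  far-X : ∀ {j j′} → Slot t j j′ → Among B (X j) ⊎ e + w < q (X j) + j′
  far-X s with SlotOK.far (slots s)
  ... | inj₁ (c , _) = inj₁ (_ , flip-range (y _) (SlotOK.range (slots s)) , B-q (SlotOK.range (slots s)) c)
  ... | inj₂ (_ , h) = inj₂ h

  near-B : ∀ {i} → InRange (e + w) i → Among A (B i) ⊎ i ≤ t + p (B i)
  near-B {i} ri with b F.≟ a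
  ... | yes b≡a = inj₁ (_ , flip-range (x b) (B-range ri) , A-p (B-range ri) b≡a)
  ... | no b≢a  = inj₂ (subst (_≤ t + p (B i)) (q-B ri) (only-far (B-range ri) b≢a refl))

  far-A : ∀ {i} → InRange (e + w) i → Among B (A i) ⊎ i ≤ t + q (A i)
  far-A {i} ri with a F.≟ b
  ... | yes a≡b = inj₁ (_ , flip-range (y a) (A-range ri) , B-q (A-range ri) a≡b)
  ... | no a≢b  = inj₂ (subst (_≤ t + q (A i)) (p-A ri) (only-near (A-range ri) refl a≢b))

-- All branch vertices share the colour nothing.
Plain : Set
Plain = Maybe (Class × ℕ)

plain-side : ℕ → ℕ → Class → (Class → Bool) → ℕ → Plain
plain-side e w a x zero    = nothing
plain-side e w a x (suc i) = just (letter e w a x (suc i))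

plain-position : ℕ → ℕ → (Class → Bool) → Plain → ℕ
plain-position e w x nothing  = 0
plain-position e w x (just z) = position e w x z

PlainValid : ℕ → Plain → Set
PlainValid r nothing  = ⊤
PlainValid r (just z) = InRange r (proj₂ z)

module _ {e w t a b x y} (L : ClassLink e w t a b x y) where
  private module K = ClassLetters L

  plain-among : ∀ {c o z} → K.Among (letter e w c o) z → On (e + w) (plain-side e w c o) (just z)
  plain-among (suc i , (_ , h) , eq) = suc i , h , cong just eq

  plain-link : Link (PlainValid (e + w)) (e + w) t (plain-side e w a x) (plain-side e w b y) (plain-position e w x) (plain-position e w y)
  plain-link .Link.X j = just (K.X j)
  plain-link .Link.valid-A {zero}  h = tt
  plain-link .Link.valid-A {suc i} h = K.A-range (s≤s z≤n , h)
  plain-link .Link.valid-B {zero}  h = tt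
  plain-link .Link.valid-B {suc i} h = K.B-range (s≤s z≤n , h)
  plain-link .Link.valid-X s = SlotOK.range (K.slots s)
  plain-link .Link.pos-A {zero}  h = refl
  plain-link .Link.pos-A {suc i} h = K.p-A (s≤s z≤n , h)
  plain-link .Link.pos-B {zero}  h = refl
  plain-link .Link.pos-B {suc i} h = K.q-B (s≤s z≤n , h)
  -- The ends of the path are 2r + 1 + t apart, so they may have the same colour.
  plain-link .Link.A-B {zero}  {zero}  _ _ _ = z≤n
  plain-link .Link.A-B {suc i} {suc j} h h′ eq = K.A-B (s≤s z≤n , h) (s≤s z≤n , h′) (Maybeₚ.just-injective eq)
  plain-link .Link.A-X {suc i} h s eq = K.A-X (s≤s z≤n , h) s (Maybeₚ.just-injective eq)
  plain-link .Link.B-X {suc i} h s eq = K.B-X (s≤s z≤n , h) s (Maybeₚ.just-injective eq)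
  plain-link .Link.X-X s s′ eq = K.X-X s s′ (Maybeₚ.just-injective eq)
  plain-link .Link.near-X s with K.near-X s
  ... | inj₁ m = inj₁ (plain-among m)
  ... | inj₂ h = inj₂ h
  plain-link .Link.far-X s with K.far-X s
  ... | inj₁ m = inj₁ (plain-among m)
  ... | inj₂ h = inj₂ h
  plain-link .Link.near-B {zero}  _ = inj₁ (0 , z≤n , refl)
  plain-link .Link.near-B {suc i} h with K.near-B (s≤s z≤n , h)
  ... | inj₁ m = inj₁ (plain-among m)
  ... | inj₂ h = inj₂ h
  plain-link .Link.far-A {zero}  _ = inj₁ (0 , z≤n , refl)
  plain-link .Link.far-A {suc i} h with K.far-A (s≤s z≤n , h)
  ... | inj₁ m = inj₁ (plain-among m)
  ... | inj₂ h = inj₂ h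

-- Links with four special colours.

-- Four further colours replace nothing: f at a branch vertex, and the others at distance r from it.
Special : Set
Special = Fin 4 ⊎ (Class × ℕ)

special-side : ℕ → ℕ → Fin 4 → Fin 4 → Class → (Class → Bool) → ℕ → Special
special-side e w f h a x zero    = inj₁ f
special-side e w f h a x (suc i) with suc i ≤? e + w
... | yes _ = inj₂ (letter e w a x (suc i))
... | no _  = inj₁ h

special-position : ℕ → ℕ → Fin 4 → (Class → Bool) → Special → ℕ
special-position e w f x (inj₁ s) with s F.≟ f
... | yes _ = 0
... | no _  = suc (e + w)
special-position e w f x (inj₂ z) = position e w x z

SpecialValid : ℕ → Special → Set
SpecialValid r (inj₁ s) = ⊤
SpecialValid r (inj₂ z) = InRange r (proj₂ z)

module _ (e w : ℕ) (f h : Fin 4) (a : Class) (x : Class → Bool) where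

  data SideView (i : ℕ) : Set where
    centre : i ≡ 0 → special-side e w f h a x i ≡ inj₁ f → SideView i
    inner  : InRange (e + w) i → special-side e w f h a x i ≡ inj₂ (letter e w a x i) → SideView i
    outer  : i ≡ suc (e + w) → special-side e w f h a x i ≡ inj₁ h → SideView i

  side-view : ∀ {i} → i ≤ suc (e + w) → SideView i
  side-view {zero}  _ = centre refl refl
  side-view {suc i} i≤ with suc i ≤? e + w in eq
  ... | yes le = inner (s≤s z≤n , le) at
    where
    at : special-side e w f h a x (suc i) ≡ inj₂ (letter e w a x (suc i))
    at rewrite eq = refl
  ... | no ¬le = outer (≤-antisym i≤ (≰⇒> ¬le)) at
    where
    at : special-side e w f h a x (suc i) ≡ inj₁ h
    at rewrite eq = refl

  side-inner : ∀ {i} → InRange (e + w) i → special-side e w f h a x i ≡ inj₂ (letter e w a x i)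
  side-inner {suc i} (_ , le) with suc i ≤? e + w
  ... | yes _  = refl
  ... | no ¬le = contradiction le ¬le

  position-centre : special-position e w f x (inj₁ f) ≡ 0
  position-centre with f F.≟ f
  ... | yes _ = refl
  ... | no ¬p = contradiction refl ¬p

  position-outer : ∀ {s} → s ≢ f → special-position e w f x (inj₁ s) ≡ suc (e + w)
  position-outer {s} s≢f with s F.≟ f
  ... | yes p = contradiction p s≢f
  ... | no _  = refl

module _ {e w t a b x y} (L : ClassLink e w t a b x y) {f g h k s u : Fin 4} (r≤t : e + w ≤ t)
  (h≢f : h ≢ f) (k≢g : k ≢ g) (h≢k : h ≢ k) (f≢g : f ≢ g)
  (s≢f : s ≢ f) (s≢h : s ≢ h) (s≢k : s ≢ k) (u≢g : u ≢ g) (u≢h : u ≢ h) (u≢k : u ≢ k) (s≢u : s ≢ u) where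
  private
    module K = ClassLetters L
    r : ℕ
    r = suc (e + w)
    A B : ℕ → Special
    A = special-side e w f h a x
    B = special-side e w g k b y
    p q : Special → ℕ
    p = special-position e w f x
    q = special-position e w g y
    view-A : ∀ {i} → i ≤ r → SideView e w f h a x i
    view-A = side-view e w f h a x
    view-B : ∀ {i} → i ≤ r → SideView e w g k b y i
    view-B = side-view e w g k b y

  -- The two extreme slots show `s` and `u`. Each avoids both outer symbols `h`, `k` and the centre
  -- nearer to it. It may repeat the other centre, whose distance r + t + 2 is more than 2r because
  -- `e + w ≤ t`.
  special-letter : ℕ → Special
  special-letter zero = inj₁ s
  special-letter (suc zero) = inj₁ s
  special-letter (suc (suc j)) with suc j ≤? t
  ... | yes _ = inj₂ (K.X (suc j))
  ... | no _  = inj₁ u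

  data SlotView (j j′ : ℕ) : Set where
    first  : j ≡ 1 → j′ ≡ suc (suc t) → special-letter j ≡ inj₁ s → SlotView j j′
    inside : ∀ {i i′} → j ≡ suc i → j′ ≡ suc i′ → Slot t i i′ → special-letter j ≡ inj₂ (K.X i) → SlotView j j′
    last   : j ≡ suc (suc t) → j′ ≡ 1 → special-letter j ≡ inj₁ u → SlotView j j′

  slot-view : ∀ {j j′} → Slot (suc (suc t)) j j′ → SlotView j j′
  slot-view {suc zero} (slot _ _ eq) = first refl (suc-injective eq) refl
  slot-view {suc (suc j)} {j′} (slot _ 1≤j′ eq) with suc j ≤? t in dec
  ... | yes le = inside refl (sym (m+[n∸m]≡n 1≤j′)) (slot (s≤s z≤n) positive total) at
    where
    opposite : ℕ
    opposite = j′ ∸ 1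
    shift : ∀ i → suc i ≡ j′ → 1 ≤ i × suc j + i ≡ suc t
    shift i o = (lin 0 (≤-reflexive (sym o) ⊕ ≤-reflexive (sym eq) ⊕ le) (solve (i ∷ j′ ∷ j ∷ t ∷ []))) , (≤-antisym (lin 0 (≤-reflexive o ⊕ ≤-reflexive eq) (solve (j ∷ i ∷ t ∷ j′ ∷ []))) (lin 0 (≤-reflexive (sym o) ⊕ ≤-reflexive (sym eq)) (solve (j ∷ i ∷ t ∷ j′ ∷ []))))
    positive : 1 ≤ opposite
    positive = proj₁ (shift opposite (m+[n∸m]≡n 1≤j′))
    total : suc j + opposite ≡ suc t
    total = proj₂ (shift opposite (m+[n∸m]≡n 1≤j′))
    at : special-letter (suc (suc j)) ≡ inj₂ (K.X (suc j))
    at rewrite dec = refl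
  ... | no ¬le = last j≡ (≤-antisym j′≤1 1≤j′) at
    where
    t<1+j : t < suc j
    t<1+j = ≰⇒> ¬le
    j′≤1 : j′ ≤ 1
    j′≤1 = lin 0 (t<1+j ⊕ ≤-reflexive eq) (solve (j′ ∷ t ∷ j ∷ []))
    j≡ : suc (suc j) ≡ suc (suc t)
    j≡ = ≤-antisym (lin 0 (≤-reflexive eq ⊕ 1≤j′) (solve (j ∷ t ∷ j′ ∷ []))) (lin 0 t<1+j (solve (j ∷ t ∷ [])))
    at : special-letter (suc (suc j)) ≡ inj₁ u
    at rewrite dec = refl

  private
    special-among : ∀ {f h c o z} → K.Among (letter e w c o) z → On r (special-side e w f h c o) (inj₂ z)
    special-among {f} {h} {c} {o} (i , ri , eq) = i , m≤n⇒m≤1+n (proj₂ ri) , trans (side-inner e w f h c o ri) (cong inj₂ eq)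

    inj₁≢inj₂ : ∀ {A B : Set} {c : A} {d : B} → _≢_ {A = A ⊎ B} (inj₁ c) (inj₂ d)
    inj₁≢inj₂ ()

    glue : ∀ {c d : Special} {c′ d′} → c ≡ c′ → d ≡ d′ → c ≡ d → c′ ≡ d′
    glue refl refl eq = eq

    lift : ∀ {i} → i ≤ t → i ≤ suc (suc t)
    lift h = m≤n⇒m≤1+n (m≤n⇒m≤1+n h)

    1+r≤2+t : r ≤ suc (suc t)
    1+r≤2+t = m≤n⇒m≤1+n (s≤s r≤t)

    far-centre : ∀ {z} → z ≡ suc (e + w) → ∀ j → 1 ≤ j → r < z + j
    far-centre refl j 1≤j = ≤-trans (≤-reflexive (+-comm 1 r)) (+-monoʳ-≤ r 1≤j)

    near-last : ∀ z → r < z + suc (suc t)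
    near-last z = ≤-trans (s≤s (s≤s r≤t)) (m≤n+m (suc (suc t)) z)

    deeper : ∀ z j → e + w < z + j → r < z + suc j
    deeper z j o = ≤-trans (s≤s o) (≤-reflexive (sym (+-suc z j)))

    deeper-sum : ∀ i j → i + (e + w) < j → i + r < suc j
    deeper-sum i j o = s≤s (≤-trans (≤-reflexive (+-suc i (e + w))) o)

  -- The class link has radius r - 1 and two slots fewer. One more letter at the end of each
  -- half-edge and one more slot on each side raise both sides of its distance conditions
  -- compatibly; only the specials have to be compared anew.
  special-link : Link (SpecialValid (e + w)) r (suc (suc t)) A B p q
  special-link .Link.X = special-letter
  special-link .Link.valid-A i≤r with view-A i≤r
  ... | centre _ eq = subst (SpecialValid (e + w)) (sym eq) tt
  ... | inner ri eq = subst (SpecialValid (e + w)) (sym eq) (K.A-range ri)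
  ... | outer _ eq  = subst (SpecialValid (e + w)) (sym eq) tt
  special-link .Link.valid-B i≤r with view-B i≤r
  ... | centre _ eq = subst (SpecialValid (e + w)) (sym eq) tt
  ... | inner ri eq = subst (SpecialValid (e + w)) (sym eq) (K.B-range ri)
  ... | outer _ eq  = subst (SpecialValid (e + w)) (sym eq) tt
  special-link .Link.valid-X sl with slot-view sl
  ... | first _ _ eq      = subst (SpecialValid (e + w)) (sym eq) tt
  ... | inside _ _ sl′ eq = subst (SpecialValid (e + w)) (sym eq) (SlotOK.range (K.slots sl′))
  ... | last _ _ eq       = subst (SpecialValid (e + w)) (sym eq) tt
  special-link .Link.pos-A i≤r with view-A i≤r
  ... | centre refl eq = position-centre e w f h a x
  ... | inner ri eq    = trans (cong p eq) (K.p-A ri)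
  ... | outer refl eq  = trans (cong p eq) (position-outer e w f h a x h≢f)
  special-link .Link.pos-B i≤r with view-B i≤r
  ... | centre refl eq = position-centre e w g k b y
  ... | inner ri eq    = trans (cong q eq) (K.q-B ri)
  ... | outer refl eq  = trans (cong q eq) (position-outer e w g k b y k≢g)
  special-link .Link.A-B i≤r j≤r eq with view-A i≤r | view-B j≤r
  ... | centre _ ei    | centre _ ej    = contradiction (Sumₚ.inj₁-injective (glue ei ej eq)) f≢g
  ... | centre _ ei    | inner _ ej     = contradiction (glue ei ej eq) inj₁≢inj₂
  ... | centre refl _  | outer refl _   = 1+r≤2+t
  ... | inner _ ei     | centre _ ej    = contradiction (sym (glue ei ej eq)) inj₁≢inj₂
  ... | inner ri ei    | inner rj ej    = lift (K.A-B ri rj (Sumₚ.inj₂-injective (glue ei ej eq)))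
  ... | inner _ ei     | outer _ ej     = contradiction (sym (glue ei ej eq)) inj₁≢inj₂
  ... | outer refl _   | centre refl _  = ≤-trans (≤-reflexive (+-identityʳ r)) 1+r≤2+t
  ... | outer _ ei     | inner _ ej     = contradiction (glue ei ej eq) inj₁≢inj₂
  ... | outer _ ei     | outer _ ej     = contradiction (Sumₚ.inj₁-injective (glue ei ej eq)) h≢k
  special-link .Link.A-X i≤r sl eq with view-A i≤r | slot-view sl
  ... | centre _ ei    | first _ _ ej          = contradiction (sym (Sumₚ.inj₁-injective (glue ei ej eq))) s≢f
  ... | centre _ ei    | inside _ _ _ ej       = contradiction (glue ei ej eq) inj₁≢inj₂
  ... | centre refl _  | last refl _ _         = s≤s (s≤s r≤t)
  ... | inner _ ei     | first _ _ ej          = contradiction (sym (glue ei ej eq)) inj₁≢inj₂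
  ... | inner ri ei    | inside {j} refl _ sl′ ej = deeper-sum _ j (K.A-X ri sl′ (Sumₚ.inj₂-injective (glue ei ej eq)))
  ... | inner _ ei     | last _ _ ej           = contradiction (sym (glue ei ej eq)) inj₁≢inj₂
  ... | outer _ ei     | first _ _ ej          = contradiction (sym (Sumₚ.inj₁-injective (glue ei ej eq))) s≢h
  ... | outer _ ei     | inside _ _ _ ej       = contradiction (glue ei ej eq) inj₁≢inj₂
  ... | outer _ ei     | last _ _ ej           = contradiction (sym (Sumₚ.inj₁-injective (glue ei ej eq))) u≢h
  special-link .Link.B-X i≤r sl eq with view-B i≤r | slot-view sl
  ... | centre _ ei    | last _ _ ej           = contradiction (sym (Sumₚ.inj₁-injective (glue ei ej eq))) u≢g
  ... | centre _ ei    | inside _ _ _ ej       = contradiction (glue ei ej eq) inj₁≢inj₂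
  ... | centre refl _  | first _ refl _        = s≤s (s≤s r≤t)
  ... | inner _ ei     | first _ _ ej          = contradiction (sym (glue ei ej eq)) inj₁≢inj₂
  ... | inner ri ei    | inside {i′ = j} _ refl sl′ ej = deeper-sum _ j (K.B-X ri sl′ (Sumₚ.inj₂-injective (glue ei ej eq)))
  ... | inner _ ei     | last _ _ ej           = contradiction (sym (glue ei ej eq)) inj₁≢inj₂
  ... | outer _ ei     | first _ _ ej          = contradiction (sym (Sumₚ.inj₁-injective (glue ei ej eq))) s≢k
  ... | outer _ ei     | inside _ _ _ ej       = contradiction (glue ei ej eq) inj₁≢inj₂
  ... | outer _ ei     | last _ _ ej           = contradiction (sym (Sumₚ.inj₁-injective (glue ei ej eq))) u≢k
  special-link .Link.X-X sl sl′ eq with slot-view sl | slot-view sl′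
  ... | first refl _ _    | first refl _ _     = refl
  ... | first _ _ ei      | inside _ _ _ ej    = contradiction (glue ei ej eq) inj₁≢inj₂
  ... | first _ _ ei      | last _ _ ej        = contradiction (Sumₚ.inj₁-injective (glue ei ej eq)) s≢u
  ... | inside _ _ _ ei   | first _ _ ej       = contradiction (sym (glue ei ej eq)) inj₁≢inj₂
  ... | inside refl _ s₁ ei | inside refl _ s₂ ej = cong suc (K.X-X s₁ s₂ (Sumₚ.inj₂-injective (glue ei ej eq)))
  ... | inside _ _ _ ei   | last _ _ ej        = contradiction (sym (glue ei ej eq)) inj₁≢inj₂
  ... | last _ _ ei       | first _ _ ej       = contradiction (sym (Sumₚ.inj₁-injective (glue ei ej eq))) s≢u
  ... | last _ _ ei       | inside _ _ _ ej    = contradiction (glue ei ej eq) inj₁≢inj₂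
  ... | last refl _ _     | last refl _ _      = refl
  special-link .Link.near-X {j} sl with slot-view sl
  ... | first refl _ eq = inj₂ (far-centre (position-outer e w f h a x s≢f) 1 ≤-refl)
  ... | last refl _ eq  = inj₂ (near-last (p (special-letter (suc (suc t)))))
  ... | inside {i} refl _ sl′ eq with K.near-X sl′
  ...   | inj₁ m = inj₁ (subst (On r A) (sym eq) (special-among {f} {h} m))
  ...   | inj₂ o = inj₂ (subst (λ c → r < p c + suc i) (sym eq) (deeper _ i o))
  special-link .Link.far-X {j} {j′} sl with slot-view sl
  ... | first refl refl eq = inj₂ (near-last (q (inj₁ s)))
  ... | last refl refl eq  = inj₂ (subst (λ c → r < q c + 1) (sym eq) (far-centre (position-outer e w g k b y u≢g) 1 ≤-refl))
  ... | inside {i} {i′} refl refl sl′ eq with K.far-X sl′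
  ...   | inj₁ m = inj₁ (subst (On r B) (sym eq) (special-among {g} {k} m))
  ...   | inj₂ o = inj₂ (subst (λ c → r < q c + suc i′) (sym eq) (deeper _ i′ o))
  special-link .Link.near-B {i} i≤r with view-B i≤r
  ... | centre refl _ = inj₂ z≤n
  ... | outer refl _  = inj₂ (≤-trans 1+r≤2+t (m≤m+n _ _))
  ... | inner ri eq with K.near-B ri
  ...   | inj₁ m = inj₁ (subst (On r A) (sym eq) (special-among {f} {h} m))
  ...   | inj₂ o = inj₂ (subst (λ c → i ≤ suc (suc t) + p c) (sym eq) (m≤n⇒m≤1+n (m≤n⇒m≤1+n o)))
  special-link .Link.far-A {i} i≤r with view-A i≤r
  ... | centre refl _ = inj₂ z≤n
  ... | outer refl _  = inj₂ (≤-trans 1+r≤2+t (m≤m+n _ _))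
  ... | inner ri eq with K.far-A ri
  ...   | inj₁ m = inj₁ (subst (On r B) (sym eq) (special-among {g} {k} m))
  ...   | inj₂ o = inj₂ (subst (λ c → i ≤ suc (suc t) + q c) (sym eq) (m≤n⇒m≤1+n (m≤n⇒m≤1+n o)))

-- Without `h` and `k` two symbols remain. Of these, `f` and `g` forbid at most one each, and not
-- the same one, so one of the two assignments to `s` and `u` works. The finite check is left to
-- evaluation.
two-specials : ∀ (f g h k : Fin 4) → f ≢ g → h ≢ k →
  ∃₂ λ s u → s ≢ f × s ≢ h × s ≢ k × u ≢ g × u ≢ h × u ≢ k × s ≢ u
two-specials = from-yes (F.all? {4} λ f → F.all? {4} λ g → F.all? {4} λ h → F.all? {4} λ k →
  ¬? (f F.≟ g) →-dec (¬? (h F.≟ k) →-dec (F.any? {4} λ s → F.any? {4} λ u →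
    ¬? (s F.≟ f) ×-dec ¬? (s F.≟ h) ×-dec ¬? (s F.≟ k) ×-dec ¬? (u F.≟ g) ×-dec ¬? (u F.≟ h) ×-dec ¬? (u F.≟ k) ×-dec ¬? (s F.≟ u))))

-- Labelling the half-edges from the 4-edge-colouring.

EndRelation : Set₁
EndRelation = Class → Class → (Class → Bool) → (Class → Bool) → Set

ThirdReversed : EndRelation
ThirdReversed a b x y = a ≢ b × x (third a b) ≢ y (third a b)

OwnOrAllReversed : EndRelation
OwnOrAllReversed a b x y = (a ≡ b × x a ≢ y a) ⊎ (a ≢ b × ∀ c → x c ≢ y c)

pattern α = zero
pattern β = suc zero
pattern γ = suc (suc zero)

pattern #0 = zero
pattern #1 = suc zero
pattern #2 = suc (suc zero)
pattern #3 = suc (suc (suc zero))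

third-comm : ∀ a b → a ≢ b → third a b ≡ third b a
third-comm α α n = contradiction refl n
third-comm α β _ = refl
third-comm α γ _ = refl
third-comm β α _ = refl
third-comm β β n = contradiction refl n
third-comm β γ _ = refl
third-comm γ α _ = refl
third-comm γ β _ = refl
third-comm γ γ n = contradiction refl n

ThirdReversed-sym : ∀ {a b x y} → ThirdReversed a b x y → ThirdReversed b a y x
ThirdReversed-sym {a} {b} {x} {y} (n , d) = ≢-sym n , subst (λ c → y c ≢ x c) (third-comm a b n) (≢-sym d)

not-≢ : ∀ {b c} → b ≡ not c → c ≢ b
not-≢ {c = false} refl ()
not-≢ {c = true}  refl ()

data Role : Set where
  outA inA outB inB : Role

module Labelled {n : ℕ} {adjacent : Fin n → Fin n → Bool}
  {symmetric : ∀ u v → adjacent u v ≡ adjacent v u} {irreflexive : ∀ u → adjacent u u ≡ false}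
  {subcubic : ∀ u (f : Fin 4 → Fin n) → Injective _≡_ _≡_ f → ¬ (∀ i → adjacent u (f i) ≡ true)}
  (M : EdgeColouring.Matchings adjacent symmetric irreflexive subcubic) where

  open EdgeColouring adjacent symmetric irreflexive subcubic using (four-used)
  open EdgeColouring.Matchings M

  Used : Fin n → Fin 4 → Set
  Used v i = mate i v ≢ v

  Used-mate : ∀ {v i} → Used v i → Used (mate i v) i
  Used-mate {v} {i} moved eq = moved (trans (sym eq) (involutive i v))

  record Labelling (R : EndRelation) : Set where
    field
      class           : Fin n → Fin 4 → Class
      order           : Fin n → Class → Bool
      class-injective : ∀ {v i j} → Used v i → Used v j → class v i ≡ class v j → i ≡ j
      related         : ∀ {v i} → Used v i → R (class v i) (class (mate i v) i) (order v) (order (mate i v))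

  used : Fin n → Fin 4 → Bool
  used v i = not (does (mate i v F.≟ v))

  used-true : ∀ {v i} → Used v i → used v i ≡ true
  used-true {v} {i} moved with mate i v F.≟ v
  ... | yes eq = contradiction eq moved
  ... | no _   = refl

  used-Used : ∀ {v i} → used v i ≡ true → Used v i
  used-Used {v} {i} eq with mate i v F.≟ v
  used-Used () | yes _
  ... | no moved = moved

  not-all : ∀ {v} → used v #0 ≡ true → used v #1 ≡ true → used v #2 ≡ true → used v #3 ≡ true → ⊥
  not-all p q r s = used-Used s (four-used M {i = #0} {#1} {#2} {#3} (λ ()) (λ ()) (λ ()) (λ ()) (λ ()) (λ ()) (used-Used p) (used-Used q) (used-Used r))

  colouring : ∀ i j → ∃ λ x → Alternating x (mate i) × Alternating x (mate j)
  colouring i j = 2-colouring (mate i) (mate j) (involutive i) (involutive j)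

  -- The colours 0 and 1 form the subgraph A, the colours 2 and 3 the subgraph B.  A 2-colouring of each
  -- orients it so that every vertex has at most one edge in and one edge out.
  abstract
    colouring-A : ∃ λ x → Alternating x (mate #0) × Alternating x (mate #1)
    colouring-A = colouring #0 #1
    colouring-B : ∃ λ x → Alternating x (mate #2) × Alternating x (mate #3)
    colouring-B = colouring #2 #3

  yA yB : Fin n → Bool
  yA = proj₁ colouring-A
  yB = proj₁ colouring-B

  -- Edges of colours 0 and 2 point from `false` to `true`, those of colours 1 and 3 from `true` to
  -- `false`; so the two colours of a subgraph take different directions at each vertex.
  colour-of : Bool → Bool → Role → Fin 4
  colour-of a b outA = if a then #1 else #0
  colour-of a b inA  = if a then #0 else #1
  colour-of a b outB = if b then #3 else #2
  colour-of a b inB  = if b then #2 else #3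

  role : Bool → Bool → Fin 4 → Role
  role a b #0 = if a then inA else outA
  role a b #1 = if a then outA else inA
  role a b #2 = if b then inB else outB
  role a b #3 = if b then outB else inB

  colour-role : ∀ a b i → colour-of a b (role a b i) ≡ i
  colour-role true  b     #0 = refl
  colour-role false b     #0 = refl
  colour-role true  b     #1 = refl
  colour-role false b     #1 = refl
  colour-role a     true  #2 = refl
  colour-role a     false #2 = refl
  colour-role a     true  #3 = refl
  colour-role a     false #3 = refl

  present : Fin n → Role → Bool
  present v ρ = used v (colour-of (yA v) (yB v) ρ)

  not-all-roles : ∀ v → present v outA ≡ true → present v inA ≡ true → present v outB ≡ true → present v inB ≡ true → ⊥
  not-all-roles v with yA v | yB v
  ... | true  | true  = λ p q r s → not-all q p s r
  ... | true  | false = λ p q r s → not-all q p r s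
  ... | false | true  = λ p q r s → not-all p q s r
  ... | false | false = λ p q r s → not-all p q r s

  -- Incoming ends have fixed classes and an outgoing end prefers γ. If both outgoing ends are
  -- present, one gives way: `outA` takes α unless `inB` occupies it, and then `outB` takes β, which
  -- is available because not all four roles occur.
  label : Fin n → Role → Class
  label v inA  = β
  label v inB  = α
  label v outA = if present v outB ∧ not (present v inB) then α else γ
  label v outB = if present v outA ∧ present v inB then β else γ

  label-injective : ∀ v ρ σ → present v ρ ≡ true → present v σ ≡ true → label v ρ ≡ label v σ → ρ ≡ σ
  label-injective v outA outA p q eq = refl
  label-injective v inA  inA  p q eq = refl
  label-injective v outB outB p q eq = refl
  label-injective v inB  inB  p q eq = refl
  label-injective v inA  inB  p q ()
  label-injective v inB  inA  p q ()
  label-injective v outA inA  p q eq with present v outB ∧ not (present v inB)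
  label-injective v outA inA  p q () | true
  label-injective v outA inA  p q () | false
  label-injective v inA  outA p q eq = sym (label-injective v outA inA q p (sym eq))
  label-injective v outA inB  p q eq with present v outB | present v inB
  label-injective v outA inB  p q () | true  | true
  label-injective v outA inB  p q () | false | true
  label-injective v inB  outA p q eq = sym (label-injective v outA inB q p (sym eq))
  label-injective v outB inB  p q eq with present v outA ∧ present v inB
  label-injective v outB inB  p q () | true
  label-injective v outB inB  p q () | false
  label-injective v inB  outB p q eq = sym (label-injective v outB inB q p (sym eq))
  label-injective v outB inA  p q eq with present v outA in oA | present v inB in iB
  label-injective v outB inA  p q eq | true  | true  = ⊥-elim (not-all-roles v oA q p iB)
  label-injective v outB inA  p q () | true  | false
  label-injective v outB inA  p q () | false | _
  label-injective v inA  outB p q eq = sym (label-injective v outB inA q p (sym eq))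
  label-injective v outA outB p q eq with present v outA | present v outB | present v inB
  label-injective v outA outB p q () | true | true | true
  label-injective v outA outB p q () | true | true | false
  label-injective v outB outA p q eq = sym (label-injective v outA outB q p (sym eq))

  -- At a mixed vertex the outgoing B-edge has class β here and α at its head, so γ has to be
  -- reversed along it. These are the edges that `advance` follows.
  mixed : Fin n → Bool
  mixed v = present v outA ∧ present v outB ∧ present v inB

  head-B : Fin n → Fin n
  head-B v = mate (colour-of (yA v) (yB v) outB) v

  advance : Fin n → Fin n
  advance v = if mixed v then head-B v else v

  advance-mixed : ∀ {v} → mixed v ≡ true → advance v ≡ head-B v
  advance-mixed eq rewrite eq = refl

  advance-unmixed : ∀ {v} → mixed v ≡ false → advance v ≡ v
  advance-unmixed eq rewrite eq = refl

  abstract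
    correction : ∃ λ (R : Fin n → Bool) → (∀ v → R (advance v) ≡ R v) × (∀ v → advance v ≡ v → R v ≡ yA v xor yB v)
    correction = Follow.constant-along advance (λ v → yA v xor yB v)

  R : Fin n → Bool
  R = proj₁ correction

  -- A component of the edges labelled α and β follows edges of B forwards and then edges of A backwards.
  -- The correction R, constant along the former, makes the two 2-colourings agree where they meet.
  reversal : Fin n → Class → Bool
  reversal v α = yA v
  reversal v β = yB v
  reversal v γ = if mixed v then yB v xor R v else yA v

  reversal-unmixed : ∀ {v} → mixed v ≡ false → reversal v γ ≡ yA v
  reversal-unmixed eq rewrite eq = refl

  xor-cancel : ∀ a b → b xor (a xor b) ≡ a
  xor-cancel false false = refl
  xor-cancel false true  = refl
  xor-cancel true  false = refl
  xor-cancel true  true  = refl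

  reversal-γ : ∀ v → reversal v γ ≡ yB v xor R v
  reversal-γ v with mixed v in eq
  ... | true  = refl
  ... | false = sym (trans (cong (yB v xor_) (proj₂ (proj₂ correction) v (advance-unmixed eq))) (xor-cancel (yA v) (yB v)))

  not-xor : ∀ a b → not a xor b ≡ not (a xor b)
  not-xor false b = refl
  not-xor true  b = sym (B.not-involutive b)

  mixed-inA : ∀ v → present v inA ≡ true → mixed v ≡ false
  mixed-inA v iA with present v outA in oA | present v outB in oB | present v inB in iB
  ... | true  | true  | true  = ⊥-elim (not-all-roles v oA iA oB iB)
  ... | true  | true  | false = refl
  ... | true  | false | _     = refl
  ... | false | _     | _     = refl

  -- If the outgoing end has γ, the third class is α, whose order `yA` alternates on A. If it has α,
  -- the third class is γ; then neither end is mixed, so γ is ordered by `yA` too.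
  A-edge : ∀ v u → present v outA ≡ true → present u inA ≡ true → yA u ≡ not (yA v) →
    ThirdReversed (label v outA) (label u inA) (reversal v) (reversal u)
  A-edge v u oA iA flips with present v outB in oB | present v inB in iB
  ... | true  | true  = (λ ()) , not-≢ flips
  ... | false | true  = (λ ()) , not-≢ flips
  ... | false | false = (λ ()) , not-≢ flips
  ... | true  | false = (λ ()) , λ eq → not-≢ flips (trans (sym (reversal-unmixed unmixed)) (trans eq (reversal-unmixed (mixed-inA u iA))))
    where
    unmixed : mixed v ≡ false
    unmixed rewrite oA | oB | iB = refl

  -- If the outgoing end has γ, the third class is β, whose order `yB` alternates on B. If it has β,
  -- the vertex is mixed and `R` takes the same value at both ends, so `yB xor R` alternates.
  B-edge : ∀ v → present v outB ≡ true → yB (head-B v) ≡ not (yB v) →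
    ThirdReversed (label v outB) (label (head-B v) inB) (reversal v) (reversal (head-B v))
  B-edge v oB flips with present v outA in oA | present v inB in iB
  ... | true  | false = (λ ()) , not-≢ flips
  ... | false | true  = (λ ()) , not-≢ flips
  ... | false | false = (λ ()) , not-≢ flips
  ... | true  | true  = (λ ()) , λ eq → not-≢ (trans (cong₂ _xor_ flips R-same) (not-xor (yB v) (R v)))
          (trans (sym (reversal-γ v)) (trans eq (reversal-γ (head-B v))))
    where
    is-mixed : mixed v ≡ true
    is-mixed rewrite oA | oB | iB = refl
    R-same : R (head-B v) ≡ R v
    R-same = trans (cong R (sym (advance-mixed is-mixed))) (proj₁ (proj₂ correction) v)

  class-of : Fin n → Fin 4 → Class
  class-of v i = label v (role (yA v) (yB v) i)

  present-role : ∀ {v i} → Used v i → present v (role (yA v) (yB v) i) ≡ true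
  present-role {v} {i} moved = trans (cong (used v) (colour-role (yA v) (yB v) i)) (used-true moved)

  flips-A : ∀ {v} i → i ≡ #0 ⊎ i ≡ #1 → Used v i → yA (mate i v) ≡ not (yA v)
  flips-A i (inj₁ refl) = proj₁ (proj₂ colouring-A) _
  flips-A i (inj₂ refl) = proj₂ (proj₂ colouring-A) _

  flips-B : ∀ {v} i → i ≡ #2 ⊎ i ≡ #3 → Used v i → yB (mate i v) ≡ not (yB v)
  flips-B i (inj₁ refl) = proj₁ (proj₂ colouring-B) _
  flips-B i (inj₂ refl) = proj₂ (proj₂ colouring-B) _

  Oriented : Fin n → Fin 4 → Set
  Oriented v i = ThirdReversed (class-of v i) (class-of (mate i v) i) (reversal v) (reversal (mate i v))

  ends-A : ∀ {v u i} → Used v i → Used u i → role (yA v) (yB v) i ≡ outA → role (yA u) (yB u) i ≡ inA → yA u ≡ not (yA v) →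
    ThirdReversed (class-of v i) (class-of u i) (reversal v) (reversal u)
  ends-A {v} {u} {i} mv mu rv ru flips = subst₂ (λ ρ σ → ThirdReversed (label v ρ) (label u σ) (reversal v) (reversal u)) (sym rv) (sym ru)
    (A-edge v u (trans (cong (present v) (sym rv)) (present-role mv)) (trans (cong (present u) (sym ru)) (present-role mu)) flips)

  ends-B : ∀ {v u i} → Used v i → u ≡ mate i v → role (yA v) (yB v) i ≡ outB → role (yA u) (yB u) i ≡ inB → yB u ≡ not (yB v) →
    ThirdReversed (class-of v i) (class-of u i) (reversal v) (reversal u)
  ends-B {v} {u} {i} mv refl rv ru flips = subst₂ (λ ρ σ → ThirdReversed (label v ρ) (label u σ) (reversal v) (reversal u)) (sym rv) (sym ru)
    (subst (λ w → ThirdReversed (label v outB) (label w inB) (reversal v) (reversal w)) head≡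
      (B-edge v (trans (cong (present v) (sym rv)) (present-role mv)) (trans (cong yB head≡) flips)))
    where
    head≡ : head-B v ≡ u
    head≡ = cong (λ k → mate k v) (trans (cong (colour-of (yA v) (yB v)) (sym rv)) (colour-role (yA v) (yB v) i))

  roles-A : ∀ {a a′ b b′} i → i ≡ #0 ⊎ i ≡ #1 → a′ ≡ not a →
    (role a b i ≡ outA × role a′ b′ i ≡ inA) ⊎ (role a b i ≡ inA × role a′ b′ i ≡ outA)
  roles-A {false} i (inj₁ refl) refl = inj₁ (refl , refl)
  roles-A {true}  i (inj₁ refl) refl = inj₂ (refl , refl)
  roles-A {false} i (inj₂ refl) refl = inj₂ (refl , refl)
  roles-A {true}  i (inj₂ refl) refl = inj₁ (refl , refl)

  roles-B : ∀ {a a′ b b′} i → i ≡ #2 ⊎ i ≡ #3 → b′ ≡ not b →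
    (role a b i ≡ outB × role a′ b′ i ≡ inB) ⊎ (role a b i ≡ inB × role a′ b′ i ≡ outB)
  roles-B {b = false} i (inj₁ refl) refl = inj₁ (refl , refl)
  roles-B {b = true}  i (inj₁ refl) refl = inj₂ (refl , refl)
  roles-B {b = false} i (inj₂ refl) refl = inj₂ (refl , refl)
  roles-B {b = true}  i (inj₂ refl) refl = inj₁ (refl , refl)

  not-sym : ∀ {b c} → b ≡ not c → c ≡ not b
  not-sym {c = c} eq = trans (sym (B.not-involutive c)) (cong not (sym eq))

  oriented-A : ∀ {v} i → i ≡ #0 ⊎ i ≡ #1 → Used v i → Oriented v i
  oriented-A {v} i i∈A mv with roles-A {yA v} {yA (mate i v)} {yB v} {yB (mate i v)} i i∈A (flips-A i i∈A mv)
  ... | inj₁ (rv , ru) = ends-A mv (Used-mate mv) rv ru (flips-A i i∈A mv)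
  ... | inj₂ (rv , ru) = ThirdReversed-sym {x = reversal (mate i v)} {y = reversal v} (ends-A (Used-mate mv) mv ru rv (not-sym (flips-A i i∈A mv)))

  oriented-B : ∀ {v} i → i ≡ #2 ⊎ i ≡ #3 → Used v i → Oriented v i
  oriented-B {v} i i∈B mv with roles-B {yA v} {yA (mate i v)} {yB v} {yB (mate i v)} i i∈B (flips-B i i∈B mv)
  ... | inj₁ (rv , ru) = ends-B mv refl rv ru (flips-B i i∈B mv)
  ... | inj₂ (rv , ru) = ThirdReversed-sym {x = reversal (mate i v)} {y = reversal v} (ends-B (Used-mate mv) (sym (involutive i v)) ru rv (not-sym (flips-B i i∈B mv)))

  oriented : ∀ {v} i → Used v i → Oriented v i
  oriented #0 = oriented-A #0 (inj₁ refl)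
  oriented #1 = oriented-A #1 (inj₂ refl)
  oriented #2 = oriented-B #2 (inj₁ refl)
  oriented #3 = oriented-B #3 (inj₂ refl)

  third-reversed : Labelling ThirdReversed
  third-reversed = record
    { class = class-of
    ; order = reversal
    ; class-injective = λ {v} {i} {j} mi mj eq → trans (sym (colour-role (yA v) (yB v) i))
        (trans (cong (colour-of (yA v) (yB v)) (label-injective v (role (yA v) (yB v) i) (role (yA v) (yB v) j) (present-role mi) (present-role mj) eq)) (colour-role (yA v) (yB v) j))
    ; related = λ {v} {i} → oriented i
    }

  abstract
    -- The order of class `c` has to alternate along edges of colour `c`, both of whose ends have
    -- class `c`, and also along edges of colour 3, where the classes of the ends may differ and all
    -- orders must be reversed.
    colouring-3 : ∀ (c : Class) → ∃ λ x → Alternating x (mate #3) × Alternating x (mate (F.inject₁ c))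
    colouring-3 c = colouring #3 (F.inject₁ c)

  -- An edge of colour 3 borrows the class of a colour absent at the vertex. If colours 0 and 1 are
  -- used beside it, colour 2 is absent by the degree bound, hence γ.
  first-absent : Fin n → Class
  first-absent v = if used v #0 then (if used v #1 then γ else β) else α

  class₃ : Fin n → Fin 4 → Class
  class₃ v #0 = α
  class₃ v #1 = β
  class₃ v #2 = γ
  class₃ v #3 = first-absent v

  order₃ : Fin n → Class → Bool
  order₃ v c = proj₁ (colouring-3 c) v

  first-absent-≢ : ∀ {v} i → Used v #3 → Used v i → i ≢ #3 → first-absent v ≢ class₃ v i
  first-absent-≢ {v} #0 m3 mi n eq rewrite used-true mi with used v #1
  first-absent-≢ {v} #0 m3 mi n () | true
  first-absent-≢ {v} #0 m3 mi n () | false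
  first-absent-≢ {v} #1 m3 mi n eq rewrite used-true mi with used v #0
  first-absent-≢ {v} #1 m3 mi n () | true
  first-absent-≢ {v} #1 m3 mi n () | false
  first-absent-≢ {v} #2 m3 mi n eq with used v #0 in u0 | used v #1 in u1
  ... | true | true = not-all u0 u1 (used-true mi) (used-true m3)
  first-absent-≢ {v} #2 m3 mi n () | true | false
  first-absent-≢ {v} #2 m3 mi n () | false | _
  first-absent-≢ {v} #3 m3 mi n eq = n refl

  class₃-injective : ∀ {v i j} → Used v i → Used v j → class₃ v i ≡ class₃ v j → i ≡ j
  class₃-injective {i = #0} {#0} mi mj eq = refl
  class₃-injective {i = #0} {#1} mi mj ()
  class₃-injective {i = #0} {#2} mi mj ()
  class₃-injective {i = #1} {#0} mi mj ()
  class₃-injective {i = #1} {#1} mi mj eq = refl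
  class₃-injective {i = #1} {#2} mi mj ()
  class₃-injective {i = #2} {#0} mi mj ()
  class₃-injective {i = #2} {#1} mi mj ()
  class₃-injective {i = #2} {#2} mi mj eq = refl
  class₃-injective {i = #3} {#3} mi mj eq = refl
  class₃-injective {i = #3} {#0} mi mj eq = contradiction eq (first-absent-≢ #0 mi mj (λ ()))
  class₃-injective {i = #3} {#1} mi mj eq = contradiction eq (first-absent-≢ #1 mi mj (λ ()))
  class₃-injective {i = #3} {#2} mi mj eq = contradiction eq (first-absent-≢ #2 mi mj (λ ()))
  class₃-injective {i = #0} {#3} mi mj eq = contradiction (sym eq) (first-absent-≢ #0 mj mi (λ ()))
  class₃-injective {i = #1} {#3} mi mj eq = contradiction (sym eq) (first-absent-≢ #1 mj mi (λ ()))
  class₃-injective {i = #2} {#3} mi mj eq = contradiction (sym eq) (first-absent-≢ #2 mj mi (λ ()))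

  related₃ : ∀ {v} i → Used v i → OwnOrAllReversed (class₃ v i) (class₃ (mate i v) i) (order₃ v) (order₃ (mate i v))
  related₃ {v} #0 m = inj₁ (refl , not-≢ (proj₂ (proj₂ (colouring-3 α)) v m))
  related₃ {v} #1 m = inj₁ (refl , not-≢ (proj₂ (proj₂ (colouring-3 β)) v m))
  related₃ {v} #2 m = inj₁ (refl , not-≢ (proj₂ (proj₂ (colouring-3 γ)) v m))
  related₃ {v} #3 m with first-absent v F.≟ first-absent (mate #3 v)
  ... | yes eq = inj₁ (eq , not-≢ (proj₁ (proj₂ (colouring-3 (first-absent v))) v m))
  ... | no neq = inj₂ (neq , λ c → not-≢ (proj₁ (proj₂ (colouring-3 c)) v m))

  own-or-all-reversed : Labelling OwnOrAllReversed
  own-or-all-reversed = record { class = class₃ ; order = order₃ ; class-injective = class₃-injective ; related = λ {v} {i} → related₃ i }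

  -- Four symbols as vectors over 𝔽₂: the symbol of a half-edge differs from that of its vertex by a vector
  -- whose first coordinate is 1 on A and whose second coordinate is 1 on B.
  offset : Fin n → Fin 4 → Bool × Bool
  offset v #0 = true , false
  offset v #1 = true , used v #0
  offset v #2 = false , true
  offset v #3 = used v #2 , true

  symbol : Bool × Bool → Fin 4
  symbol (false , false) = #0
  symbol (false , true)  = #1
  symbol (true  , false) = #2
  symbol (true  , true)  = #3

  vector : Fin 4 → Bool × Bool
  vector #0 = false , false
  vector #1 = false , true
  vector #2 = true  , false
  vector #3 = true  , true

  vector-symbol : ∀ p → vector (symbol p) ≡ p
  vector-symbol (false , false) = refl
  vector-symbol (false , true)  = refl
  vector-symbol (true  , false) = refl
  vector-symbol (true  , true)  = refl

  symbol-injective : ∀ {p q} → symbol p ≡ symbol q → p ≡ q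
  symbol-injective {p} {q} eq = trans (sym (vector-symbol p)) (trans (cong vector eq) (vector-symbol q))

  centre-symbol : Fin n → Fin 4
  centre-symbol v = symbol (yA v , yB v)

  outer-symbol : Fin n → Fin 4 → Fin 4
  outer-symbol v i = symbol (proj₁ (offset v i) xor yA v , proj₂ (offset v i) xor yB v)

  not-fixed : ∀ {b} → not b ≢ b
  not-fixed {true}  ()
  not-fixed {false} ()

  outer-≢-centre : ∀ v i → outer-symbol v i ≢ centre-symbol v
  outer-≢-centre v #0 eq = not-fixed (cong proj₁ (symbol-injective eq))
  outer-≢-centre v #1 eq = not-fixed (cong proj₁ (symbol-injective eq))
  outer-≢-centre v #2 eq = not-fixed (cong proj₂ (symbol-injective eq))
  outer-≢-centre v #3 eq = not-fixed (cong proj₂ (symbol-injective eq))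

  centres-differ : ∀ {v} i → Used v i → centre-symbol v ≢ centre-symbol (mate i v)
  centres-differ #0 m eq = not-≢ (flips-A #0 (inj₁ refl) m) (cong proj₁ (symbol-injective eq))
  centres-differ #1 m eq = not-≢ (flips-A #1 (inj₂ refl) m) (cong proj₁ (symbol-injective eq))
  centres-differ #2 m eq = not-≢ (flips-B #2 (inj₁ refl) m) (cong proj₂ (symbol-injective eq))
  centres-differ #3 m eq = not-≢ (flips-B #3 (inj₂ refl) m) (cong proj₂ (symbol-injective eq))

  -- On an A-edge the first coordinate of the offset is 1 at both ends, on a B-edge the second, so
  -- the alternation of `yA` or `yB` survives the shift.
  outers-differ : ∀ {v} i → Used v i → outer-symbol v i ≢ outer-symbol (mate i v) i
  outers-differ #0 m eq = not-≢ (flips-A #0 (inj₁ refl) m) (B.not-injective (cong proj₁ (symbol-injective eq)))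
  outers-differ #1 m eq = not-≢ (flips-A #1 (inj₂ refl) m) (B.not-injective (cong proj₁ (symbol-injective eq)))
  outers-differ #2 m eq = not-≢ (flips-B #2 (inj₁ refl) m) (B.not-injective (cong proj₂ (symbol-injective eq)))
  outers-differ #3 m eq = not-≢ (flips-B #3 (inj₂ refl) m) (B.not-injective (cong proj₂ (symbol-injective eq)))

  xor-injective : ∀ {a b} c → a xor c ≡ b xor c → a ≡ b
  xor-injective {false} {false} c eq = refl
  xor-injective {true}  {true}  c eq = refl
  xor-injective {false} {true}  c eq = contradiction (sym eq) not-fixed
  xor-injective {true}  {false} c eq = contradiction eq not-fixed

  -- The `used` bits separate the two colours of one subgraph when both are present. Only colours 1
  -- and 3 can then still collide, and only if 0 and 2 are present as well, which would make four
  -- edges at `v`.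
  offset-injective : ∀ {v} i j → Used v i → Used v j → offset v i ≡ offset v j → i ≡ j
  offset-injective #0 #0 mi mj eq = refl
  offset-injective #1 #1 mi mj eq = refl
  offset-injective #2 #2 mi mj eq = refl
  offset-injective #3 #3 mi mj eq = refl
  offset-injective #0 #1 mi mj eq = contradiction (trans (cong proj₂ eq) (used-true mi)) (λ ())
  offset-injective #1 #0 mi mj eq = contradiction (trans (cong proj₂ (sym eq)) (used-true mj)) (λ ())
  offset-injective #0 #2 mi mj ()
  offset-injective #2 #0 mi mj ()
  offset-injective #0 #3 mi mj eq = contradiction (cong proj₂ eq) (λ ())
  offset-injective #3 #0 mi mj eq = contradiction (cong proj₂ eq) (λ ())
  offset-injective #1 #2 mi mj eq = contradiction (cong proj₁ eq) (λ ())
  offset-injective #2 #1 mi mj eq = contradiction (cong proj₁ eq) (λ ())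
  offset-injective #1 #3 mi mj eq = ⊥-elim (not-all (cong proj₂ eq) (used-true mi) (sym (cong proj₁ eq)) (used-true mj))
  offset-injective #3 #1 mi mj eq = ⊥-elim (not-all (sym (cong proj₂ eq)) (used-true mj) (cong proj₁ eq) (used-true mi))
  offset-injective #2 #3 mi mj eq = contradiction (trans (cong proj₁ eq) (used-true mi)) (λ ())
  offset-injective #3 #2 mi mj eq = contradiction (trans (cong proj₁ (sym eq)) (used-true mj)) (λ ())

  outer-injective : ∀ {v i j} → Used v i → Used v j → outer-symbol v i ≡ outer-symbol v j → i ≡ j
  outer-injective {v} {i} {j} mi mj eq = offset-injective i j mi mj
    (cong₂ _,_ (xor-injective (yA v) (cong proj₁ (symbol-injective eq))) (xor-injective (yB v) (cong proj₂ (symbol-injective eq))))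

-- Short walks and cliques in the subdivision.

module Subdivision (G : FinGraph) (n′ : ℕ) where

  n : ℕ
  n = suc n′

  HalfEdge : Set
  HalfEdge = Edge G × Bool

  base : HalfEdge → Fin (N G)
  base ((u , v , _) , false) = u
  base ((u , v , _) , true)  = v

  op : HalfEdge → HalfEdge
  op (e , d) = e , not d

  point : HalfEdge → ℕ → SubV G n
  point (e , false) i = pathPos G n e i
  point (e , true)  i = pathPos G n e (n ∸ i)

  pathPos-end : ∀ e → pathPos G n e n ≡ inj₁ (base (e , true))
  pathPos-end e with n′ <? n′
  ... | yes p = contradiction p (n≮n n′)
  ... | no _  = refl

  pathPos-inside : ∀ e {k} (p : k < n′) → pathPos G n e (suc k) ≡ inj₂ (e , fromℕ< p)
  pathPos-inside e {k} p with k <? n′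
  ... | yes _ = refl
  ... | no ¬p = contradiction p ¬p

  End : ℕ → Set
  End i = i ≡ 0 ⊎ i ≡ n

  data Where (e : Edge G) : ℕ → Set where
    at-start : Where e 0
    at-end   : Where e n
    inside   : ∀ {k} (p : k < n′) → Where e (suc k)

  locate : ∀ e {i} → i ≤ n → Where e i
  locate e {zero}  _ = at-start
  locate e {suc k} h with m≤n⇒m<n∨m≡n (s≤s⁻¹ h)
  ... | inj₁ p    = inside p
  ... | inj₂ refl = at-end

  inside-≢-vertex : ∀ {e k} {p : k < n′} {x v} → pathPos G n e (suc k) ≡ x → x ≢ inj₁ v
  inside-≢-vertex {e} {p = p} refl eq with () ← trans (sym (pathPos-inside e p)) eq

  pathPos-injective : ∀ {e e′ i i′} → i ≤ n → i′ ≤ n → pathPos G n e i ≡ pathPos G n e′ i′ → (e ≡ e′ × i ≡ i′) ⊎ (End i × End i′)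
  pathPos-injective {e} {e′} h h′ eq with locate e h | locate e′ h′
  ... | at-start | at-start = inj₂ (inj₁ refl , inj₁ refl)
  ... | at-start | at-end   = inj₂ (inj₁ refl , inj₂ refl)
  ... | at-end   | at-start = inj₂ (inj₂ refl , inj₁ refl)
  ... | at-end   | at-end   = inj₂ (inj₂ refl , inj₂ refl)
  ... | at-start | inside p = contradiction refl (inside-≢-vertex {p = p} (sym eq))
  ... | inside p | at-start = contradiction refl (inside-≢-vertex {p = p} eq)
  ... | at-end   | inside p = contradiction (pathPos-end e) (inside-≢-vertex {p = p} (sym eq))
  ... | inside p | at-end   = contradiction (pathPos-end e′) (inside-≢-vertex {p = p} eq)
  ... | inside {k} p | inside {k′} p′ with Sumₚ.inj₂-injective (trans (sym (pathPos-inside e p)) (trans eq (pathPos-inside e′ p′)))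
  ...   | eq′ = inj₁ (cong proj₁ eq′ , cong suc (trans (sym (F.toℕ-fromℕ< p)) (trans (cong (toℕ ∘ proj₂) eq′) (F.toℕ-fromℕ< p′))))

  point-start : ∀ h → point h 0 ≡ inj₁ (base h)
  point-start (e , false) = refl
  point-start (e , true)  = pathPos-end e

  point-op : ∀ h {i} → i ≤ n → point (op h) i ≡ point h (n ∸ i)
  point-op (e , false) _ = refl
  point-op (e , true)  i≤n = cong (pathPos G n e) (sym (m∸[m∸n]≡n i≤n))

  point-opposite : ∀ h {i j} → i + j ≡ n → point h i ≡ point (op h) j
  point-opposite h {i} {j} eq = sym (trans (point-op h (≤-trans (m≤n+m j i) (≤-reflexive eq)))
    (cong (point h) (trans (cong (_∸ j) (sym eq)) (m+n∸n≡m i j))))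

  point-end : ∀ h → point h n ≡ inj₁ (base (op h))
  point-end h = trans (point-opposite h (+-identityʳ n)) (point-start (op h))

  data Coincide (h h′ : HalfEdge) (i i′ : ℕ) : Set where
    equal    : h ≡ h′ → i ≡ i′ → Coincide h h′ i i′
    opposite : h′ ≡ op h → i + i′ ≡ n → Coincide h h′ i i′
    vertices : End i → End i′ → Coincide h h′ i i′

  End-opposite : ∀ {i} → i ≤ n → End (n ∸ i) → End i
  End-opposite i≤n (inj₁ eq) = inj₂ (≤-antisym i≤n (m∸n≡0⇒m≤n eq))
  End-opposite i≤n (inj₂ eq) = inj₁ (trans (sym (m∸[m∸n]≡n i≤n)) (trans (cong (n ∸_) eq) (n∸n≡0 n)))

  coincide : ∀ h h′ {i i′} → i ≤ n → i′ ≤ n → point h i ≡ point h′ i′ → Coincide h h′ i i′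
  coincide (e , false) (e′ , false) p p′ eq with pathPos-injective {e} {e′} p p′ eq
  ... | inj₁ (refl , refl) = equal refl refl
  ... | inj₂ (x , y)       = vertices x y
  coincide (e , false) (e′ , true) {i} {i′} p p′ eq with pathPos-injective {e} {e′} p (m∸n≤m n i′) eq
  ... | inj₁ (refl , refl) = opposite refl (m∸n+n≡m p′)
  ... | inj₂ (x , y)       = vertices x (End-opposite p′ y)
  coincide (e , true) (e′ , false) {i} {i′} p p′ eq with pathPos-injective {e} {e′} (m∸n≤m n i) p′ eq
  ... | inj₁ (refl , refl) = opposite refl (m+[n∸m]≡n p)
  ... | inj₂ (x , y)       = vertices (End-opposite p x) y
  coincide (e , true) (e′ , true) {i} {i′} p p′ eq with pathPos-injective {e} {e′} (m∸n≤m n i) (m∸n≤m n i′) eq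
  ... | inj₁ (refl , eq′) = equal refl (∸-cancelˡ-≡ p p′ eq′)
  ... | inj₂ (x , y)       = vertices (End-opposite p x) (End-opposite p′ y)

  _~_ : SubV G n → SubV G n → Set
  x ~ y = SubAdj G n x y

  consecutive : ∀ h {k} → k < n → point h k ~ point h (suc k)
  consecutive (e , false) k<n = e , _ , k<n , inj₁ (refl , refl)
  consecutive (e , true) {k} k<n = e , n ∸ suc k , s≤s (m∸n≤m n′ k) , inj₂ (refl , cong (pathPos G n e) (sym (+-∸-assoc 1 k<n)))

  ~-sym : ∀ {x y} → x ~ y → y ~ x
  ~-sym (e , k , k<n , inj₁ p) = e , k , k<n , inj₂ p
  ~-sym (e , k , k<n , inj₂ p) = e , k , k<n , inj₁ p

  as-step : ∀ {x y} → x ~ y → ∃₂ λ h k → k < n × x ≡ point h k × y ≡ point h (suc k)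
  as-step (e , k , k<n , inj₁ (p , q)) = (e , false) , k , k<n , sym p , sym q
  as-step (e , k , k<n , inj₂ (p , q)) = (e , true) , n ∸ suc k , s≤s (m∸n≤m n′ k) ,
    trans (sym q) (cong (pathPos G n e) (sym (m∸[m∸n]≡n k<n))) ,
    trans (sym p) (cong (pathPos G n e) (sym (trans (cong (n ∸_) (sym (+-∸-assoc 1 k<n))) (m∸[m∸n]≡n (<⇒≤ k<n)))))

  data Close (x y : SubV G n) (ℓ : ℕ) : Set where
    stay    : x ≡ y → Close x y ℓ
    along   : ∀ h {i j} → i ≤ j → j ≤ i + ℓ → j ≤ n → x ≡ point h i → y ≡ point h j → Close x y ℓ
    through : ∀ h h′ {i j} → base h ≡ base h′ → i + j ≤ ℓ → x ≡ point h i → y ≡ point h′ j → Close x y ℓ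

  -- Induction on the first step. It moves along the half-edge on which the rest of the walk starts,
  -- in either direction, or it arrives at the branch vertex from which the rest starts, and then
  -- its reversed half-edge becomes the first one of `through`.
  walk-close : ∀ {x y ℓ} → Walk (subdivision G n) x y ℓ → ℓ < n → Close x y ℓ
  walk-close (here x) _ = stay refl
  walk-close {x} {y} {suc ℓ} (step {y = z} xz w) ℓ<n with as-step xz | walk-close w (<-trans (n<1+n ℓ) ℓ<n)
  ... | h , k , k<n , xk , zk | close = prepend close
    where
    last-step : z ≡ y → Close x y (suc ℓ)
    last-step refl = along h (n≤1+n k) (≤-trans (s≤s (m≤m+n k ℓ)) (≤-reflexive (sym (+-suc k ℓ)))) k<n xk zk
    at-vertex : suc k ≡ n → x ≡ point (op h) 1
    at-vertex eq = trans xk (point-opposite h (trans (+-comm k 1) eq))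
    vertex-base : ∀ h₁ → suc k ≡ n → z ≡ point h₁ 0 → base (op h) ≡ base h₁
    vertex-base h₁ refl eq = Sumₚ.inj₁-injective (trans (sym (point-end h)) (trans (sym zk) (trans eq (point-start h₁))))
    one-back : ∀ {i} → suc k + i ≡ n → x ≡ point (op h) (suc i)
    one-back {i} eq = trans xk (point-opposite h (trans (+-suc k i) eq))
    prepend : Close z y ℓ → Close x y (suc ℓ)
    prepend (stay eq) = last-step eq
    prepend (along h₁ {i} {j} i≤j j≤i+ℓ j≤n zi yj) with coincide h h₁ k<n (≤-trans i≤j j≤n) (trans (sym zk) zi)
    ... | equal refl refl = along h (<⇒≤ i≤j) (≤-trans j≤i+ℓ (≤-reflexive (sym (+-suc k ℓ)))) j≤n xk yj
    ... | opposite refl eq with m≤n⇒m<n∨m≡n i≤j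
    ...   | inj₁ i<j  = along h₁ i<j (≤-trans j≤i+ℓ (+-mono-≤ (n≤1+n i) (n≤1+n ℓ))) j≤n (one-back eq) yj
    ...   | inj₂ refl = last-step (trans zi (sym yj))
    prepend (along h₁ i≤j j≤i+ℓ j≤n zi yj) | vertices (inj₂ eq) (inj₁ refl) =
      through (op h) h₁ (vertex-base h₁ eq zi) (s≤s j≤i+ℓ) (at-vertex eq) yj
    prepend (along h₁ i≤j j≤i+ℓ j≤n zi yj) | vertices (inj₂ eq) (inj₂ refl) =
      last-step (trans zi (trans (cong (point h₁) (≤-antisym i≤j j≤n)) (sym yj)))
    prepend (through h₁ h₂ {i} {j} b i+j≤ℓ zi yj) with coincide h h₁ k<n (≤-trans (m≤m+n i j) (≤-trans i+j≤ℓ (<⇒≤ (<-trans (n<1+n ℓ) ℓ<n)))) (trans (sym zk) zi)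
    ... | equal refl refl = through h h₂ b (≤-trans (n≤1+n (k + j)) (≤-trans i+j≤ℓ (n≤1+n ℓ))) xk yj
    ... | opposite refl eq = through h₁ h₂ b (s≤s i+j≤ℓ) (one-back eq) yj
    ... | vertices (inj₂ eq) (inj₁ refl) = through (op h) h₂ (trans (vertex-base h₁ eq zi) b) (s≤s i+j≤ℓ) (at-vertex eq) yj
    -- Here the walk would traverse a whole subdivided edge and pass a second branch vertex, which
    -- takes `n` steps.
    ... | vertices (inj₂ eq) (inj₂ refl) = contradiction (≤-trans (s≤s (≤-trans (m≤m+n n j) i+j≤ℓ)) (<⇒≤ ℓ<n)) (n≮n n)

  walk-to-base : ∀ h i → i ≤ n → Walk (subdivision G n) (point h i) (inj₁ (base h)) i
  walk-to-base h zero    _   = subst (λ x → Walk (subdivision G n) x (inj₁ (base h)) 0) (sym (point-start h)) (here _)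
  walk-to-base h (suc i) i<n = step (~-sym (consecutive h i<n)) (walk-to-base h i (<⇒≤ i<n))

  walk-snoc : ∀ {x y z ℓ} → Walk (subdivision G n) x y ℓ → y ~ z → Walk (subdivision G n) x z (suc ℓ)
  walk-snoc (here _)   e = step e (here _)
  walk-snoc (step d w) e = step d (walk-snoc w e)

  walk-from-base : ∀ h i → i ≤ n → Walk (subdivision G n) (inj₁ (base h)) (point h i) i
  walk-from-base h zero    _   = subst (λ x → Walk (subdivision G n) (inj₁ (base h)) x 0) (sym (point-start h)) (here _)
  walk-from-base h (suc i) i<n = walk-snoc (walk-from-base h i (<⇒≤ i<n)) (consecutive h i<n)

  walk-append : ∀ {x y z ℓ ℓ′} → Walk (subdivision G n) x y ℓ → Walk (subdivision G n) y z ℓ′ → Walk (subdivision G n) x z (ℓ + ℓ′)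
  walk-append (here _)   w′ = w′
  walk-append (step d w) w′ = step d (walk-append w w′)

  half-edge : ∀ {v u} → adj G v u ≡ true → ∃ λ h → base h ≡ v × base (op h) ≡ u
  half-edge {v} {u} vu with F.<-cmp v u
  ... | tri< v<u _ _ = ((v , u , v<u , subst T (sym vu) _) , false) , refl , refl
  ... | tri> _ _ u<v = ((u , v , u<v , subst T (sym (trans (FinGraph.sym G u v) vu)) _) , true) , refl , refl
  ... | tri≈ _ refl _ with () ← trans (sym vu) (irref G v)

  -- The ball of radius r around a branch vertex of degree 3.
  clique : ∀ r → r + r < n → ∀ v (g : Fin 3 → Fin (N G)) → Injective _≡_ _≡_ g → (∀ c → adj G v (g c) ≡ true) →
    HasClique (fracPower G (r + r) n) (suc (3 * r))
  clique r 2r<n v g g-inj vg = f , λ i j i≢j → distinct i j i≢j , distinct i j i≢j , close i j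
    where
    h : Fin 3 → HalfEdge
    h c = proj₁ (half-edge (vg c))
    h-injective : ∀ {c c′} → h c ≡ h c′ → c ≡ c′
    h-injective {c} {c′} eq = g-inj (trans (sym (proj₂ (proj₂ (half-edge (vg c))))) (trans (cong (base ∘ op) eq) (proj₂ (proj₂ (half-edge (vg c′))))))
    r≤n : r ≤ n
    r≤n = ≤-trans (m≤m+n r r) (<⇒≤ 2r<n)
    member : Fin 3 × Fin r → SubV G n
    member (c , k) = point (h c) (suc (toℕ k))
    f : Fin (suc (3 * r)) → SubV G n
    f zero    = inj₁ v
    f (suc i) = member (F.remQuot r i)
    near : ∀ (k : Fin r) → suc (toℕ k) ≤ n
    near k = ≤-trans (F.toℕ<n k) r≤n
    interior : ∀ (k : Fin r) → ¬ End (suc (toℕ k))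
    interior k (inj₂ eq) = <-irrefl eq (≤-trans (s≤s (F.toℕ<n k)) (≤-trans (s≤s (m≤m+n r r)) 2r<n))
    base-h : ∀ c → base (h c) ≡ v
    base-h c = proj₁ (proj₂ (half-edge (vg c)))
    at-centre : ∀ c → point (h c) 0 ≡ inj₁ v
    at-centre c = trans (point-start (h c)) (cong inj₁ (base-h c))
    centre-≢ : ∀ z → inj₁ v ≢ member z
    centre-≢ (c , k) eq with coincide (h c) (h c) z≤n (near k) (trans (at-centre c) eq)
    ... | opposite _ e = interior k (inj₂ e)
    ... | vertices _ e = interior k e
    member-injective : ∀ {z z′} → member z ≡ member z′ → z ≡ z′
    member-injective {c , k} {c′ , k′} eq with coincide (h c) (h c′) (near k) (near k′) eq
    ... | equal e e′ = cong₂ _,_ (h-injective e) (F.toℕ-injective (suc-injective e′))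
    ... | opposite _ e = contradiction (≤-trans 2r<n (≤-trans (≤-reflexive (sym e)) (+-mono-≤ (F.toℕ<n k) (F.toℕ<n k′)))) (n≮n (r + r))
    ... | vertices e _ = contradiction e (interior k)
    distinct : ∀ i j → i ≢ j → f i ≢ f j
    distinct zero    zero    i≢j _  = i≢j refl
    distinct zero    (suc j) _   eq = centre-≢ (F.remQuot r j) eq
    distinct (suc i) zero    _   eq = centre-≢ (F.remQuot r i) (sym eq)
    distinct (suc i) (suc j) i≢j eq = i≢j (cong suc (trans (sym (F.combine-remQuot {3} r i))
      (trans (cong (λ z → F.combine (proj₁ z) (proj₂ z)) (member-injective eq)) (F.combine-remQuot {3} r j))))
    to-centre : ∀ i → ∃ λ ℓ → ℓ ≤ r × Walk (subdivision G n) (f i) (inj₁ v) ℓ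
    to-centre zero    = 0 , z≤n , here _
    to-centre (suc i) = suc (toℕ k) , F.toℕ<n k , subst (λ x → Walk (subdivision G n) (f (suc i)) (inj₁ x) (suc (toℕ k))) (base-h c) (walk-to-base (h c) _ (near k))
      where
      c = proj₁ (F.remQuot {3} r i)
      k = proj₂ (F.remQuot {3} r i)
    from-centre : ∀ i → ∃ λ ℓ → ℓ ≤ r × Walk (subdivision G n) (inj₁ v) (f i) ℓ
    from-centre zero    = 0 , z≤n , here _
    from-centre (suc i) = suc (toℕ k) , F.toℕ<n k , subst (λ x → Walk (subdivision G n) (inj₁ x) (f (suc i)) (suc (toℕ k))) (base-h c) (walk-from-base (h c) _ (near k))
      where
      c = proj₁ (F.remQuot {3} r i)
      k = proj₂ (F.remQuot {3} r i)
    close : ∀ i j → DistLe (subdivision G n) (f i) (f j) (r + r)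
    close i j with to-centre i | from-centre j
    ... | ℓ , ℓ≤r , w | ℓ′ , ℓ′≤r , w′ = ℓ + ℓ′ , +-mono-≤ ℓ≤r ℓ′≤r , walk-append w w′

  -- A proper colouring from words on the edges.

  module Assembly {C : Set} (Valid : C → Set) (r : ℕ) (2r<n : r + r < n)
    (f : Fin (N G) → C) (pos : Fin (N G) → C → ℕ) (side : HalfEdge → ℕ → C)
    (valid-f : ∀ v → Valid (f v))
    (side-0 : ∀ h → side h 0 ≡ f (base h))
    (side-pos : ∀ h {i} → i ≤ r → pos (base h) (side h i) ≡ i)
    (side-injective : ∀ {h h′ i i′} → base h ≡ base h′ → 1 ≤ i → i ≤ r → i′ ≤ r → side h i ≡ side h′ i′ → h ≡ h′)
    (words : ∀ e → Word Valid r n (side (e , false)) (side (e , true)) (pos (base (e , false))) (pos (base (e , true))))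
    where

    reading : HalfEdge → ℕ → C
    reading (e , false) i = Word.W (words e) i
    reading (e , true)  i = Word.W (words e) (n ∸ i)

    colour : SubV G n → C
    colour (inj₁ v)       = f v
    colour (inj₂ (e , k)) = Word.W (words e) (suc (toℕ k))

    colour-path : ∀ e {i} → i ≤ n → colour (pathPos G n e i) ≡ Word.W (words e) i
    colour-path e h with locate e h
    ... | at-start = sym (trans (Word.start (words e) z≤n) (side-0 (e , false)))
    ... | at-end   = trans (cong colour (pathPos-end e)) (sym (trans (Word.end (words e) (+-identityʳ n) z≤n) (side-0 (e , true))))
    ... | inside p = trans (cong colour (pathPos-inside e p)) (cong (λ k → Word.W (words e) (suc k)) (F.toℕ-fromℕ< p))

    colour-point : ∀ h {i} → i ≤ n → colour (point h i) ≡ reading h i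
    colour-point (e , false) i≤n = colour-path e i≤n
    colour-point (e , true) {i} i≤n = colour-path e (m∸n≤m n i)

    colour-valid : ∀ x → Valid (colour x)
    colour-valid (inj₁ v)       = valid-f v
    colour-valid (inj₂ (e , k)) = Word.valid (words e) (m<n⇒m<1+n (F.toℕ<n k) )

    reading-window : ∀ h {i j} → i < j → j ≤ n → j ≤ i + (r + r) → reading h i ≢ reading h j
    reading-window (e , false) i<j j≤n close = Word.window (words e) i<j j≤n close
    reading-window (e , true) {i} {j} i<j j≤n close eq =
      Word.window (words e) (∸-monoʳ-< i<j j≤n) (m∸n≤m n i) (gap (n ∸ i) (n ∸ j) (m+[n∸m]≡n (≤-trans (<⇒≤ i<j) j≤n)) (m+[n∸m]≡n j≤n)) (sym eq)
      where
      gap : ∀ x y → i + x ≡ n → j + y ≡ n → x ≤ y + (r + r)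
      gap x y p q = shift x y (trans p (sym q))
        where
        shift : ∀ x y → i + x ≡ j + y → x ≤ y + (r + r)
        shift x y o = lin 0 (≤-reflexive o ⊕ close) (solve (x ∷ y ∷ r ∷ i ∷ j ∷ []))

    reading-start : ∀ h {i} → i ≤ r → reading h i ≡ side h i
    reading-start (e , false) i≤r = Word.start (words e) i≤r
    reading-start (e , true)  i≤r = Word.end (words e) (m∸n+n≡m (≤-trans i≤r (≤-trans (m≤m+n r r) (<⇒≤ 2r<n)))) i≤r

    reading-near : ∀ h {i} → i ≤ r + r → On r (side h) (reading h i) ⊎ r + r < pos (base h) (reading h i) + i
    reading-near (e , false) i≤2r = Word.near (words e) i≤2r
    reading-near (e , true)  i≤2r = Word.far (words e) (m∸n+n≡m (≤-trans i≤2r (<⇒≤ 2r<n))) i≤2r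

    reading-distinct : ∀ h {i j} → i ≤ r + r → j ≤ r + r → i ≢ j → reading h i ≢ reading h j
    reading-distinct h {i} {j} i≤ j≤ i≢j eq with <-cmp i j
    ... | tri< i<j _ _ = reading-window h i<j (≤-trans j≤ (<⇒≤ 2r<n)) (≤-trans j≤ (m≤n+m (r + r) i)) eq
    ... | tri≈ _ i≡j _ = i≢j i≡j
    ... | tri> _ _ j<i = reading-window h j<i (≤-trans i≤ (<⇒≤ 2r<n)) (≤-trans i≤ (m≤n+m (r + r) j)) (sym eq)

    -- A colour at distance `i ≤ r` has position `i` at the common base. By `reading-near` it is
    -- either on the side of `h′`, and a colour identifies its half-edge, or it satisfies i + j >
    -- 2r.
    crossing : ∀ {h h′ i j} → base h ≡ base h′ → 1 ≤ i → i ≤ r → i + j ≤ r + r → reading h i ≡ reading h′ j → h ≡ h′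
    crossing {h} {h′} {i} {j} b 1≤i i≤r i+j≤ eq with reading-near h′ {j} (≤-trans (m≤n+m j i) i+j≤)
    ... | inj₁ (k , k≤r , sk) = side-injective b 1≤i i≤r k≤r (trans (sym (reading-start h i≤r)) (trans eq (sym sk)))
    ... | inj₂ far = contradiction (≤-trans far (≤-trans (≤-reflexive (cong (_+ j) pos≡)) i+j≤)) (n≮n _)
      where
      pos≡ : pos (base h′) (reading h′ j) ≡ i
      pos≡ = trans (cong₂ pos (sym b) (trans (sym eq) (reading-start h i≤r))) (side-pos h i≤r)

    half : ∀ {i j} → i + j ≤ r + r → i ≤ r ⊎ j ≤ r
    half {i} {j} h with i ≤? r | j ≤? r
    ... | yes p | _     = inj₁ p
    ... | no _  | yes q = inj₂ q
    ... | no p  | no q  = contradiction (≤-trans (+-mono-< (≰⇒> p) (≰⇒> q)) h) (n≮n _)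

    -- If one of the vertices is the common base, both lie on one half-edge and the windows separate
    -- them. Otherwise one of the distances is at most r, and `crossing` reduces to a single
    -- half-edge again.
    close-distinct : ∀ {x y} → x ≢ y → Close x y (r + r) → colour x ≢ colour y
    close-distinct x≢y (stay eq) _ = x≢y eq
    close-distinct x≢y (along h {i} {j} i≤j close j≤n xi yj) eq with m≤n⇒m<n∨m≡n i≤j
    ... | inj₂ refl = x≢y (trans xi (sym yj))
    ... | inj₁ i<j  = reading-window h i<j j≤n close (trans (sym (colour-point h (≤-trans i≤j j≤n)))
      (trans (cong colour (sym xi)) (trans eq (trans (cong colour yj) (colour-point h j≤n)))))
    close-distinct {x} {y} x≢y (through h h′ {i} {j} b i+j≤ xi yj) eq = cases i j i+j≤ xi yj same-reading
      where
      i≤2r : i ≤ r + r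
      i≤2r = ≤-trans (m≤m+n i j) i+j≤
      j≤2r : j ≤ r + r
      j≤2r = ≤-trans (m≤n+m j i) i+j≤
      same-reading : reading h i ≡ reading h′ j
      same-reading = trans (sym (colour-point h (≤-trans i≤2r (<⇒≤ 2r<n)))) (trans (cong colour (sym xi))
        (trans eq (trans (cong colour yj) (colour-point h′ (≤-trans j≤2r (<⇒≤ 2r<n))))))
      start-reading : reading h 0 ≡ reading h′ 0
      start-reading = trans (reading-start h z≤n) (trans (side-0 h) (trans (cong f b) (sym (trans (reading-start h′ z≤n) (side-0 h′)))))
      start-point : point h 0 ≡ point h′ 0
      start-point = trans (point-start h) (trans (cong inj₁ b) (sym (point-start h′)))
      on-one : ∀ h i j → i + j ≤ r + r → x ≡ point h i → y ≡ point h j → reading h i ≢ reading h j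
      on-one h i j i+j≤ xi yj = reading-distinct h (≤-trans (m≤m+n i j) i+j≤) (≤-trans (m≤n+m j i) i+j≤)
        (λ i≡j → x≢y (trans xi (trans (cong (point h) i≡j) (sym yj))))
      merge : ∀ i j → i + j ≤ r + r → x ≡ point h i → y ≡ point h′ j → reading h i ≡ reading h′ j → h ≡ h′ → ⊥
      merge i j i+j≤ xi yj eq refl = on-one h i j i+j≤ xi yj eq
      cases : ∀ i j → i + j ≤ r + r → x ≡ point h i → y ≡ point h′ j → reading h i ≡ reading h′ j → ⊥
      cases zero j i+j≤ xi yj eq = on-one h′ 0 j i+j≤ (trans xi start-point) yj (trans (sym start-reading) eq)
      cases (suc i) zero i+j≤ xi yj eq = on-one h (suc i) 0 i+j≤ xi (trans yj (sym start-point)) (trans eq (sym start-reading))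
      cases (suc i) (suc j) i+j≤ xi yj eq with half i+j≤
      ... | inj₁ i≤r = merge (suc i) (suc j) i+j≤ xi yj eq (crossing b (s≤s z≤n) i≤r i+j≤ eq)
      ... | inj₂ j≤r = merge (suc i) (suc j) i+j≤ xi yj eq
        (sym (crossing (sym b) (s≤s z≤n) j≤r (≤-trans (≤-reflexive (+-comm (suc j) (suc i))) i+j≤) (sym eq)))

    colourable : ∀ {k} (code : C → Fin k) → (∀ {c d} → Valid c → Valid d → code c ≡ code d → c ≡ d) → Colourable (fracPower G (r + r) n) k
    colourable code code-injective = code ∘ colour , λ x y (x≢y , ℓ , ℓ≤ , w) eq →
      close-distinct x≢y (weaken ℓ≤ (walk-close w (≤-trans (s≤s ℓ≤) 2r<n))) (code-injective (colour-valid x) (colour-valid y) eq)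
      where
      weaken : ∀ {x y ℓ} → ℓ ≤ r + r → Close x y ℓ → Close x y (r + r)
      weaken h (stay eq) = stay eq
      weaken h (along e i≤j j≤ j≤n xi yj) = along e i≤j (≤-trans j≤ (+-monoʳ-≤ _ h)) j≤n xi yj
      weaken h (through e e′ b i+j≤ xi yj) = through e e′ b (≤-trans i+j≤ h) xi yj

-- Encoding the colours as numbers.

clique-≤-colours : ∀ {H j k} → HasClique H j → Colourable H k → j ≤ k
clique-≤-colours (f , clique) (c , proper) = F.injective⇒≤ {f = c ∘ f}
  (λ {i} {j} eq → decidable-stable (i F.≟ j) (λ i≢j → proper _ _ (proj₂ (clique i j i≢j)) eq))

-- Positions start at 1, so they are shifted down by one. Valid letters have nonzero codes, which
-- reserves 0 for the branch vertices.
class-code : ∀ r → Class × ℕ → Fin (suc (3 * r))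
class-code r (c , k) with k ∸ 1 <? r
... | yes p = suc (F.combine c (fromℕ< p))
... | no _  = zero

index-bound : ∀ {r k} → InRange r k → k ∸ 1 < r
index-bound {k = suc k} (_ , h) = h

class-code-valid : ∀ {r c k} (v : InRange r k) → class-code r (c , k) ≡ suc (F.combine c (fromℕ< (index-bound v)))
class-code-valid {r} {c} {k} v with k ∸ 1 <? r
... | yes p = refl
... | no ¬p = contradiction (index-bound v) ¬p

class-code-injective : ∀ {r y z} → InRange r (proj₂ y) → InRange r (proj₂ z) → class-code r y ≡ class-code r z → y ≡ z
class-code-injective {y = c , suc k} {d , suc l} v w eq
  with F.combine-injective c _ d _ (F.suc-injective (trans (sym (class-code-valid {c = c} v)) (trans eq (class-code-valid {c = d} w))))
... | refl , eq′ = cong (λ i → c , suc i) (trans (sym (F.toℕ-fromℕ< (index-bound v))) (trans (cong toℕ eq′) (F.toℕ-fromℕ< (index-bound w))))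

plain-code : ∀ r → Plain → Fin (suc (3 * r))
plain-code r nothing  = zero
plain-code r (just z) = class-code r z

plain-code-injective : ∀ {r c d} → PlainValid r c → PlainValid r d → plain-code r c ≡ plain-code r d → c ≡ d
plain-code-injective {c = nothing} {nothing} v w eq = refl
plain-code-injective {c = nothing} {just z}  v w eq with () ← trans eq (class-code-valid w)
plain-code-injective {c = just z}  {nothing} v w eq with () ← trans (sym (class-code-valid v)) eq
plain-code-injective {c = just y}  {just z}  v w eq = cong just (class-code-injective v w eq)

-- The specials take 0 to 3. The code of a valid class letter is at least 1, so a shift by 3 clears
-- them.
special-code : ∀ r → Special → Fin (3 + suc (3 * r))
special-code r (inj₁ s) = F.inject≤ s (m≤m+n 4 (3 * r))
special-code r (inj₂ z) = 3 F.↑ʳ class-code r z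

special-code-injective : ∀ {r c d} → SpecialValid r c → SpecialValid r d → special-code r c ≡ special-code r d → c ≡ d
special-code-injective {r} {inj₁ s} {inj₁ u} v w eq = cong inj₁ (F.inject≤-injective _ _ s u eq)
special-code-injective {r} {inj₂ y} {inj₂ z} v w eq = cong inj₂ (class-code-injective v w (F.↑ʳ-injective 3 _ _ eq))
special-code-injective {r} {inj₁ s} {inj₂ (c , k)} v w eq = contradiction (trans (sym (F.toℕ-inject≤ s _)) (trans (cong toℕ eq) high)) (<⇒≢ (<-≤-trans (F.toℕ<n s) (m≤m+n 4 _)))
  where
  high : toℕ (3 F.↑ʳ class-code r (c , k)) ≡ 4 + toℕ (F.combine c (fromℕ< (index-bound w)))
  high = trans (F.toℕ-↑ʳ 3 (class-code r (c , k))) (cong (λ i → 3 + toℕ i) (class-code-valid w))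
special-code-injective {r} {inj₂ z} {inj₁ s} v w eq = sym (special-code-injective w v (sym eq))

-- Colouring with 3r + 1 colours for every remainder.

module Colouring (G : FinGraph)
  (subcubic : ∀ u (f : Fin 4 → Fin (N G)) → Injective _≡_ _≡_ f → ¬ (∀ i → adj G u (f i) ≡ true)) where

  open EdgeColouring (adj G) (FinGraph.sym G) (irref G) subcubic using (Matchings; edge-colouring)

  abstract
    matchings : ∃ λ M → ∀ u v → adj G u v ≡ true → Matchings.Covered M u v
    matchings = edge-colouring

  M : Matchings
  M = proj₁ matchings

  open Matchings M
  open Labelled M

  record Scheme (e w t : ℕ) : Set where
    field
      class           : Fin (N G) → Fin 4 → Class
      order           : Fin (N G) → Class → Bool
      class-injective : ∀ {v i j} → Used v i → Used v j → class v i ≡ class v j → i ≡ j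
      link            : ∀ {v i} → Used v i → ClassLink e w t (class v i) (class (mate i v) i) (order v) (order (mate i v))

  scheme : ∀ {R e w t} → Labelling R → (∀ {a b x y} → R a b x y → ClassLink e w t a b x y) → Scheme e w t
  scheme L link = record { class = class ; order = order ; class-injective = class-injective ; link = λ m → link (related m) }
    where open Labelling L

  short-scheme : ∀ e w → Scheme e w w
  short-scheme e w = scheme third-reversed λ {a} {b} {x} {y} (a≢b , d) →
    subst (λ t → ClassLink e w t a b x y) (trans (+-identityʳ (w + 0)) (+-identityʳ w)) (Mixed.mixed-link {e} {w} {0} a≢b d (inj₁ refl))

  -- For `z = 0` there are only `w` slots, too few for one class at both ends, and the labelling
  -- with different classes is used instead.
  long-scheme : ∀ w z → z + z ≤ w → Scheme 0 w (w + z + z)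
  long-scheme w zero _ = subst (Scheme 0 w) (sym (trans (+-identityʳ (w + 0)) (+-identityʳ w))) (short-scheme 0 w)
  long-scheme w (suc z) 2z≤w = scheme own-or-all-reversed λ
    { (inj₁ (refl , d))   → Same.same-link d above within-2w
    ; (inj₂ (a≢b , d)) → Mixed.mixed-link {0} {w} {suc z} a≢b (d _) (inj₂ (refl , 2z≤w , d _ , d _)) }
    where
    above : w < w + suc z + suc z
    above = lin (2 * z + 1) (≤-refl {0}) (solve (w ∷ z ∷ []))
    within-2w : w + suc z + suc z ≤ w + w
    within-2w = lin 0 2z≤w (solve (w ∷ z ∷ []))

  module Subdivided (n′ : ℕ) where
    open Subdivision G n′

    edge-colour : Edge G → Fin 4
    edge-colour (u , v , _ , uv) = proj₁ (proj₂ matchings u v (Equivalence.to B.T-≡ uv))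

    colour-of-half : HalfEdge → Fin 4
    colour-of-half (e , _) = edge-colour e

    mate-op : ∀ h → mate (colour-of-half h) (base h) ≡ base (op h)
    mate-op ((u , v , _ , uv) , false) = proj₂ (proj₂ matchings u v (Equivalence.to B.T-≡ uv))
    mate-op (e@(u , v , _ , uv) , true) = trans (cong (mate (edge-colour e)) (sym (mate-op (e , false)))) (involutive (edge-colour e) u)

    base-≢ : ∀ h → base (op h) ≢ base h
    base-≢ ((u , v , u<v , _) , false) eq = F.<-irrefl (sym eq) u<v
    base-≢ ((u , v , u<v , _) , true)  eq = F.<-irrefl eq u<v

    used-half : ∀ h → Used (base h) (colour-of-half h)
    used-half h eq = base-≢ h (trans (sym (mate-op h)) eq)

    -- The graph is simple and each edge is stored with its smaller end first, so the two ends
    -- determine the half-edge up to irrelevant proofs.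
    same-ends : ∀ {h h′} → base h ≡ base h′ → base (op h) ≡ base (op h′) → h ≡ h′
    same-ends {(u , v , p , q) , false} {(_ , _ , p′ , q′) , false} refl refl = cong₂ (λ p q → (u , v , p , q) , false) (<-irrelevant p p′) (B.T-irrelevant q q′)
    same-ends {(u , v , p , q) , true}  {(_ , _ , p′ , q′) , true}  refl refl = cong₂ (λ p q → (u , v , p , q) , true) (<-irrelevant p p′) (B.T-irrelevant q q′)
    same-ends {(u , v , p , _) , false} {(_ , _ , p′ , _) , true}  refl refl = contradiction p′ (<-asym p)
    same-ends {(u , v , p , _) , true}  {(_ , _ , p′ , _) , false} refl refl = contradiction p′ (<-asym p)

    half-injective : ∀ {h h′} → base h ≡ base h′ → colour-of-half h ≡ colour-of-half h′ → h ≡ h′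
    half-injective {h} {h′} b c = same-ends b (trans (sym (mate-op h)) (trans (cong₂ mate c b) (mate-op h′)))

    module _ {e w t k : ℕ} (scheme : Scheme e w t) where
      open Scheme scheme

      class-half : HalfEdge → Class
      class-half h = class (base h) (colour-of-half h)

      class-half-injective : ∀ {h h′} → base h ≡ base h′ → class-half h ≡ class-half h′ → h ≡ h′
      class-half-injective {h} {h′} b eq = half-injective b (class-injective (used-half h)
        (subst (λ v → Used v (colour-of-half h′)) (sym b) (used-half h′)) (trans eq (cong (λ v → class v (colour-of-half h′)) (sym b))))

      link-edge : ∀ d → ClassLink e w t (class-half (d , false)) (class-half (d , true)) (order (base (d , false))) (order (base (d , true)))
      link-edge d = subst (λ u → ClassLink e w t (class-half (d , false)) (class u (edge-colour d)) (order (base (d , false))) (order u))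
        (mate-op (d , false)) (link (used-half (d , false)))

      module _ (n≡ : k * suc ((e + w) + (e + w)) + suc ((e + w) + (e + w) + t) ≡ n) where

        plain-colourable : Colourable (fracPower G ((e + w) + (e + w)) n) (suc (3 * (e + w)))
        plain-colourable = Assembly.colourable (PlainValid r) r long (λ _ → nothing) (λ v → plain-position e w (order v)) side
          (λ _ → tt) (λ _ → refl) side-pos side-injective
          (λ d → word-of-total (PlainValid r) r (plain-link (link-edge d)) k n≡)
          (plain-code r) plain-code-injective
          where
          r = e + w
          side : HalfEdge → ℕ → Plain
          side h = plain-side e w (class-half h) (order (base h))
          long : r + r < n
          long = ≤-trans (≤-trans (s≤s (m≤m+n (r + r) t)) (m≤n+m _ (k * suc (r + r)))) (≤-reflexive n≡)
          side-pos : ∀ h {i} → i ≤ r → plain-position e w (order (base h)) (side h i) ≡ i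
          side-pos h {zero}  _   = refl
          side-pos h {suc i} i≤r = flip-flip (order (base h) (class-half h)) (s≤s z≤n , i≤r)
          side-injective : ∀ {h h′ i i′} → base h ≡ base h′ → 1 ≤ i → i ≤ r → i′ ≤ r → side h i ≡ side h′ i′ → h ≡ h′
          side-injective {i = suc i} {suc i′} b _ _ _ eq = class-half-injective b (class-of-just eq)
            where
            class-of-just : ∀ {y z : Class × ℕ} → just y ≡ just z → proj₁ y ≡ proj₁ z
            class-of-just refl = refl

      module _ (n≡ : k * suc (suc (e + w) + suc (e + w)) + suc (suc (e + w) + suc (e + w) + suc (suc t)) ≡ n) (r≤t : e + w ≤ t) where

        special-colourable : Colourable (fracPower G (suc (e + w) + suc (e + w)) n) (3 + suc (3 * (e + w)))
        special-colourable = Assembly.colourable (SpecialValid (e + w)) r long (λ v → inj₁ (centre-symbol v))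
          (λ v → special-position e w (centre-symbol v) (order v)) side (λ _ → tt) (λ _ → refl) side-pos side-injective
          (λ d → word-of-total (SpecialValid (e + w)) r (edge-link d) k n≡)
          (special-code (e + w)) special-code-injective
          where
          r = suc (e + w)
          outer-half : HalfEdge → Fin 4
          outer-half h = outer-symbol (base h) (colour-of-half h)
          side : HalfEdge → ℕ → Special
          side h = special-side e w (centre-symbol (base h)) (outer-half h) (class-half h) (order (base h))
          long : r + r < n
          long = ≤-trans (≤-trans (s≤s (m≤m+n (r + r) (suc (suc t)))) (m≤n+m _ (k * suc (r + r)))) (≤-reflexive n≡)
          view : ∀ h {i} → i ≤ r → SideView e w (centre-symbol (base h)) (outer-half h) (class-half h) (order (base h)) i
          view h = side-view e w (centre-symbol (base h)) (outer-half h) (class-half h) (order (base h))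
          side-pos : ∀ h {i} → i ≤ r → special-position e w (centre-symbol (base h)) (order (base h)) (side h i) ≡ i
          side-pos h i≤r with view h i≤r
          ... | centre refl eq = position-centre e w (centre-symbol (base h)) (outer-half h) (class-half h) (order (base h))
          ... | inner ri eq    = trans (cong (special-position e w _ _) eq) (flip-flip (order (base h) (class-half h)) ri)
          ... | outer refl eq  = trans (cong (special-position e w _ _) eq)
            (position-outer e w (centre-symbol (base h)) (outer-half h) (class-half h) (order (base h)) (outer-≢-centre (base h) (colour-of-half h)))
          outer-half-injective : ∀ {h h′} → base h ≡ base h′ → outer-half h ≡ outer-half h′ → h ≡ h′
          outer-half-injective {h} {h′} b eq = half-injective b (outer-injective (used-half h)
            (subst (λ v → Used v (colour-of-half h′)) (sym b) (used-half h′)) (trans eq (cong (λ v → outer-symbol v (colour-of-half h′)) (sym b))))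
          outer-≢ : ∀ h h′ → base h ≡ base h′ → outer-half h ≢ centre-symbol (base h′)
          outer-≢ h h′ b eq = outer-≢-centre (base h) (colour-of-half h) (trans eq (cong centre-symbol (sym b)))
          side-injective : ∀ {h h′ i i′} → base h ≡ base h′ → 1 ≤ i → i ≤ r → i′ ≤ r → side h i ≡ side h′ i′ → h ≡ h′
          side-injective {h} {h′} b 1≤i i≤r i′≤r eq with view h i≤r | view h′ i′≤r
          ... | centre refl _ | _           = contradiction 1≤i (λ ())
          ... | inner _ p     | inner _ q   = class-half-injective b (cong proj₁ (Sumₚ.inj₂-injective (trans (sym p) (trans eq q))))
          ... | outer _ p     | outer _ q   = outer-half-injective b (Sumₚ.inj₁-injective (trans (sym p) (trans eq q)))
          ... | outer _ p     | centre _ q  = contradiction (Sumₚ.inj₁-injective (trans (sym p) (trans eq q))) (outer-≢ h h′ b)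
          ... | inner _ p     | centre _ q  with () ← trans (sym p) (trans eq q)
          side-injective {h} {h′} b 1≤i i≤r i′≤r eq | inner _ p | outer _ q with () ← trans (sym p) (trans eq q)
          side-injective {h} {h′} b 1≤i i≤r i′≤r eq | outer _ p | inner _ q with () ← trans (sym p) (trans eq q)
          edge-link : ∀ d → Link (SpecialValid (e + w)) r (suc (suc t)) (side (d , false)) (side (d , true))
            (special-position e w (centre-symbol (base (d , false))) (order (base (d , false))))
            (special-position e w (centre-symbol (base (d , true))) (order (base (d , true))))
          edge-link d = build (two-specials _ _ _ _ centres outers)
            where
            v = base (d , false)
            u = base (d , true)
            i = edge-colour d
            centres : centre-symbol v ≢ centre-symbol u
            centres = subst (λ u → centre-symbol v ≢ centre-symbol u) (mate-op (d , false)) (centres-differ i (used-half (d , false)))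
            outers : outer-symbol v i ≢ outer-symbol u i
            outers = subst (λ u → outer-symbol v i ≢ outer-symbol u i) (mate-op (d , false)) (outers-differ i (used-half (d , false)))
            build : (∃₂ λ s u′ → s ≢ centre-symbol v × s ≢ outer-symbol v i × s ≢ outer-symbol u i ×
                u′ ≢ centre-symbol u × u′ ≢ outer-symbol v i × u′ ≢ outer-symbol u i × s ≢ u′) → _
            build (s , u′ , s≢f , s≢h , s≢k , u≢g , u≢h , u≢k , s≢u) =
              special-link (link-edge d) r≤t (outer-≢-centre v i) (outer-≢-centre u i) outers centres s≢f s≢h s≢k u≢g u≢h u≢k s≢u

  halve : ∀ s → ∃ λ z → s ≡ z + z ⊎ s ≡ suc (z + z)
  halve zero = 0 , inj₁ refl
  halve (suc s) with halve s
  ... | z , inj₁ eq = z , inj₂ (cong suc eq)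
  ... | z , inj₂ eq = suc z , inj₁ (trans (cong suc eq) (cong suc (sym (+-suc z z))))

  colourable-short : ∀ n′ k {e w} r → e + w ≡ r → k * suc (r + r) + suc (r + r + w) ≡ suc n′ →
    Colourable (fracPower G (r + r) (suc n′)) (suc (3 * r))
  colourable-short n′ k {e} {w} r refl eq = Subdivided.plain-colourable n′ {e} {w} {w} {k} (short-scheme e w) eq

  colourable-even : ∀ n′ k r z → z + z ≤ r → k * suc (r + r) + suc (r + r + (r + z + z)) ≡ suc n′ →
    Colourable (fracPower G (r + r) (suc n′)) (suc (3 * r))
  colourable-even n′ k r z h eq = Subdivided.plain-colourable n′ {0} {r} {r + z + z} {k} (long-scheme r z h) eq

  colourable-odd : ∀ n′ k r z → z + z ≤ r → k * suc (suc r + suc r) + suc (suc r + suc r + suc (suc (r + z + z))) ≡ suc n′ →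
    Colourable (fracPower G (suc r + suc r) (suc n′)) (suc (3 * suc r))
  colourable-odd n′ k r z h eq = subst (Colourable (fracPower G (suc r + suc r) (suc n′))) colours
    (Subdivided.special-colourable n′ {0} {r} {r + z + z} {k} (long-scheme r z h) eq (≤-trans (m≤m+n r z) (m≤m+n (r + z) z)))
    where
    colours : 3 + suc (3 * r) ≡ suc (3 * suc r)
    colours = solve (r ∷ [])

  colourable-by-remainder : ∀ n′ k r t → 1 ≤ r → t ≤ r + r → k * suc (r + r) + suc (r + r + t) ≡ suc n′ →
    Colourable (fracPower G (r + r) (suc n′)) (suc (3 * r))
  colourable-by-remainder n′ k r t 1≤r t≤2r eq with t ≤? r
  -- The `t` highest positions are reversed and the other `r ∸ t` stay fixed.
  ... | yes t≤r = colourable-short n′ k {r ∸ t} {t} r (m∸n+n≡m t≤r) eq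
  ... | no t≰r with m≤n⇒∃[o]m+o≡n (<⇒≤ (≰⇒> t≰r))
  ...   | s , refl with halve s
  ...     | z , inj₁ refl = colourable-even n′ k r z (+-cancelˡ-≤ r _ _ t≤2r)
              (trans (cong (λ x → k * suc (r + r) + suc (r + r + x)) (+-assoc r z z)) eq)
  -- The radius is now `suc r`, the classes have `r` colours, and two of the `t = r + 2z + 2` slots
  -- are left to the specials.
  colourable-by-remainder n′ k (suc r) t 1≤r t≤2r eq | no t≰r | s , refl | z , inj₂ refl =
    colourable-odd n′ k r z (s≤s⁻¹ (+-cancelˡ-≤ (suc r) _ _ t≤2r))
      (trans (cong (λ x → k * suc (suc r + suc r) + suc (suc r + suc r + x)) odd-sum) eq)
    where
    odd-sum : suc (suc (r + z + z)) ≡ suc r + suc (z + z)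
    odd-sum = solve (r ∷ z ∷ [])

  colourable : ∀ n r → 1 ≤ r → r + r < n → Colourable (fracPower G (r + r) n) (suc (3 * r))
  colourable (suc n′) r 1≤r (s≤s 2r≤n′) = colourable-by-remainder n′ (T₀ / suc (r + r)) r (T₀ % suc (r + r)) 1≤r
    (s≤s⁻¹ (m%n<n T₀ (suc (r + r)))) total
    where
    -- Dividing n - 1 - 2r by 2r + 1 gives the number of repeated stretches and the remainder t ≤
    -- 2r.
    T₀ : ℕ
    T₀ = n′ ∸ (r + r)
    rearrange : ∀ c q x → x ≡ q + c → c + suc (r + r + q) ≡ suc (r + r + x)
    rearrange c q x h = ≤-antisym (lin 0 (≤-reflexive (sym h)) (solve (c ∷ r ∷ q ∷ x ∷ []))) (lin 0 (≤-reflexive h) (solve (c ∷ r ∷ q ∷ x ∷ [])))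
    total : T₀ / suc (r + r) * suc (r + r) + suc (r + r + T₀ % suc (r + r)) ≡ suc n′
    total = trans (rearrange (T₀ / suc (r + r) * suc (r + r)) (T₀ % suc (r + r)) T₀ (m≡m%n+[m/n]*n T₀ (suc (r + r))))
      (cong suc (m+[n∸m]≡n 2r≤n′))

-- A clique and a colouring of the same size.

degree-≤ : ∀ G v → degree G v ≤ maxDegree G
degree-≤ G v = max-≥ (degree G) (allFin (N G)) (∈-allFin v)

theorem4p3 : (m n : ℕ) → 1 ≤ m → m < n → 2 ∣ m →
    (G : FinGraph) → maxDegree G ≡ 3 →
    ∃[ k ] (IsChromaticNumber (fracPower G m n) k × IsCliqueNumber (fracPower G m n) k)
theorem4p3 m n 1≤m m<n (divides r m≡r*2) G Δ≡3 with trans m≡r*2 (trans (*-comm r 2) (cong (r +_) (+-identityʳ r)))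
theorem4p3 m (suc n′) 1≤m m<n (divides r m≡r*2) G Δ≡3 | refl =
  suc (3 * r) , (coloured , λ j → clique-≤-colours ball) , (ball , λ j c → clique-≤-colours c coloured)
  where
  three : ∀ v → count (N G) (adj G v) ≤ 3
  three v = ≤-trans (≤-reflexive (sym (degree-count G v))) (≤-trans (degree-≤ G v) (≤-reflexive Δ≡3))
  subcubic : ∀ u (f : Fin 4 → Fin (N G)) → Injective _≡_ _≡_ f → ¬ (∀ i → adj G u (f i) ≡ true)
  subcubic u f inj adjacent = contradiction (≤-trans (count-≥ (N G) (adj G u) f inj adjacent) (three u)) 1+n≰n
  positive : 1 ≤ r
  positive = n≢0⇒n>0 (λ { refl → contradiction 1≤m (λ ()) })
  coloured : Colourable (fracPower G (r + r) (suc n′)) (suc (3 * r))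
  coloured = Colouring.colourable G subcubic (suc n′) r positive m<n
  ball : HasClique (fracPower G (r + r) (suc n′)) (suc (3 * r))
  ball with max-attained (degree G) (allFin (N G)) Δ≡3
  ... | v , deg with enumerate (N G) (adj G v)
  ...   | g , g-inj , vg rewrite trans (sym (degree-count G v)) deg = Subdivision.clique G n′ r m<n v g g-inj vg
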